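{- Let $\mathcal{R}_m$ be the partial order of c.e. many-one degrees with greatest element $\mathbf{1}$. The class of partial maps $\{\Phi\restriction[\mathbf{0},\mathbf{e}]:\mathbf{e}<\mathbf{1},\ \Phi\in\mathrm{Aut}(\mathcal{R}_m)\}$ is weakly uniformly definable: there is a first-order formula $\psi(x,y;\bar p)$ in the language of partial orders such that for each $\mathbf{e}<\mathbf{1}$ and each automorphism $\Phi$ of $\mathcal{R}_m$ there is a tuple $\bar{\mathbf{p}}$ in $\mathcal{R}_m$ with $\{(\mathbf{x},\mathbf{y}):\mathcal{R}_m\models\psi(\mathbf{x},\mathbf{y};\bar{\mathbf{p}})\}=\{(\mathbf{x},\Phi(\mathbf{x})):\mathbf{x}\le\mathbf{e}\}$.
   Context: $\mathcal{R}_m$ is the set of many-one degrees of c.e. sets ordered by $\le_m$ ($X\le_m Y$ iff some computable $f$, possibly with values TRUE/FALSE, satisfies $n\in X\Leftrightarrow f(n)\in Y$); $\mathbf{0},\mathbf{1}$ are its least and greatest elements. -}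

module Defs where

open import Level using (0ℓ)
open import Data.Nat using (ℕ; zero; suc; _<_)
open import Data.Fin using (Fin)
open import Data.Vec using (Vec; []; _∷_; lookup)
open import Data.Product using (Σ; _×_; _,_)
open import Data.Sum using (_⊎_)
open import Data.Empty using (⊥)
open import Data.Unit using (⊤)
open import Relation.Nullary using (¬_)
open import Function.Bundles using (_⇔_)

data Code : ℕ → Set where
  zer  : ∀ {n} → Code n
  succ : Code 1
  proj : ∀ {n} → Fin n → Code n
  comp : ∀ {m n} → Code m → Vec (Code n) m → Code n
  prec : ∀ {n} → Code n → Code (suc (suc n)) → Code (suc n)
  mu   : ∀ {n} → Code (suc n) → Code n

data _∙_⇓_ : ∀ {n} → Code n → Vec ℕ n → ℕ → Set
data _∙*_⇓_ : ∀ {m n} → Vec (Code n) m → Vec ℕ n → Vec ℕ m → Set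

data _∙_⇓_ where
  ev-zer  : ∀ {n} {xs : Vec ℕ n} → zer ∙ xs ⇓ 0
  ev-succ : ∀ {x} → succ ∙ (x ∷ []) ⇓ suc x
  ev-proj : ∀ {n} {i : Fin n} {xs} → proj i ∙ xs ⇓ lookup xs i
  ev-comp : ∀ {m n} {f : Code m} {gs : Vec (Code n) m} {xs ys v} →
            gs ∙* xs ⇓ ys → f ∙ ys ⇓ v → comp f gs ∙ xs ⇓ v
  ev-prec0 : ∀ {n} {g : Code n} {h xs v} →
             g ∙ xs ⇓ v → prec g h ∙ (0 ∷ xs) ⇓ v
  ev-precS : ∀ {n} {g : Code n} {h xs k r v} →
             prec g h ∙ (k ∷ xs) ⇓ r → h ∙ (k ∷ r ∷ xs) ⇓ v →
             prec g h ∙ (suc k ∷ xs) ⇓ v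
  ev-mu   : ∀ {n} {f : Code (suc n)} {xs k} →
            f ∙ (k ∷ xs) ⇓ 0 →
            (∀ j → j < k → Σ ℕ λ r → f ∙ (j ∷ xs) ⇓ suc r) →
            mu f ∙ xs ⇓ k

data _∙*_⇓_ where
  ev-[] : ∀ {n} {xs : Vec ℕ n} → [] ∙* xs ⇓ []
  ev-∷  : ∀ {m n} {g : Code n} {gs : Vec (Code n) m} {xs y ys} →
          g ∙ xs ⇓ y → gs ∙* xs ⇓ ys → (g ∷ gs) ∙* xs ⇓ (y ∷ ys)

-- W c : the c.e. set with index c (domain of the partial computable c).
-- Every c.e. set is W c for some c.
W : Code 1 → ℕ → Set
W c n = Σ ℕ λ v → c ∙ (n ∷ []) ⇓ v

-- Outputs of a reduction: 0 = FALSE, 1 = TRUE, k+2 = the number k.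
interp : (ℕ → Set) → ℕ → Set
interp Y zero = ⊥
interp Y (suc zero) = ⊤
interp Y (suc (suc k)) = Y k

_≤ₘ_ : (ℕ → Set) → (ℕ → Set) → Set
X ≤ₘ Y = Σ (Code 1) λ f → ∀ n → Σ ℕ λ v → (f ∙ (n ∷ []) ⇓ v) × (X n ⇔ interp Y v)

-- The structure R_m, presented on c.e. indices (degrees = ≡ₘ-classes)

_≤R_ : Code 1 → Code 1 → Set
a ≤R b = W a ≤ₘ W b

_≡R_ : Code 1 → Code 1 → Set
a ≡R b = (a ≤R b) × (b ≤R a)

IsTop : Code 1 → Set
IsTop t = ∀ d → d ≤R t

_<𝟏 : Code 1 → Set
e <𝟏 = ∀ t → IsTop t → (e ≤R t) × ¬ (t ≤R e)

-- Automorphisms of R_m, presented as maps on indices inducing an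
-- order-automorphism of the quotient by ≡R.
record Aut : Set where
  field
    map     : Code 1 → Code 1
    order   : ∀ a b → (a ≤R b) ⇔ (map a ≤R map b)
    onto    : ∀ b → Σ (Code 1) λ a → map a ≡R b

data Formula (n : ℕ) : Set where
  _≐_  : Fin n → Fin n → Formula n
  _≼_  : Fin n → Fin n → Formula n
  ⊥f   : Formula n
  ¬f_  : Formula n → Formula n
  _∧f_ : Formula n → Formula n → Formula n
  _∨f_ : Formula n → Formula n → Formula n
  _⇒f_ : Formula n → Formula n → Formula n
  ∀f   : Formula (suc n) → Formula n
  ∃f   : Formula (suc n) → Formula n

-- Tarskian satisfaction in R_m; equality of degrees is ≡R.
-- Variable 0 is the most recently bound one.
Sat : ∀ {n} → Formula n → Vec (Code 1) n → Set
Sat (i ≐ j) ρ = lookup ρ i ≡R lookup ρ j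
Sat (i ≼ j) ρ = lookup ρ i ≤R lookup ρ j
Sat ⊥f ρ = ⊥
Sat (¬f φ) ρ = ¬ Sat φ ρ
Sat (φ ∧f ψ) ρ = Sat φ ρ × Sat ψ ρ
Sat (φ ∨f ψ) ρ = Sat φ ρ ⊎ Sat ψ ρ
Sat (φ ⇒f ψ) ρ = Sat φ ρ → Sat ψ ρ
Sat (∀f φ) ρ = ∀ d → Sat φ (d ∷ ρ)
Sat (∃f φ) ρ = Σ (Code 1) λ d → Sat φ (d ∷ ρ)

{-# OPTIONS --safe #-}
-- Call a degree z prime if z ≤ x ∨ y implies z ≤ x or z ≤ y.  One finite-injury construction does the computability: given c.e. E
-- and a uniformly c.e. family A, it yields uniformly c.e. primes W₀, W₁, … such that Wᵢ bounds the columns of Aᵢ, is not below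
-- towerᵢ = E ⊕ W₀ ⊕ … ⊕ Wᵢ₋₁, and has in common with towerᵢ only degrees below finitely many columns of Aᵢ, provided that towerᵢ
-- is incomplete.
--
-- Let e < 𝟏 be nonzero and let x₀, x₁, … enumerate the degrees below e.  Repeated use of the construction gives independent primes
-- bᵢ over e with an upper bound β that has meet 𝟎 with e, an antichain of primes uᵢ with meet(uᵢ, e) = xᵢ whose meet with β is
-- b₀ ∨ … ∨ bᵢ, and an exact pair γ, δ for the ideal generated by the uᵢ.  The uᵢ are the maximal primes of that ideal, and uᵢ comes
-- before uⱼ iff everything below β and uᵢ is below uⱼ.  So e, γ, δ, β define a copy of ω together with the map i ↦ xᵢ, and their
-- images under Φ define another copy with i ↦ Φ(xᵢ).  The two copies are matched by finite back-and-forth systems: a pair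
-- (uᵢ, Φ(uᵢ)) is coded by primes over uᵢ ∨ tᵢ and Φ(uᵢ) ∨ tᵢ, where t₀, …, tₙ are primes independent of everything before.
module Submission where

open import Defs
open import Level using (0ℓ)
open import Axiom.ExcludedMiddle using (ExcludedMiddle)
open import Data.Nat using (ℕ; zero; suc; _+_; _*_; _∸_; _≤_; _<_; z≤n; s≤s; pred; _⊔_)
open import Data.Nat.Induction using (<-rec)
open import Data.Nat.Properties
open import Data.Fin using (Fin; zero; suc; toℕ)
open import Data.Vec using (Vec; []; _∷_; lookup; head; tail)
open import Data.Product using (Σ; _×_; _,_; proj₁; proj₂; ∃)
open import Data.Sum using (_⊎_; inj₁; inj₂; [_,_]′; map)
open import Data.Empty using (⊥; ⊥-elim)
open import Data.Unit using (⊤; tt)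
open import Relation.Nullary using (¬_; Dec; yes; no)
open import Relation.Binary.PropositionalEquality using (_≡_; _≢_; refl; sym; trans; cong; cong₂; subst; subst₂)
open import Relation.Binary.Definitions using (tri<; tri≈; tri>)
open import Function.Bundles using (_⇔_; mk⇔; Equivalence)

-- Computable functions

-- The heart of the construction is the clause on common lower bounds. If f reduces Q to Wᵢ and g
-- reduces Q to towerᵢ, then coding `K` into the values of f would compute `K` from the tower
-- through g. As the tower is incomplete, the requirement for f and g stops after finitely many
-- actions, and from then on the root of each value of f ends up in Wᵢ, below a fixed bound, or in
-- one of finitely many columns. Requirement r freezes only in columns beyond r, so each column
-- keeps Aᵢ up to finitely many elements. Bases must be incomplete, and this is where e < 𝟏 enters;
-- joins preserve incompleteness because `K` itself is join-prime, a fact that the same construction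
-- yields. Comparing position n of one copy of ω with a position of the other takes only a finite
-- matching of the positions up to n. Such a matching is coded by three degrees, over which the
-- formula quantifies, so one formula serves all n and its eight parameters are e, γ, δ, β and their
-- images. The images behave like the originals because every notion involved is first-order.

record Fn {n} (f : Vec ℕ n → ℕ) : Set where
  constructor fn
  field
    code : Code n
    eval : ∀ ρ → code ∙ ρ ⇓ f ρ
open Fn public

infixr 5 _∷ᶠ_
data Fns {n} : ∀ {m} → (Vec ℕ n → Vec ℕ m) → Set where
  []ᶠ  : Fns (λ _ → [])
  _∷ᶠ_ : ∀ {m f} {gs : Vec ℕ n → Vec ℕ m} → Fn f → Fns gs → Fns (λ ρ → f ρ ∷ gs ρ)

codes : ∀ {n m} {gs : Vec ℕ n → Vec ℕ m} → Fns gs → Vec (Code n) m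
codes []ᶠ = []
codes (f ∷ᶠ gs) = code f ∷ codes gs

evals : ∀ {n m} {gs : Vec ℕ n → Vec ℕ m} (G : Fns gs) → ∀ ρ → codes G ∙* ρ ⇓ gs ρ
evals []ᶠ ρ = ev-[]
evals (f ∷ᶠ gs) ρ = ev-∷ (eval f ρ) (evals gs ρ)

infixr 4 _$ᶠ_
_$ᶠ_ : ∀ {n m} {f : Vec ℕ m → ℕ} {gs : Vec ℕ n → Vec ℕ m} → Fn f → Fns gs → Fn (λ ρ → f (gs ρ))
F $ᶠ G = fn (comp (code F) (codes G)) (λ ρ → ev-comp (evals G ρ) (eval F _))

Fn-ext : ∀ {n} {f g : Vec ℕ n → ℕ} → (∀ ρ → f ρ ≡ g ρ) → Fn f → Fn g
Fn-ext e F = fn (code F) (λ ρ → subst (code F ∙ ρ ⇓_) (e ρ) (eval F ρ))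

vr : ∀ {n} (i : Fin n) → Fn (λ ρ → lookup ρ i)
vr i = fn (proj i) (λ ρ → ev-proj)

pattern #0 = zero
pattern #1 = suc #0
pattern #2 = suc #1
pattern #3 = suc #2
pattern #4 = suc #3
pattern #5 = suc #4
pattern #6 = suc #5
pattern #7 = suc #6
pattern #8 = suc #7
pattern #9 = suc #8

v0 : ∀ {n} → Fn {1 + n} (λ ρ → lookup ρ #0)
v0 = vr #0
v1 : ∀ {n} → Fn {2 + n} (λ ρ → lookup ρ #1)
v1 = vr #1
v2 : ∀ {n} → Fn {3 + n} (λ ρ → lookup ρ #2)
v2 = vr #2
v3 : ∀ {n} → Fn {4 + n} (λ ρ → lookup ρ #3)
v3 = vr #3
v4 : ∀ {n} → Fn {5 + n} (λ ρ → lookup ρ #4)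
v4 = vr #4
v5 : ∀ {n} → Fn {6 + n} (λ ρ → lookup ρ #5)
v5 = vr #5
v6 : ∀ {n} → Fn {7 + n} (λ ρ → lookup ρ #6)
v6 = vr #6
v7 : ∀ {n} → Fn {8 + n} (λ ρ → lookup ρ #7)
v7 = vr #7

x0 : ∀ {n} → Vec ℕ (1 + n) → ℕ
x0 ρ = lookup ρ #0
x1 : ∀ {n} → Vec ℕ (2 + n) → ℕ
x1 ρ = lookup ρ #1
x2 : ∀ {n} → Vec ℕ (3 + n) → ℕ
x2 ρ = lookup ρ #2
x3 : ∀ {n} → Vec ℕ (4 + n) → ℕ
x3 ρ = lookup ρ #3
x4 : ∀ {n} → Vec ℕ (5 + n) → ℕ
x4 ρ = lookup ρ #4

sucᶠ : ∀ {n} {f : Vec ℕ n → ℕ} → Fn f → Fn (λ ρ → suc (f ρ))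
sucᶠ F = fn (comp succ (code F ∷ [])) (λ ρ → ev-comp (ev-∷ (eval F ρ) ev-[]) ev-succ)

kn : ∀ {n} (k : ℕ) → Fn {n} (λ _ → k)
kn zero = fn zer (λ ρ → ev-zer)
kn (suc k) = sucᶠ (kn k)

nrec : ℕ → (ℕ → ℕ → ℕ) → ℕ → ℕ
nrec z s zero = z
nrec z s (suc k) = s k (nrec z s k)

recᶠ : ∀ {n} {z : Vec ℕ n → ℕ} {s : Vec ℕ (suc (suc n)) → ℕ} → Fn z → Fn s →
       Fn {suc n} (λ ρ → nrec (z (tail ρ)) (λ k r → s (k ∷ r ∷ tail ρ)) (head ρ))
recᶠ {n} {z} {s} Z S = fn (prec (code Z) (code S)) (λ { (k ∷ ρ) → go k ρ })
  where
  go : ∀ k ρ → prec (code Z) (code S) ∙ (k ∷ ρ) ⇓ nrec (z ρ) (λ k r → s (k ∷ r ∷ ρ)) k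
  go zero ρ = ev-prec0 (eval Z ρ)
  go (suc k) ρ = ev-precS (go k ρ) (eval S _)

weaken : ∀ {n m} {gs : Vec ℕ n → Vec ℕ m} → Fns gs → Fns {suc n} (λ ρ → gs (tail ρ))
weaken []ᶠ = []ᶠ
weaken (F ∷ᶠ G) = wk F ∷ᶠ weaken G
  where
  allF : ∀ k {m} (i : Fin m → Fin k) → Vec (Code k) m
  allF k {zero} i = []
  allF k {suc m} i = proj (i zero) ∷ allF k (λ j → i (suc j))
  allE : ∀ {k m} (i : Fin m → Fin k) (ρ : Vec ℕ k) (xs : Vec ℕ m) →
         (∀ j → lookup ρ (i j) ≡ lookup xs j) → allF k i ∙* ρ ⇓ xs
  allE i ρ [] e = ev-[]
  allE i ρ (x ∷ xs) e = ev-∷ (subst (proj (i zero) ∙ ρ ⇓_) (e zero) ev-proj) (allE (λ j → i (suc j)) ρ xs (λ j → e (suc j)))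
  wk : ∀ {n f} → Fn {n} f → Fn {suc n} (λ ρ → f (tail ρ))
  wk F = fn (comp (code F) (allF _ suc)) (λ { (x ∷ ρ) → ev-comp (allE suc (x ∷ ρ) ρ (λ j → refl)) (eval F ρ) })

-- `Vec` has no eta rule, so the tuple of all projections equals ρ only up to a proof; `minᶠ` uses
-- it to carry its parameters through the recursion.
vs : ∀ n → Σ (Vec ℕ n → Vec ℕ n) λ g → Fns g × (∀ ρ → g ρ ≡ ρ)
vs zero = (λ _ → []) , []ᶠ , λ { [] → refl }
vs (suc n) with vs n
... | g , G , e = (λ ρ → lookup ρ zero ∷ g (tail ρ)) , (v0 ∷ᶠ weaken G) , λ { (x ∷ ρ) → cong (x ∷_) (e ρ) }

infixl 6 _+ᶠ_ _∸ᶠ_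
infixl 7 _*ᶠ_

private
  +' : Fn {2} (λ ρ → lookup ρ zero + lookup ρ (suc zero))
  +' = Fn-ext (λ { (a ∷ b ∷ []) → e a b }) (recᶠ {1} v0 (sucᶠ v1))
    where
    e : ∀ a b → nrec b (λ k r → suc r) a ≡ a + b
    e zero b = refl
    e (suc a) b = cong suc (e a b)

_+ᶠ_ : ∀ {n} {f g : Vec ℕ n → ℕ} → Fn f → Fn g → Fn (λ ρ → f ρ + g ρ)
F +ᶠ G = +' $ᶠ F ∷ᶠ G ∷ᶠ []ᶠ

private
  *' : Fn {2} (λ ρ → lookup ρ zero * lookup ρ (suc zero))
  *' = Fn-ext (λ { (a ∷ b ∷ []) → e a b }) (recᶠ {1} (kn 0) (v2 +ᶠ v1))
    where
    e : ∀ a b → nrec 0 (λ k r → b + r) a ≡ a * b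
    e zero b = refl
    e (suc a) b = cong (b +_) (e a b)

_*ᶠ_ : ∀ {n} {f g : Vec ℕ n → ℕ} → Fn f → Fn g → Fn (λ ρ → f ρ * g ρ)
F *ᶠ G = *' $ᶠ F ∷ᶠ G ∷ᶠ []ᶠ

private
  pred' : Fn {1} (λ ρ → pred (lookup ρ zero))
  pred' = Fn-ext (λ { (a ∷ []) → e a }) (recᶠ {0} (kn 0) v0)
    where
    e : ∀ a → nrec 0 (λ k r → k) a ≡ pred a
    e zero = refl
    e (suc a) = refl

predᶠ : ∀ {n} {f : Vec ℕ n → ℕ} → Fn f → Fn (λ ρ → pred (f ρ))
predᶠ F = pred' $ᶠ F ∷ᶠ []ᶠ

private
  ∸' : Fn {2} (λ ρ → lookup ρ (suc zero) ∸ lookup ρ zero)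
  ∸' = Fn-ext (λ { (a ∷ b ∷ []) → e a b }) (recᶠ {1} v0 (predᶠ v1))
    where
    e : ∀ a b → nrec b (λ k r → pred r) a ≡ b ∸ a
    e zero b = refl
    e (suc a) b = trans (cong pred (e a b)) (pred[m∸n]≡m∸[1+n] b a)

_∸ᶠ_ : ∀ {n} {f g : Vec ℕ n → ℕ} → Fn f → Fn g → Fn (λ ρ → f ρ ∸ g ρ)
F ∸ᶠ G = ∸' $ᶠ G ∷ᶠ F ∷ᶠ []ᶠ

-- Decidable relations; the characteristic function takes the value 0 on true instances, as the μ-operator of Code wants.

record Dc {n} (P : Vec ℕ n → Set) : Set where
  constructor dc
  field
    χ    : Vec ℕ n → ℕ
    χᶠ   : Fn χ
    spec : ∀ ρ → (χ ρ ≡ 0 × P ρ) ⊎ (χ ρ ≡ 1 × ¬ P ρ)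
open Dc public

toDec : ∀ {P : Set} {c : ℕ} → (c ≡ 0 × P) ⊎ (c ≡ 1 × ¬ P) → Dec P
toDec (inj₁ (_ , p)) = yes p
toDec (inj₂ (_ , p)) = no p

dec : ∀ {n} {P : Vec ℕ n → Set} → Dc P → ∀ ρ → Dec (P ρ)
dec D ρ = toDec (spec D ρ)

Dc-ext : ∀ {n} {P Q : Vec ℕ n → Set} → (∀ ρ → P ρ → Q ρ) → (∀ ρ → Q ρ → P ρ) → Dc P → Dc Q
Dc-ext {P = P} {Q} f g D = dc (χ D) (χᶠ D) s
  where
  s : ∀ ρ → (χ D ρ ≡ 0 × Q ρ) ⊎ (χ D ρ ≡ 1 × ¬ Q ρ)
  s ρ with spec D ρ
  ... | inj₁ (e , p) = inj₁ (e , f ρ p)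
  ... | inj₂ (e , p) = inj₂ (e , λ q → p (g ρ q))

infixr 4 _$ᵈ_
_$ᵈ_ : ∀ {n m} {P : Vec ℕ m → Set} {gs : Vec ℕ n → Vec ℕ m} → Dc P → Fns gs → Dc (λ ρ → P (gs ρ))
D $ᵈ G = dc _ (χᶠ D $ᶠ G) (λ ρ → spec D _)

infix 3 _≤ᵈ_ _<ᵈ_ _≡ᵈ_ ¬ᵈ_
infixr 0 _→ᵈ_
infixr 2 _×ᵈ_
infixr 1 _⊎ᵈ_

_≤ᵈ_ : ∀ {n} {f g : Vec ℕ n → ℕ} → Fn f → Fn g → Dc (λ ρ → f ρ ≤ g ρ)
_≤ᵈ_ {n} {f} {g} F G = dc _ (kn 1 ∸ᶠ (kn 1 ∸ᶠ (F ∸ᶠ G))) s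
  where
  s : ∀ ρ → (1 ∸ (1 ∸ (f ρ ∸ g ρ)) ≡ 0 × f ρ ≤ g ρ) ⊎ (1 ∸ (1 ∸ (f ρ ∸ g ρ)) ≡ 1 × ¬ f ρ ≤ g ρ)
  s ρ with f ρ ∸ g ρ in e
  ... | zero = inj₁ (refl , m∸n≡0⇒m≤n e)
  ... | suc k = inj₂ (cong (1 ∸_) (0∸n≡0 k) , λ le → 0≢1+n (trans (sym (m≤n⇒m∸n≡0 le)) e))

_<ᵈ_ : ∀ {n} {f g : Vec ℕ n → ℕ} → Fn f → Fn g → Dc (λ ρ → f ρ < g ρ)
F <ᵈ G = sucᶠ F ≤ᵈ G

_×ᵈ_ : ∀ {n} {P Q : Vec ℕ n → Set} → Dc P → Dc Q → Dc (λ ρ → P ρ × Q ρ)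
_×ᵈ_ {n} {P} {Q} D E = dc _ (kn 1 ∸ᶠ ((kn 1 ∸ᶠ χᶠ D) *ᶠ (kn 1 ∸ᶠ χᶠ E))) s
  where
  s : ∀ ρ → (1 ∸ (1 ∸ χ D ρ) * (1 ∸ χ E ρ) ≡ 0 × (P ρ × Q ρ)) ⊎ (1 ∸ (1 ∸ χ D ρ) * (1 ∸ χ E ρ) ≡ 1 × ¬ (P ρ × Q ρ))
  s ρ with χ D ρ | spec D ρ | χ E ρ | spec E ρ
  ... | _ | inj₁ (refl , p) | _ | inj₁ (refl , q) = inj₁ (refl , p , q)
  ... | _ | inj₁ (refl , p) | _ | inj₂ (refl , q) = inj₂ (refl , λ z → q (proj₂ z))
  ... | _ | inj₂ (refl , p) | _ | _ = inj₂ (refl , λ z → p (proj₁ z))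

¬ᵈ_ : ∀ {n} {P : Vec ℕ n → Set} → Dc P → Dc (λ ρ → ¬ P ρ)
¬ᵈ_ {n} {P} D = dc _ (kn 1 ∸ᶠ χᶠ D) s
  where
  s : ∀ ρ → (1 ∸ χ D ρ ≡ 0 × ¬ P ρ) ⊎ (1 ∸ χ D ρ ≡ 1 × ¬ ¬ P ρ)
  s ρ with χ D ρ | spec D ρ
  ... | _ | inj₁ (refl , p) = inj₂ (refl , λ z → z p)
  ... | _ | inj₂ (refl , p) = inj₁ (refl , p)

_⊎ᵈ_ : ∀ {n} {P Q : Vec ℕ n → Set} → Dc P → Dc Q → Dc (λ ρ → P ρ ⊎ Q ρ)
_⊎ᵈ_ {n} {P} {Q} D E = Dc-ext f g (¬ᵈ (¬ᵈ D ×ᵈ ¬ᵈ E))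
  where
  f : ∀ ρ → ¬ (¬ P ρ × ¬ Q ρ) → P ρ ⊎ Q ρ
  f ρ h with dec D ρ | dec E ρ
  ... | yes p | _ = inj₁ p
  ... | no _ | yes q = inj₂ q
  ... | no p | no q = ⊥-elim (h (p , q))
  g : ∀ ρ → P ρ ⊎ Q ρ → ¬ (¬ P ρ × ¬ Q ρ)
  g ρ (inj₁ p) (a , b) = a p
  g ρ (inj₂ p) (a , b) = b p

_→ᵈ_ : ∀ {n} {P Q : Vec ℕ n → Set} → Dc P → Dc Q → Dc (λ ρ → P ρ → Q ρ)
_→ᵈ_ {n} {P} {Q} D E = Dc-ext f g (¬ᵈ (D ×ᵈ ¬ᵈ E))
  where
  f : ∀ ρ → ¬ (P ρ × ¬ Q ρ) → P ρ → Q ρ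
  f ρ h p with dec E ρ
  ... | yes q = q
  ... | no q = ⊥-elim (h (p , q))
  g : ∀ ρ → (P ρ → Q ρ) → ¬ (P ρ × ¬ Q ρ)
  g ρ h (p , q) = q (h p)

_≡ᵈ_ : ∀ {n} {f g : Vec ℕ n → ℕ} → Fn f → Fn g → Dc (λ ρ → f ρ ≡ g ρ)
F ≡ᵈ G = Dc-ext (λ ρ → λ { (a , b) → ≤-antisym a b }) (λ ρ e → ≤-reflexive e , ≤-reflexive (sym e)) ((F ≤ᵈ G) ×ᵈ (G ≤ᵈ F))

falseᵈ : ∀ {n} → Dc {n} (λ _ → ⊥)
falseᵈ = dc (λ _ → 1) (kn 1) (λ ρ → inj₂ (refl , λ z → z))

-- Least witness below b, or b itself if there is none.
minStep : (ℕ → ℕ) → ℕ → ℕ → ℕ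
minStep c k r = r + (1 ∸ (k ∸ r)) * c k

minχ : (ℕ → ℕ) → ℕ → ℕ
minχ c = nrec 0 (minStep c)

record IsMin (P : ℕ → Set) (b m : ℕ) : Set where
  field
    bounded : m ≤ b
    holds   : m < b → P m
    least   : ∀ j → j < m → ¬ P j
open IsMin public

minχ-spec : (P : ℕ → Set) (c : ℕ → ℕ) → (∀ k → (c k ≡ 0 × P k) ⊎ (c k ≡ 1 × ¬ P k)) → ∀ b → IsMin P b (minχ c b)
minχ-spec P c sp zero = record { bounded = z≤n ; holds = λ () ; least = λ j () }
minχ-spec P c sp (suc b) with minχ c b | minχ-spec P c sp b
... | r | ih with m≤n⇒m<n∨m≡n (bounded ih)
... | inj₁ lt = subst (IsMin P (suc b)) (sym eq)
      record { bounded = ≤-trans (bounded ih) (n≤1+n b) ; holds = λ _ → holds ih lt ; least = least ih }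
  where
  -- Once a witness r < b is found, the factor `1 ∸ (b ∸ r)` is 0 and the search stands still; while
  -- r = b the factor is 1 and r moves on by `c b`.
  eq : minStep c b r ≡ r
  eq with b ∸ r | m<n⇒0<n∸m lt
  ... | suc d | _ rewrite 0∸n≡0 d = +-identityʳ r
... | inj₂ refl with sp b
... | inj₁ (e , p) = subst (IsMin P (suc b)) (sym eq)
      record { bounded = n≤1+n b ; holds = λ _ → p ; least = least ih }
  where
  eq : minStep c b b ≡ b
  eq rewrite n∸n≡0 b | e = +-identityʳ b
... | inj₂ (e , p) = subst (IsMin P (suc b)) (sym eq)
      record { bounded = ≤-refl ; holds = λ lt → ⊥-elim (<-irrefl refl lt) ; least = l }
  where
  eq : minStep c b b ≡ suc b
  eq rewrite n∸n≡0 b | e = +-comm b 1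
  l : ∀ j → j < suc b → ¬ P j
  l j (s≤s j≤b) with m≤n⇒m<n∨m≡n j≤b
  ... | inj₁ lt = least ih j lt
  ... | inj₂ refl = p

min : ∀ {n} {P : Vec ℕ (suc n) → Set} → Dc P → Vec ℕ n → ℕ → ℕ
min D ρ b = minχ (λ k → χ D (k ∷ ρ)) b

min-spec : ∀ {n} {P : Vec ℕ (suc n) → Set} (D : Dc P) ρ b → IsMin (λ k → P (k ∷ ρ)) b (min D ρ b)
min-spec D ρ b = minχ-spec _ _ (λ k → spec D (k ∷ ρ)) b

minᶠ : ∀ {n} {P : Vec ℕ (suc n) → Set} {b : Vec ℕ n → ℕ} (D : Dc P) → Fn b → Fn (λ ρ → min D ρ (b ρ))
minᶠ {n} {P} {b} D B with vs n
... | g , G , e = Fn-ext (λ ρ → cong (λ σ → minχ (λ k → χ D (k ∷ σ)) (b ρ)) (trans (cong g (e ρ)) (e ρ)))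
   (recᶠ (kn 0) (v1 +ᶠ (kn 1 ∸ᶠ (v0 ∸ᶠ v1)) *ᶠ (χᶠ D $ᶠ v0 ∷ᶠ weaken (weaken G))) $ᶠ B ∷ᶠ G)

∃ᵈ : ∀ {n} {P : Vec ℕ (suc n) → Set} {b : Vec ℕ n → ℕ} → Fn b → Dc P → Dc (λ ρ → ∃ λ k → k < b ρ × P (k ∷ ρ))
∃ᵈ {n} {P} {b} B D = Dc-ext f g (minᶠ D B <ᵈ B)
  where
  f : ∀ ρ → min D ρ (b ρ) < b ρ → ∃ λ k → k < b ρ × P (k ∷ ρ)
  f ρ lt = _ , lt , holds (min-spec D ρ (b ρ)) lt
  g : ∀ ρ → (∃ λ k → k < b ρ × P (k ∷ ρ)) → min D ρ (b ρ) < b ρ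
  g ρ (k , lt , p) = ≤-<-trans (≮⇒≥ (λ lt' → least (min-spec D ρ (b ρ)) k lt' p)) lt

∀ᵈ : ∀ {n} {P : Vec ℕ (suc n) → Set} {b : Vec ℕ n → ℕ} → Fn b → Dc P → Dc (λ ρ → ∀ k → k < b ρ → P (k ∷ ρ))
∀ᵈ {n} {P} {b} B D = Dc-ext f g (¬ᵈ ∃ᵈ B (¬ᵈ D))
  where
  f : ∀ ρ → ¬ (∃ λ k → k < b ρ × ¬ P (k ∷ ρ)) → ∀ k → k < b ρ → P (k ∷ ρ)
  f ρ h k lt with dec D (k ∷ ρ)
  ... | yes p = p
  ... | no p = ⊥-elim (h (k , lt , p))
  g : ∀ ρ → (∀ k → k < b ρ → P (k ∷ ρ)) → ¬ (∃ λ k → k < b ρ × ¬ P (k ∷ ρ))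
  g ρ h (k , lt , p) = p (h k lt)

choose : ∀ {P : Set} → Dec P → ℕ → ℕ → ℕ
choose (yes _) a b = a
choose (no _) a b = b

choose-yes : ∀ {P : Set} (d : Dec P) {a b} → P → choose d a b ≡ a
choose-yes (yes _) p = refl
choose-yes (no n) p = ⊥-elim (n p)

choose-no : ∀ {P : Set} (d : Dec P) {a b} → ¬ P → choose d a b ≡ b
choose-no (yes p) n = ⊥-elim (n p)
choose-no (no _) n = refl

ifᶠ : ∀ {n} {P : Vec ℕ n → Set} {f g : Vec ℕ n → ℕ} (D : Dc P) → Fn f → Fn g → Fn (λ ρ → choose (dec D ρ) (f ρ) (g ρ))
ifᶠ {n} {P} {f} {g} D F G = Fn-ext (λ ρ → e (spec D ρ)) ((kn 1 ∸ᶠ χᶠ D) *ᶠ F +ᶠ χᶠ D *ᶠ G)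
  where
  e : ∀ {P : Set} {c a b} (s : (c ≡ 0 × P) ⊎ (c ≡ 1 × ¬ P)) → (1 ∸ c) * a + c * b ≡ choose (toDec s) a b
  e (inj₁ (refl , p)) = trans (+-identityʳ _) (+-identityʳ _)
  e (inj₂ (refl , p)) = +-identityʳ _

deterministic : ∀ {n} {c : Code n} {xs u v} → c ∙ xs ⇓ u → c ∙ xs ⇓ v → u ≡ v
deterministic* : ∀ {m n} {c : Vec (Code n) m} {xs u v} → c ∙* xs ⇓ u → c ∙* xs ⇓ v → u ≡ v
deterministic ev-zer ev-zer = refl
deterministic ev-succ ev-succ = refl
deterministic ev-proj ev-proj = refl
deterministic (ev-comp a b) (ev-comp c d) with deterministic* a c
... | refl = deterministic b d
deterministic (ev-prec0 a) (ev-prec0 b) = deterministic a b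
deterministic (ev-precS a b) (ev-precS c d) with deterministic a c
... | refl = deterministic b d
deterministic (ev-mu {k = k} a f) (ev-mu {k = l} b g) with <-cmp k l
... | tri≈ _ e _ = e
... | tri< lt _ _ with deterministic a (proj₂ (g k lt))
... | ()
deterministic (ev-mu {k = k} a f) (ev-mu {k = l} b g) | tri> _ _ gt with deterministic (proj₂ (f l gt)) b
... | ()
deterministic* ev-[] ev-[] = refl
deterministic* (ev-∷ a b) (ev-∷ c d) = cong₂ _∷_ (deterministic a c) (deterministic* b d)

-- Unbounded search, and c.e. sets as projections of decidable relations

module _ {n} {P : Vec ℕ (suc n) → Set} (D : Dc P) where

  private
    least-witness : ∀ {ρ} s → P (s ∷ ρ) → ∃ λ m → P (m ∷ ρ) × (∀ j → j < m → ¬ P (j ∷ ρ))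
    least-witness {ρ} s p = _ , holds M lt , least M
      where
      M = min-spec D ρ (suc s)
      lt : min D ρ (suc s) < suc s
      lt = ≤-<-trans (≮⇒≥ (λ lt' → least M s lt' p)) (n<1+n s)

    χ≡0 : ∀ {ρ} → P ρ → χ D ρ ≡ 0
    χ≡0 {ρ} p with spec D ρ
    ... | inj₁ (e , _) = e
    ... | inj₂ (_ , q) = ⊥-elim (q p)

    χ≡1 : ∀ {ρ} → ¬ P ρ → χ D ρ ≡ 1
    χ≡1 {ρ} p with spec D ρ
    ... | inj₁ (_ , q) = ⊥-elim (p q)
    ... | inj₂ (e , _) = e

    μ-eval : ∀ {ρ m} → P (m ∷ ρ) → (∀ j → j < m → ¬ P (j ∷ ρ)) → mu (code (χᶠ D)) ∙ ρ ⇓ m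
    μ-eval {ρ} {m} p l = ev-mu (subst (code (χᶠ D) ∙ (m ∷ ρ) ⇓_) (χ≡0 p) (eval (χᶠ D) _))
      (λ j lt → 0 , subst (code (χᶠ D) ∙ (j ∷ ρ) ⇓_) (χ≡1 (l j lt)) (eval (χᶠ D) _))

  searchᶠ : (∀ ρ → ∃ λ s → P (s ∷ ρ)) → Σ (Vec ℕ n → ℕ) λ f → Fn f × (∀ ρ → P (f ρ ∷ ρ))
  searchᶠ tot = (λ ρ → proj₁ (w ρ)) , fn (mu (code (χᶠ D))) (λ ρ → μ-eval (proj₁ (proj₂ (w ρ))) (proj₂ (proj₂ (w ρ)))) ,
                λ ρ → proj₁ (proj₂ (w ρ))
    where
    w : ∀ ρ → ∃ λ m → P (m ∷ ρ) × (∀ j → j < m → ¬ P (j ∷ ρ))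
    w ρ = least-witness (proj₁ (tot ρ)) (proj₂ (tot ρ))

  projection : Code n
  projection = mu (code (χᶠ D))

  projection-spec : ∀ {ρ} → (∃ λ v → projection ∙ ρ ⇓ v) ⇔ (∃ λ s → P (s ∷ ρ))
  projection-spec {ρ} = mk⇔ to from
    where
    to : (∃ λ v → projection ∙ ρ ⇓ v) → ∃ λ s → P (s ∷ ρ)
    to (v , ev-mu {k = k} h _) with spec D (k ∷ ρ)
    ... | inj₁ (_ , p) = k , p
    ... | inj₂ (e , _) with trans (deterministic h (eval (χᶠ D) _)) e
    ... | ()
    from : (∃ λ s → P (s ∷ ρ)) → ∃ λ v → projection ∙ ρ ⇓ v
    from (s , p) with least-witness s p
    ... | m , q , l = m , μ-eval q l

-- Pairing and lists

opaque
  -- Values lie between the squares of a + b and a + b + 1, whence injectivity. The pairing is not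
  -- onto: `fst` and `snd` are searches below n with default n, which is also the right answer when
  -- the component equals n.
  ⟨_,_⟩ : ℕ → ℕ → ℕ
  ⟨ a , b ⟩ = (a + b) * (a + b) + b

  ⟨⟩-<ʳ : ∀ {a b b'} → b < b' → ⟨ a , b ⟩ < ⟨ a , b' ⟩
  ⟨⟩-<ʳ {a} q = +-mono-≤-< (*-mono-≤ (+-monoʳ-≤ a (<⇒≤ q)) (+-monoʳ-≤ a (<⇒≤ q))) q

  ≤⟨⟩ʳ : ∀ {a b} → b ≤ ⟨ a , b ⟩
  ≤⟨⟩ʳ = m≤n+m _ _

  ≤⟨⟩ˡ : ∀ {a b} → a ≤ ⟨ a , b ⟩
  ≤⟨⟩ˡ {a} {b} = ≤-trans (≤-trans (m≤m+n a b) (square (a + b))) (m≤m+n _ b)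
    where
    square : ∀ n → n ≤ n * n
    square zero = z≤n
    square (suc n) = m≤m*n (suc n) (suc n)

  ⟨0,0⟩ : ⟨ 0 , 0 ⟩ ≡ 0
  ⟨0,0⟩ = refl

  private
    next-square : ∀ a b → ⟨ a , b ⟩ < suc (a + b) * suc (a + b)
    next-square a b = s≤s (≤-trans (≤-reflexive (+-comm _ b)) (+-mono-≤ (m≤n+m b a)
      (*-monoʳ-≤ (a + b) (n≤1+n (a + b)))))

    sum-≤ : ∀ {a b a' b'} → ⟨ a , b ⟩ ≡ ⟨ a' , b' ⟩ → a + b ≤ a' + b'
    sum-≤ {a} {b} {a'} {b'} e = ≮⇒≥ λ lt → <-irrefl (sym e)
      (<-≤-trans (next-square a' b') (≤-trans (*-mono-≤ lt lt) (m≤m+n _ b)))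

  ⟨⟩-injective : ∀ {a b a' b'} → ⟨ a , b ⟩ ≡ ⟨ a' , b' ⟩ → a ≡ a' × b ≡ b'
  ⟨⟩-injective {a} {b} {a'} {b'} e = +-cancelʳ-≡ b a a' (trans s (cong (a' +_) (sym eb))) , eb
    where
    s : a + b ≡ a' + b'
    s = ≤-antisym (sum-≤ {a} {b} {a'} {b'} e) (sum-≤ {a'} {b'} {a} {b} (sym e))
    eb : b ≡ b'
    eb = +-cancelˡ-≡ ((a + b) * (a + b)) b b' (trans e (cong (λ t → t * t + b') (sym s)))

  infix 8 ⟨_,_⟩ᶠ
  ⟨_,_⟩ᶠ : ∀ {n} {f g : Vec ℕ n → ℕ} → Fn f → Fn g → Fn (λ ρ → ⟨ f ρ , g ρ ⟩)
  ⟨ F , G ⟩ᶠ = (F +ᶠ G) *ᶠ (F +ᶠ G) +ᶠ G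

opaque
  private
    fstᵈ : Dc {2} (λ ρ → ∃ λ b → b < suc (lookup ρ (suc zero)) × ⟨ lookup ρ zero , b ⟩ ≡ lookup ρ (suc zero))
    fstᵈ = ∃ᵈ (sucᶠ v1) (⟨ v1 , v0 ⟩ᶠ ≡ᵈ v2)

    sndᵈ : Dc {2} (λ ρ → ∃ λ a → a < suc (lookup ρ (suc zero)) × ⟨ a , lookup ρ zero ⟩ ≡ lookup ρ (suc zero))
    sndᵈ = ∃ᵈ (sucᶠ v1) (⟨ v0 , v1 ⟩ᶠ ≡ᵈ v2)

  fst : ℕ → ℕ
  fst n = min fstᵈ (n ∷ []) n

  snd : ℕ → ℕ
  snd n = min sndᵈ (n ∷ []) n

  fst≤ : ∀ n → fst n ≤ n
  fst≤ n = bounded (min-spec fstᵈ (n ∷ []) n)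

  snd≤ : ∀ n → snd n ≤ n
  snd≤ n = bounded (min-spec sndᵈ (n ∷ []) n)

  fst-⟨⟩ : ∀ {a b} → fst ⟨ a , b ⟩ ≡ a
  fst-⟨⟩ {a} {b} with m≤n⇒m<n∨m≡n (fst≤ ⟨ a , b ⟩)
  ... | inj₁ lt = proj₁ (⟨⟩-injective (proj₂ (proj₂ (holds (min-spec fstᵈ (⟨ a , b ⟩ ∷ []) ⟨ a , b ⟩) lt))))
  ... | inj₂ e with m≤n⇒m<n∨m≡n (≤⟨⟩ˡ {a} {b})
  ... | inj₂ e' = trans e (sym e')
  ... | inj₁ lt = ⊥-elim (least (min-spec fstᵈ (⟨ a , b ⟩ ∷ []) ⟨ a , b ⟩) a (subst (a <_) (sym e) lt) (b , s≤s ≤⟨⟩ʳ , refl))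

  snd-⟨⟩ : ∀ {a b} → snd ⟨ a , b ⟩ ≡ b
  snd-⟨⟩ {a} {b} with m≤n⇒m<n∨m≡n (snd≤ ⟨ a , b ⟩)
  ... | inj₁ lt = proj₂ (⟨⟩-injective (proj₂ (proj₂ (holds (min-spec sndᵈ (⟨ a , b ⟩ ∷ []) ⟨ a , b ⟩) lt))))
  ... | inj₂ e with m≤n⇒m<n∨m≡n (≤⟨⟩ʳ {a} {b})
  ... | inj₂ e' = trans e (sym e')
  ... | inj₁ lt = ⊥-elim (least (min-spec sndᵈ (⟨ a , b ⟩ ∷ []) ⟨ a , b ⟩) b (subst (b <_) (sym e) lt) (a , s≤s ≤⟨⟩ˡ , refl))

  fstᶠ : ∀ {n} {f : Vec ℕ n → ℕ} → Fn f → Fn (λ ρ → fst (f ρ))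
  fstᶠ F = minᶠ {1} fstᵈ v0 $ᶠ F ∷ᶠ []ᶠ

  sndᶠ : ∀ {n} {f : Vec ℕ n → ℕ} → Fn f → Fn (λ ρ → snd (f ρ))
  sndᶠ F = minᶠ {1} sndᵈ v0 $ᶠ F ∷ᶠ []ᶠ

cons : ℕ → ℕ → ℕ
cons a l = suc ⟨ a , l ⟩

hd tl : ℕ → ℕ
hd l = fst (pred l)
tl l = snd (pred l)

drop : ℕ → ℕ → ℕ
drop i l = nrec l (λ _ r → tl r) i

consᶠ : ∀ {n} {f g : Vec ℕ n → ℕ} → Fn f → Fn g → Fn (λ ρ → cons (f ρ) (g ρ))
consᶠ F G = sucᶠ ⟨ F , G ⟩ᶠ

hdᶠ : ∀ {n} {f : Vec ℕ n → ℕ} → Fn f → Fn (λ ρ → hd (f ρ))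
hdᶠ F = fstᶠ (predᶠ F)

tlᶠ : ∀ {n} {f : Vec ℕ n → ℕ} → Fn f → Fn (λ ρ → tl (f ρ))
tlᶠ F = sndᶠ (predᶠ F)

dropᶠ : ∀ {n} {f g : Vec ℕ n → ℕ} → Fn f → Fn g → Fn (λ ρ → drop (f ρ) (g ρ))
dropᶠ F G = recᶠ {1} v0 (tlᶠ v1) $ᶠ F ∷ᶠ G ∷ᶠ []ᶠ

tl0 : tl 0 ≡ 0
tl0 = trans (cong snd (sym ⟨0,0⟩)) snd-⟨⟩

drop-suc : ∀ i l → drop (suc i) l ≡ drop i (tl l)
drop-suc zero l = refl
drop-suc (suc i) l = cong tl (drop-suc i l)

drop-drop : ∀ i j l → drop i (drop j l) ≡ drop (i + j) l
drop-drop zero j l = refl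
drop-drop (suc i) j l = cong tl (drop-drop i j l)

drop-index : ∀ i l → drop i l ≢ 0 → drop i l + i ≤ l
drop-index zero l _ = ≤-reflexive (+-identityʳ l)
drop-index (suc i) l ne with drop i l | drop-index i l
... | zero | _ = ⊥-elim (ne tl0)
... | suc n | h = ≤-trans (≤-reflexive (+-suc (snd n) i)) (≤-trans (s≤s (+-monoˡ-≤ i (snd≤ n))) (h λ ()))

drop-index' : ∀ i l → drop i l ≢ 0 → i < l
drop-index' i l ne with drop i l | ne | drop-index i l ne
... | zero | ne' | _ = ⊥-elim (ne' refl)
... | suc n | _ | h = ≤-trans (s≤s (m≤n+m i n)) h

drop≤ : ∀ i l → drop i l ≤ l
drop≤ i l with drop i l | drop-index i l
... | zero | _ = z≤n
... | suc n | h = ≤-trans (m≤m+n _ i) (h λ ())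

infix 4 _∈_
-- The bound `i < l` turns membership into a bounded search; `drop-index'` supplies it.
_∈_ : ℕ → ℕ → Set
a ∈ l = ∃ λ i → i < l × drop i l ≢ 0 × hd (drop i l) ≡ a

∈ᵈ : ∀ {n} {f g : Vec ℕ n → ℕ} → Fn f → Fn g → Dc (λ ρ → f ρ ∈ g ρ)
∈ᵈ F G = ∃ᵈ {2} v1 (¬ᵈ (dropᶠ v0 v2 ≡ᵈ kn 0) ×ᵈ (hdᶠ (dropᶠ v0 v2) ≡ᵈ v1)) $ᵈ F ∷ᶠ G ∷ᶠ []ᶠ

hd-cons : ∀ {a l} → hd (cons a l) ≡ a
hd-cons = fst-⟨⟩

tl-cons : ∀ {a l} → tl (cons a l) ≡ l
tl-cons = snd-⟨⟩

∉0 : ∀ {a} → ¬ a ∈ 0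
∉0 (i , () , _)

∈-head : ∀ {a l} → a ∈ cons a l
∈-head = 0 , s≤s z≤n , (λ ()) , hd-cons

∈-tail : ∀ {a b l} → a ∈ l → a ∈ cons b l
∈-tail {a} {b} {l} (i , lt , ne , e) = suc i , s≤s (≤-trans lt ≤⟨⟩ʳ) , subst (_≢ 0) (sym eq) ne , trans (cong hd eq) e
  where
  eq : drop (suc i) (cons b l) ≡ drop i l
  eq = trans (drop-suc i (cons b l)) (cong (drop i) tl-cons)

∈-cons⁻ : ∀ {a b l} → a ∈ cons b l → a ≡ b ⊎ a ∈ l
∈-cons⁻ (zero , _ , _ , e) = inj₁ (trans (sym e) hd-cons)
∈-cons⁻ {a} {b} {l} (suc i , _ , ne , e) = inj₂ (i , drop-index' i l ne' , ne' , trans (cong hd (sym eq)) e)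
  where
  eq : drop (suc i) (cons b l) ≡ drop i l
  eq = trans (drop-suc i (cons b l)) (cong (drop i) tl-cons)
  ne' : drop i l ≢ 0
  ne' = subst (_≢ 0) eq ne

∈⇒< : ∀ {a l} → a ∈ l → a < l
∈⇒< {a} {l} (i , lt , ne , e) with drop i l | ne | e | drop≤ i l
... | zero | ne | _ | _ = ⊥-elim (ne refl)
... | suc n | _ | e | le = ≤-trans (s≤s (≤-trans (≤-reflexive (sym e)) (fst≤ n))) le

-- Many-one reductions as computable functions

infix 0 _⟺_
_⟺_ : Set → Set → Set
A ⟺ B = (A → B) × (B → A)

reduction : ∀ {X Y : ℕ → Set} {f : Vec ℕ 1 → ℕ} → Fn f → (∀ n → X n → interp Y (f (n ∷ []))) →
            (∀ n → interp Y (f (n ∷ [])) → X n) → X ≤ₘ Y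
reduction F to from = code F , λ n → _ , eval F (n ∷ []) , mk⇔ (to n) (from n)

record Reduction (X Y : ℕ → Set) : Set where
  field
    fun  : ℕ → ℕ
    funᶠ : ∀ {n} {g : Vec ℕ n → ℕ} → Fn g → Fn (λ ρ → fun (g ρ))
    forth : ∀ n → X n → interp Y (fun n)
    back : ∀ n → interp Y (fun n) → X n
open Reduction public

unpack : ∀ {X Y} → X ≤ₘ Y → Reduction X Y
unpack (c , h) = record
  { fun = λ n → proj₁ (h n)
  ; funᶠ = λ G → fn {f = λ ρ → proj₁ (h (lookup ρ zero))} c (λ { (n ∷ []) → proj₁ (proj₂ (h n)) }) $ᶠ G ∷ᶠ []ᶠ
  ; forth = λ n → Equivalence.to (proj₂ (proj₂ (h n)))
  ; back = λ n → Equivalence.from (proj₂ (proj₂ (h n))) }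

-- The action of a reduction g : X → Y on the outputs of a reduction to X.
bind : (ℕ → ℕ) → ℕ → ℕ
bind g zero = 0
bind g (suc zero) = 1
bind g (suc (suc v)) = g v

bindᶠ : ∀ {n} {f : Vec ℕ n → ℕ} {g} → Fn f → (∀ {m} {h : Vec ℕ m → ℕ} → Fn h → Fn (λ ρ → g (h ρ))) → Fn (λ ρ → bind g (f ρ))
bindᶠ {f = f} {g} F G = Fn-ext (λ ρ → e (f ρ)) (ifᶠ (v0 <ᵈ kn 2) v0 (G (v0 ∸ᶠ kn 2)) $ᶠ F ∷ᶠ []ᶠ)
  where
  e : ∀ v → choose (dec (v0 {0} <ᵈ kn 2) (v ∷ [])) v (g (v ∸ 2)) ≡ bind g v
  e v with dec (v0 {0} <ᵈ kn 2) (v ∷ [])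
  e zero | yes p = refl
  e (suc zero) | yes p = refl
  e (suc (suc v)) | yes (s≤s (s≤s ()))
  e zero | no p = ⊥-elim (p (s≤s z≤n))
  e (suc zero) | no p = ⊥-elim (p (s≤s (s≤s z≤n)))
  e (suc (suc v)) | no p = refl

bind-to : ∀ {X Y} (r : Reduction X Y) v → interp X v → interp Y (bind (fun r) v)
bind-to r (suc zero) p = p
bind-to r (suc (suc v)) p = forth r v p

bind-from : ∀ {X Y} (r : Reduction X Y) v → interp Y (bind (fun r) v) → interp X v
bind-from r (suc zero) p = p
bind-from r (suc (suc v)) p = back r v p

≤ₘ-refl : ∀ {X} → X ≤ₘ X
≤ₘ-refl = reduction (sucᶠ (sucᶠ v0)) (λ n p → p) (λ n p → p)

≤ₘ-trans : ∀ {X Y Z} → X ≤ₘ Y → Y ≤ₘ Z → X ≤ₘ Z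
≤ₘ-trans p q = reduction (bindᶠ (funᶠ R v0) (funᶠ S))
    (λ n x → bind-to S (fun R n) (forth R n x)) (λ n z → back R n (bind-from S (fun R n) z))
  where
  R = unpack p
  S = unpack q

⇔-≤ₘ : ∀ {X Y : ℕ → Set} → (∀ n → X n → Y n) → (∀ n → Y n → X n) → X ≤ₘ Y
⇔-≤ₘ f g = reduction (sucᶠ (sucᶠ v0)) f g

∅ : ℕ → Set
∅ _ = ⊥

∅-least : ∀ {X} → ∅ ≤ₘ X
∅-least = reduction (kn 0) (λ n ()) (λ n ())

-- Any certificate will do, so a reduction may search for the first one. That certificates exist may
-- be proved classically; the search is computable all the same.
search-reduction : ∀ {X Y : ℕ → Set} {P : Vec ℕ 2 → Set} {g : Vec ℕ 2 → ℕ} → Dc P → Fn g →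
  (∀ n → ∃ λ s → P (s ∷ n ∷ [])) → (∀ n s → P (s ∷ n ∷ []) → X n ⟺ interp Y (g (s ∷ n ∷ []))) → X ≤ₘ Y
search-reduction {P = P} {g} D G tot h with searchᶠ D (λ { (n ∷ []) → tot n })
... | f , F , c = reduction (G $ᶠ F ∷ᶠ v0 ∷ᶠ []ᶠ)
  (λ n → proj₁ (h n _ (c (n ∷ [])))) (λ n → proj₂ (h n _ (c (n ∷ []))))

-- A universal predicate: a computation is certified by a list of facts, each derivable from the later entries by one evaluation rule

-- The tag is 0 for evaluations of codes and 1 for evaluations of vectors of codes.
fact : ℕ → ℕ → ℕ → ℕ → ℕ
fact t c xs v = ⟨ t , ⟨ c , ⟨ xs , v ⟩ ⟩ ⟩

factᶠ : ∀ {n} {t c x v : Vec ℕ n → ℕ} → Fn t → Fn c → Fn x → Fn v → Fn (λ ρ → fact (t ρ) (c ρ) (x ρ) (v ρ))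
factᶠ T C X V = ⟨ T , ⟨ C , ⟨ X , V ⟩ᶠ ⟩ᶠ ⟩ᶠ

-- Tags 0 to 5 stand for `zer`, `succ`, `proj`, `comp`, `prec` and `mu`, as in `⌜_⌝`, and a is what
-- the tag is paired with. The bounds by L keep the rules decidable.
CodeRule : (tag c a xs v L : ℕ) → Set
CodeRule 0 c a xs v L = v ≡ 0
CodeRule 1 c a xs v L = v ≡ suc (hd xs)
CodeRule 2 c a xs v L = v ≡ hd (drop a xs)
CodeRule 3 c a xs v L = ∃ λ ys → ys < L × fact 1 (snd a) xs ys ∈ L × fact 0 (fst a) ys v ∈ L
CodeRule 4 c a xs v L =
  (hd xs ≡ 0 × fact 0 (fst a) (tl xs) v ∈ L) ⊎
  (hd xs ≢ 0 × ∃ λ r → r < L × fact 0 c (cons (pred (hd xs)) (tl xs)) r ∈ L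
                           × fact 0 (snd a) (cons (pred (hd xs)) (cons r (tl xs))) v ∈ L)
CodeRule 5 c a xs v L = fact 0 a (cons v xs) 0 ∈ L × (∀ j → j < v → ∃ λ r → r < L × fact 0 a (cons j xs) (suc r) ∈ L)
CodeRule _ c a xs v L = ⊥

VecRule : (c xs v L : ℕ) → Set
VecRule c xs v L = (c ≡ 0 × v ≡ 0) ⊎ (c ≢ 0 × v ≡ cons (hd v) (tl v) × fact 0 (hd c) xs (hd v) ∈ L × fact 1 (tl c) xs (tl v) ∈ L)

FactRule : (t c xs v L : ℕ) → Set
FactRule t c xs v L = (t ≡ 0 × CodeRule (fst c) c (snd c) xs v L) ⊎ (t ≡ 1 × VecRule c xs v L)

Rule : ℕ → ℕ → Set
Rule F L = FactRule (fst F) (fst (snd F)) (fst (snd (snd F))) (snd (snd (snd F))) L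

Valid : ℕ → Set
Valid L = ∀ i → i < L → drop i L ≢ 0 → Rule (hd (drop i L)) (tl (drop i L))

opaque
  CodeRuleᵈ : Dc {6} λ { (t ∷ c ∷ a ∷ xs ∷ v ∷ L ∷ []) → CodeRule t c a xs v L }
  CodeRuleᵈ = Dc-ext (λ { (t ∷ c ∷ a ∷ xs ∷ v ∷ L ∷ []) → toRule }) (λ { (t ∷ c ∷ a ∷ xs ∷ v ∷ L ∷ []) → fromRule t }) cases
    where
    cases : Dc {6} λ { (t ∷ c ∷ a ∷ xs ∷ v ∷ L ∷ []) →
      (t ≡ 0 × CodeRule 0 c a xs v L) ⊎ (t ≡ 1 × CodeRule 1 c a xs v L) ⊎ (t ≡ 2 × CodeRule 2 c a xs v L) ⊎
      (t ≡ 3 × CodeRule 3 c a xs v L) ⊎ (t ≡ 4 × CodeRule 4 c a xs v L) ⊎ (t ≡ 5 × CodeRule 5 c a xs v L) }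
    cases = Dc-ext (λ { (t ∷ c ∷ a ∷ xs ∷ v ∷ L ∷ []) p → p }) (λ { (t ∷ c ∷ a ∷ xs ∷ v ∷ L ∷ []) p → p })
      (((v0 ≡ᵈ kn 0) ×ᵈ (v4 ≡ᵈ kn 0)) ⊎ᵈ
       ((v0 ≡ᵈ kn 1) ×ᵈ (v4 ≡ᵈ sucᶠ (hdᶠ v3))) ⊎ᵈ
       ((v0 ≡ᵈ kn 2) ×ᵈ (v4 ≡ᵈ hdᶠ (dropᶠ v2 v3))) ⊎ᵈ
       ((v0 ≡ᵈ kn 3) ×ᵈ ∃ᵈ v5 (∈ᵈ (factᶠ (kn 1) (sndᶠ v3) v4 v0) v6 ×ᵈ ∈ᵈ (factᶠ (kn 0) (fstᶠ v3) v0 v5) v6)) ⊎ᵈ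
       ((v0 ≡ᵈ kn 4) ×ᵈ
         (((hdᶠ v3 ≡ᵈ kn 0) ×ᵈ ∈ᵈ (factᶠ (kn 0) (fstᶠ v2) (tlᶠ v3) v4) v5) ⊎ᵈ
          (¬ᵈ (hdᶠ v3 ≡ᵈ kn 0) ×ᵈ ∃ᵈ v5 (∈ᵈ (factᶠ (kn 0) v2 (consᶠ (predᶠ (hdᶠ v4)) (tlᶠ v4)) v0) v6 ×ᵈ
             ∈ᵈ (factᶠ (kn 0) (sndᶠ v3) (consᶠ (predᶠ (hdᶠ v4)) (consᶠ v0 (tlᶠ v4))) v5) v6)))) ⊎ᵈ
       ((v0 ≡ᵈ kn 5) ×ᵈ ∈ᵈ (factᶠ (kn 0) v2 (consᶠ v4 v3) (kn 0)) v5 ×ᵈ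
          ∀ᵈ v4 (∃ᵈ v6 (∈ᵈ (factᶠ (kn 0) v4 (consᶠ v1 v5) (sucᶠ v0)) v7))))
    toRule : ∀ {t c a xs v L} →
      (t ≡ 0 × CodeRule 0 c a xs v L) ⊎ (t ≡ 1 × CodeRule 1 c a xs v L) ⊎ (t ≡ 2 × CodeRule 2 c a xs v L) ⊎
      (t ≡ 3 × CodeRule 3 c a xs v L) ⊎ (t ≡ 4 × CodeRule 4 c a xs v L) ⊎ (t ≡ 5 × CodeRule 5 c a xs v L) →
      CodeRule t c a xs v L
    toRule (inj₁ (refl , p)) = p
    toRule (inj₂ (inj₁ (refl , p))) = p
    toRule (inj₂ (inj₂ (inj₁ (refl , p)))) = p
    toRule (inj₂ (inj₂ (inj₂ (inj₁ (refl , p))))) = p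
    toRule (inj₂ (inj₂ (inj₂ (inj₂ (inj₁ (refl , p)))))) = p
    toRule (inj₂ (inj₂ (inj₂ (inj₂ (inj₂ (refl , p)))))) = p
    fromRule : ∀ t {c a xs v L} → CodeRule t c a xs v L →
      (t ≡ 0 × CodeRule 0 c a xs v L) ⊎ (t ≡ 1 × CodeRule 1 c a xs v L) ⊎ (t ≡ 2 × CodeRule 2 c a xs v L) ⊎
      (t ≡ 3 × CodeRule 3 c a xs v L) ⊎ (t ≡ 4 × CodeRule 4 c a xs v L) ⊎ (t ≡ 5 × CodeRule 5 c a xs v L)
    fromRule 0 p = inj₁ (refl , p)
    fromRule 1 p = inj₂ (inj₁ (refl , p))
    fromRule 2 p = inj₂ (inj₂ (inj₁ (refl , p)))
    fromRule 3 p = inj₂ (inj₂ (inj₂ (inj₁ (refl , p))))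
    fromRule 4 p = inj₂ (inj₂ (inj₂ (inj₂ (inj₁ (refl , p)))))
    fromRule 5 p = inj₂ (inj₂ (inj₂ (inj₂ (inj₂ (refl , p)))))

  FactRuleᵈ : Dc {5} (λ ρ → FactRule (x0 ρ) (x1 ρ) (x2 ρ) (x3 ρ) (x4 ρ))
  FactRuleᵈ =
    ((v0 ≡ᵈ kn 0) ×ᵈ (CodeRuleᵈ $ᵈ fstᶠ v1 ∷ᶠ v1 ∷ᶠ sndᶠ v1 ∷ᶠ v2 ∷ᶠ v3 ∷ᶠ v4 ∷ᶠ []ᶠ)) ⊎ᵈ
     ((v0 ≡ᵈ kn 1) ×ᵈ (((v1 ≡ᵈ kn 0) ×ᵈ (v3 ≡ᵈ kn 0)) ⊎ᵈ
        (¬ᵈ (v1 ≡ᵈ kn 0) ×ᵈ (v3 ≡ᵈ consᶠ (hdᶠ v3) (tlᶠ v3)) ×ᵈ ∈ᵈ (factᶠ (kn 0) (hdᶠ v1) v2 (hdᶠ v3)) v4 ×ᵈ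
         ∈ᵈ (factᶠ (kn 1) (tlᶠ v1) v2 (tlᶠ v3)) v4)))

  Ruleᵈ : ∀ {n} {F L : Vec ℕ n → ℕ} → Fn F → Fn L → Dc (λ ρ → Rule (F ρ) (L ρ))
  Ruleᵈ F L = FactRuleᵈ $ᵈ fstᶠ F ∷ᶠ fstᶠ (sndᶠ F) ∷ᶠ fstᶠ (sndᶠ (sndᶠ F)) ∷ᶠ sndᶠ (sndᶠ (sndᶠ F)) ∷ᶠ L ∷ᶠ []ᶠ

  Validᵈ : ∀ {n} {L : Vec ℕ n → ℕ} → Fn L → Dc (λ ρ → Valid (L ρ))
  Validᵈ L = ∀ᵈ {1} v0 (¬ᵈ (dropᶠ v0 v1 ≡ᵈ kn 0) →ᵈ Ruleᵈ (hdᶠ (dropᶠ v0 v1)) (tlᶠ (dropᶠ v0 v1))) $ᵈ L ∷ᶠ []ᶠ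

Valid-0 : Valid 0
Valid-0 i ()

Valid-cons : ∀ {F L} → Rule F L → Valid L → Valid (cons F L)
Valid-cons r V zero lt ne = subst₂ Rule (sym hd-cons) (sym tl-cons) r
Valid-cons {F} {L} r V (suc i) lt ne = subst (λ d → Rule (hd d) (tl d)) (sym eq) (V i (drop-index' i L ne') ne')
  where
  eq : drop (suc i) (cons F L) ≡ drop i L
  eq = trans (drop-suc i (cons F L)) (cong (drop i) tl-cons)
  ne' : drop i L ≢ 0
  ne' = subst (_≢ 0) eq ne

Valid-drop : ∀ {L} j → Valid L → Valid (drop j L)
Valid-drop {L} j V i lt ne = subst (λ d → Rule (hd d) (tl d)) (sym (drop-drop i j L)) (V (i + j) (drop-index' (i + j) L ne') ne')
  where
  ne' : drop (i + j) L ≢ 0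
  ne' = subst (_≢ 0) (drop-drop i j L) ne

-- The entries behind F form a smaller valid list; `sound` descends along it.
justification : ∀ {F L} → Valid L → F ∈ L → ∃ λ L' → L' < L × Valid L' × Rule F L'
justification {F} {L} V (i , lt , ne , refl) = tl (drop i L) , tl< , Valid-drop (suc i) V , V i lt ne
  where
  tl< : tl (drop i L) < L
  tl< with drop i L | drop-index i L ne
  ... | zero | _ = ≤-<-trans (≤-reflexive tl0) (≤-<-trans z≤n lt)
  ... | suc n | le = ≤-trans (s≤s (snd≤ n)) (≤-trans (m≤m+n _ i) le)

Rule-fact : ∀ {t c xs v L} → Rule (fact t c xs v) L ⟺ FactRule t c xs v L
Rule-fact {t} {c} {xs} {v} {L}
  rewrite fst-⟨⟩ {t} {⟨ c , ⟨ xs , v ⟩ ⟩} | snd-⟨⟩ {t} {⟨ c , ⟨ xs , v ⟩ ⟩}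
        | fst-⟨⟩ {c} {⟨ xs , v ⟩} | snd-⟨⟩ {c} {⟨ xs , v ⟩} | fst-⟨⟩ {xs} {v} | snd-⟨⟩ {xs} {v} = (λ p → p) , (λ p → p)

vecN : ∀ {n} → Vec ℕ n → ℕ
vecN [] = 0
vecN (x ∷ xs) = cons x (vecN xs)

hd-drop-vecN : ∀ {n} (i : Fin n) (xs : Vec ℕ n) → hd (drop (toℕ i) (vecN xs)) ≡ lookup xs i
hd-drop-vecN zero (x ∷ xs) = hd-cons
hd-drop-vecN (suc i) (x ∷ xs) = trans (cong hd (trans (drop-suc (toℕ i) (vecN (x ∷ xs))) (cong (drop (toℕ i)) tl-cons))) (hd-drop-vecN i xs)

opaque
  ⌜_⌝ : ∀ {n} → Code n → ℕ
  ⌜_⌝* : ∀ {n m} → Vec (Code n) m → ℕ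
  ⌜ zer ⌝ = ⟨ 0 , 0 ⟩
  ⌜ succ ⌝ = ⟨ 1 , 0 ⟩
  ⌜ proj i ⌝ = ⟨ 2 , toℕ i ⟩
  ⌜ comp f gs ⌝ = ⟨ 3 , ⟨ ⌜ f ⌝ , ⌜ gs ⌝* ⟩ ⟩
  ⌜ prec g h ⌝ = ⟨ 4 , ⟨ ⌜ g ⌝ , ⌜ h ⌝ ⟩ ⟩
  ⌜ mu f ⌝ = ⟨ 5 , ⌜ f ⌝ ⟩
  ⌜ [] ⌝* = 0
  ⌜ c ∷ cs ⌝* = cons ⌜ c ⌝ ⌜ cs ⌝*

private
  CodeRule-⟨⟩ : ∀ {t a xs v L} → CodeRule (fst ⟨ t , a ⟩) ⟨ t , a ⟩ (snd ⟨ t , a ⟩) xs v L → CodeRule t ⟨ t , a ⟩ a xs v L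
  CodeRule-⟨⟩ {t} {a} {xs} {v} {L} = subst₂ (λ f s → CodeRule f ⟨ t , a ⟩ s xs v L) fst-⟨⟩ snd-⟨⟩

  CodeRule-⟨⟩⁻ : ∀ {t a xs v L} → CodeRule t ⟨ t , a ⟩ a xs v L → CodeRule (fst ⟨ t , a ⟩) ⟨ t , a ⟩ (snd ⟨ t , a ⟩) xs v L
  CodeRule-⟨⟩⁻ {t} {a} {xs} {v} {L} = subst₂ (λ f s → CodeRule f ⟨ t , a ⟩ s xs v L) (sym fst-⟨⟩) (sym snd-⟨⟩)

  code-rule : ∀ {c xs v L} → Rule (fact 0 c xs v) L → CodeRule (fst c) c (snd c) xs v L
  code-rule r with proj₁ Rule-fact r
  ... | inj₁ (_ , p) = p
  ... | inj₂ (() , _)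

  vec-rule : ∀ {c xs v L} → Rule (fact 1 c xs v) L → VecRule c xs v L
  vec-rule r with proj₁ Rule-fact r
  ... | inj₁ (() , _)
  ... | inj₂ (_ , p) = p

Sound : ℕ → Set
Sound L = (∀ {n} (c : Code n) xs v → fact 0 ⌜ c ⌝ (vecN xs) v ∈ L → c ∙ xs ⇓ v) ×
          (∀ {n m} (cs : Vec (Code n) m) xs y → fact 1 ⌜ cs ⌝* (vecN xs) y ∈ L → ∃ λ ys → y ≡ vecN ys × cs ∙* xs ⇓ ys)

opaque
  unfolding ⌜_⌝

  private
    evaluate : ∀ {L} → Sound L → ∀ {n} (c : Code n) xs v → CodeRule (fst ⌜ c ⌝) ⌜ c ⌝ (snd ⌜ c ⌝) (vecN xs) v L → c ∙ xs ⇓ v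
    evaluate (ih , ih*) zer xs v r with CodeRule-⟨⟩ {0} r
    ... | refl = ev-zer
    evaluate (ih , ih*) succ (x ∷ []) v r with CodeRule-⟨⟩ {1} r
    ... | refl = subst (λ y → succ ∙ (x ∷ []) ⇓ suc y) (sym hd-cons) ev-succ
    evaluate (ih , ih*) (proj i) xs v r with CodeRule-⟨⟩ {2} r
    ... | refl = subst (proj i ∙ xs ⇓_) (sym (hd-drop-vecN i xs)) ev-proj
    evaluate {L} (ih , ih*) (comp f gs) xs v r with CodeRule-⟨⟩ {3} r
    ... | y , _ , p , q with ih* gs xs y (subst (λ g → fact 1 g (vecN xs) y ∈ L) snd-⟨⟩ p)
    ... | ys , refl , d = ev-comp d (ih f ys v (subst (λ g → fact 0 g (vecN ys) v ∈ L) fst-⟨⟩ q))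
    evaluate {L} (ih , ih*) (prec g h) (x ∷ xs) v r with CodeRule-⟨⟩ {4} r
    ... | inj₁ (e , p) with trans (sym hd-cons) e
    ... | refl = ev-prec0 (ih g xs v (subst₂ (λ a b → fact 0 a b v ∈ L) fst-⟨⟩ tl-cons p))
    evaluate {L} (ih , ih*) (prec g h) (x ∷ xs) v r | inj₂ (ne , s , _ , p , q)
      rewrite hd-cons {x} {vecN xs} | tl-cons {x} {vecN xs} | snd-⟨⟩ {⌜ g ⌝} {⌜ h ⌝} with x
    ... | zero = ⊥-elim (ne refl)
    ... | suc k = ev-precS (ih (prec g h) (k ∷ xs) s p) (ih h (k ∷ s ∷ xs) v q)
    evaluate (ih , ih*) (mu f) xs v r with CodeRule-⟨⟩ {5} r
    ... | p , q = ev-mu (ih f (v ∷ xs) 0 p) (λ j lt → proj₁ (q j lt) , ih f (j ∷ xs) _ (proj₂ (proj₂ (q j lt))))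

    evaluate* : ∀ {L} → Sound L → ∀ {n m} (cs : Vec (Code n) m) xs y → VecRule ⌜ cs ⌝* (vecN xs) y L → ∃ λ ys → y ≡ vecN ys × cs ∙* xs ⇓ ys
    evaluate* (ih , ih*) [] xs y (inj₁ (_ , refl)) = [] , refl , ev-[]
    evaluate* (ih , ih*) [] xs y (inj₂ (ne , _)) = ⊥-elim (ne refl)
    evaluate* {L} (ih , ih*) (c ∷ cs) xs y (inj₂ (_ , e , p , q)) with ih* cs xs (tl y) (subst (λ g → fact 1 g (vecN xs) (tl y) ∈ L) tl-cons q)
    ... | ys , e' , d = (hd y ∷ ys) , trans e (cong (cons (hd y)) e') ,
                        ev-∷ (ih c xs (hd y) (subst (λ g → fact 0 g (vecN xs) (hd y) ∈ L) hd-cons p)) d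

  sound : ∀ L → Valid L → Sound L
  sound = <-rec _ step
    where
    step : ∀ L → (∀ {L'} → L' < L → Valid L' → Sound L') → Valid L → Sound L
    step L ih V = (λ c xs v m → let L' , lt , V' , r = justification V m in evaluate (ih lt V') c xs v (code-rule r)) ,
                  (λ cs xs y m → let L' , lt , V' , r = justification V m in evaluate* (ih lt V') cs xs y (vec-rule r))

Extends : ℕ → ℕ → Set
Extends L L' = ∀ {a} → a ∈ L → a ∈ L'

private
  append : ∀ {t c xs v L} → Valid L → FactRule t c xs v L → Valid (cons (fact t c xs v) L) × fact t c xs v ∈ cons (fact t c xs v) L
  append V r = Valid-cons (proj₂ Rule-fact r) V , ∈-head

  component< : ∀ {t c xs v L} → fact t c xs v ∈ L → v < L
  component< m = ≤-<-trans (≤-trans ≤⟨⟩ʳ (≤-trans ≤⟨⟩ʳ ≤⟨⟩ʳ)) (∈⇒< m)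

opaque
  unfolding ⌜_⌝

  -- Starting from an arbitrary valid L lets the certificates of several premises accumulate in a
  -- single list.
  complete : ∀ {n} {c : Code n} {xs v} → c ∙ xs ⇓ v → ∀ L → Valid L →
             ∃ λ L' → Valid L' × Extends L L' × fact 0 ⌜ c ⌝ (vecN xs) v ∈ L'
  complete* : ∀ {n m} {cs : Vec (Code n) m} {xs ys} → cs ∙* xs ⇓ ys → ∀ L → Valid L →
              ∃ λ L' → Valid L' × Extends L L' × fact 1 ⌜ cs ⌝* (vecN xs) (vecN ys) ∈ L'

  complete-all : ∀ {n} {f : Code (suc n)} {xs} k → (∀ j → j < k → Σ ℕ λ r → f ∙ (j ∷ xs) ⇓ suc r) → ∀ L → Valid L →
                 ∃ λ L' → Valid L' × Extends L L' × (∀ j → j < k → ∃ λ r → r < L' × fact 0 ⌜ f ⌝ (cons j (vecN xs)) (suc r) ∈ L')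

  private
    finish : ∀ {n} {c : Code n} {xs : Vec ℕ n} {v L L'} → Valid L' → Extends L L' → CodeRule (fst ⌜ c ⌝) ⌜ c ⌝ (snd ⌜ c ⌝) (vecN xs) v L' →
             ∃ λ L' → Valid L' × Extends L L' × fact 0 ⌜ c ⌝ (vecN xs) v ∈ L'
    finish V E r = _ , proj₁ (append V (inj₁ (refl , r))) , (λ m → ∈-tail (E m)) , ∈-head

  complete ev-zer L V = finish {c = zer} V (λ m → m) (CodeRule-⟨⟩⁻ {0} refl)
  complete (ev-succ {x}) L V = finish {c = succ} {xs = x ∷ []} V (λ m → m) (CodeRule-⟨⟩⁻ {1} (cong suc (sym hd-cons)))
  complete (ev-proj {i = i} {xs}) L V = finish {c = proj i} {xs = xs} V (λ m → m) (CodeRule-⟨⟩⁻ {2} (sym (hd-drop-vecN i xs)))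
  complete (ev-comp {f = f} {gs} {xs} {ys} {v} d e) L V with complete* d L V
  ... | L₁ , V₁ , E₁ , m₁ with complete e L₁ V₁
  ... | L₂ , V₂ , E₂ , m₂ = finish {c = comp f gs} {xs = xs} V₂ (λ m → E₂ (E₁ m)) (CodeRule-⟨⟩⁻ {3}
        (vecN ys , component< (E₂ m₁) , subst (λ g → fact 1 g (vecN xs) (vecN ys) ∈ L₂) (sym snd-⟨⟩) (E₂ m₁) ,
         subst (λ g → fact 0 g (vecN ys) v ∈ L₂) (sym fst-⟨⟩) m₂))
  complete (ev-prec0 {g = g} {h} {xs} {v} d) L V with complete d L V
  ... | L₁ , V₁ , E₁ , m₁ = finish {c = prec g h} {xs = 0 ∷ xs} V₁ E₁ (CodeRule-⟨⟩⁻ {4}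
        (inj₁ (hd-cons , subst₂ (λ a b → fact 0 a b v ∈ L₁) (sym fst-⟨⟩) (sym tl-cons) m₁)))
  complete (ev-precS {g = g} {h} {xs} {k} {r} {v} d e) L V with complete d L V
  ... | L₁ , V₁ , E₁ , m₁ with complete e L₁ V₁
  ... | L₂ , V₂ , E₂ , m₂ = finish {c = prec g h} {xs = suc k ∷ xs} V₂ (λ m → E₂ (E₁ m)) (CodeRule-⟨⟩⁻ {4}
        (inj₂ ((λ z → 0≢1+n (trans (sym z) hd-cons)) , r , component< (E₂ m₁) ,
          subst₂ (λ a b → fact 0 ⌜ prec g h ⌝ (cons (pred a) b) r ∈ L₂) (sym hd-cons) (sym tl-cons) (E₂ m₁) ,
          subst (λ c → fact 0 c (cons (pred (hd (vecN (suc k ∷ xs)))) (cons r (tl (vecN (suc k ∷ xs))))) v ∈ L₂) (sym snd-⟨⟩)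
            (subst₂ (λ a b → fact 0 ⌜ h ⌝ (cons (pred a) (cons r b)) v ∈ L₂) (sym hd-cons) (sym tl-cons) m₂))))
  complete (ev-mu {f = f} {xs} {k} d e) L V with complete-all k e L V
  ... | L₁ , V₁ , E₁ , m₁ with complete d L₁ V₁
  ... | L₂ , V₂ , E₂ , m₂ = finish {c = mu f} {xs = xs} V₂ (λ m → E₂ (E₁ m)) (CodeRule-⟨⟩⁻ {5}
        (m₂ , λ j lt → let r , _ , m = m₁ j lt in r , <-trans (n<1+n r) (component< (E₂ m)) , E₂ m))

  complete* ev-[] L V = _ , proj₁ (append V (inj₂ (refl , inj₁ (refl , refl)))) , ∈-tail , ∈-head
  complete* (ev-∷ {g = g} {gs} {xs} {y} {ys} d e) L V with complete d L V
  ... | L₁ , V₁ , E₁ , m₁ with complete* e L₁ V₁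
  ... | L₂ , V₂ , E₂ , m₂ = _ , proj₁ (append V₂ (inj₂ (refl , inj₂ ((λ ()) , cong₂ cons (sym hd-cons) (sym tl-cons) ,
        subst₂ (λ a b → fact 0 a (vecN xs) b ∈ L₂) (sym hd-cons) (sym hd-cons) (E₂ m₁) ,
        subst₂ (λ a b → fact 1 a (vecN xs) b ∈ L₂) (sym tl-cons) (sym tl-cons) m₂)))) , (λ m → ∈-tail (E₂ (E₁ m))) , ∈-head

  complete-all zero h L V = L , V , (λ m → m) , λ j ()
  complete-all {f = f} {xs} (suc k) h L V with complete-all k (λ j lt → h j (≤-trans lt (n≤1+n k))) L V
  ... | L₁ , V₁ , E₁ , m₁ with complete (proj₂ (h k ≤-refl)) L₁ V₁
  ... | L₂ , V₂ , E₂ , m₂ = L₂ , V₂ , (λ m → E₂ (E₁ m)) , all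
    where
    all : ∀ j → j < suc k → ∃ λ r → r < L₂ × fact 0 ⌜ f ⌝ (cons j (vecN xs)) (suc r) ∈ L₂
    all j (s≤s le) with m≤n⇒m<n∨m≡n le
    ... | inj₁ lt = let r , _ , m = m₁ j lt in r , <-trans (n<1+n r) (component< (E₂ m)) , E₂ m
    ... | inj₂ refl = _ , <-trans (n<1+n _) (component< m₂) , m₂

-- Comp c x v s: some certificate below s shows that the code numbered c yields v on input x; hence v < s.

opaque
  Comp : ℕ → ℕ → ℕ → ℕ → Set
  Comp c x v s = ∃ λ w → w < s × Valid w × fact 0 c (cons x 0) v ∈ w

  Compᵈ : ∀ {n} {c x v s : Vec ℕ n → ℕ} → Fn c → Fn x → Fn v → Fn s → Dc (λ ρ → Comp (c ρ) (x ρ) (v ρ) (s ρ))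
  Compᵈ C X V S = ∃ᵈ {4} v3 (Validᵈ v0 ×ᵈ ∈ᵈ (factᶠ (kn 0) v1 (consᶠ v2 (kn 0)) v3) v0) $ᵈ C ∷ᶠ X ∷ᶠ V ∷ᶠ S ∷ᶠ []ᶠ

  Comp-mono : ∀ {c x v s s'} → s ≤ s' → Comp c x v s → Comp c x v s'
  Comp-mono le (w , lt , p) = w , <-≤-trans lt le , p

  Comp-< : ∀ {c x v s} → Comp c x v s → v < s
  Comp-< (w , lt , V , m) = <-trans (component< m) lt

  Comp-sound : ∀ {c : Code 1} {x v s} → Comp ⌜ c ⌝ x v s → c ∙ (x ∷ []) ⇓ v
  Comp-sound {c} {x} {v} (w , _ , V , m) = proj₁ (sound w V) c (x ∷ []) v m

  Comp-complete : ∀ {c : Code 1} {x v} → c ∙ (x ∷ []) ⇓ v → ∃ λ s → Comp ⌜ c ⌝ x v s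
  Comp-complete d with complete d 0 Valid-0
  ... | w , V , _ , m = suc w , w , n<1+n w , V , m

Halt : ℕ → ℕ → ℕ → Set
Halt c x s = ∃ λ v → v < s × Comp c x v s

Haltᵈ : ∀ {n} {c x s : Vec ℕ n → ℕ} → Fn c → Fn x → Fn s → Dc (λ ρ → Halt (c ρ) (x ρ) (s ρ))
Haltᵈ C X S = ∃ᵈ {3} v2 (Compᵈ v1 v2 v0 v3) $ᵈ C ∷ᶠ X ∷ᶠ S ∷ᶠ []ᶠ

Halt-mono : ∀ {c x s s'} → s ≤ s' → Halt c x s → Halt c x s'
Halt-mono le (v , lt , h) = v , <-≤-trans lt le , Comp-mono le h

Halt-W : ∀ {c : Code 1} {x} → (∃ λ s → Halt ⌜ c ⌝ x s) ⟺ W c x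
Halt-W {c} {x} = (λ (s , v , _ , h) → v , Comp-sound h) ,
                 (λ (v , d) → let s , h = Comp-complete d in s , v , Comp-< h , h)

module _ {P : Vec ℕ 2 → Set} (D : Dc P) where
  enum : Code 1
  enum = projection D

  enum-spec : ∀ {n} → W enum n ⟺ (∃ λ s → P (s ∷ n ∷ []))
  enum-spec = Equivalence.to (projection-spec D) , Equivalence.from (projection-spec D)

private
  universalᵈ : Dc {2} (λ ρ → Halt (fst (lookup ρ (suc zero))) (snd (lookup ρ (suc zero))) (lookup ρ zero))
  universalᵈ = Haltᵈ (fstᶠ v1) (sndᶠ v1) v0

opaque
  universal : Code 1
  universal = enum universalᵈ

  K-halt : ∀ {n} → W universal n ⟺ (∃ λ s → Halt (fst n) (snd n) s)
  K-halt = enum-spec universalᵈ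

K : ℕ → Set
K = W universal

K-spec : ∀ {c x} → K ⟨ c , x ⟩ ⟺ (∃ λ s → Halt c x s)
K-spec {c} {x} = (λ k → subst₂ (λ a b → ∃ λ s → Halt a b s) fst-⟨⟩ snd-⟨⟩ (proj₁ K-halt k)) ,
                 (λ h → proj₂ K-halt (subst₂ (λ a b → ∃ λ s → Halt a b s) (sym fst-⟨⟩) (sym snd-⟨⟩) h))

K-top : ∀ (c : Code 1) → W c ≤ₘ K
K-top c = reduction (sucᶠ (sucᶠ ⟨ kn ⌜ c ⌝ , v0 ⟩ᶠ))
  (λ n w → proj₂ K-spec (proj₂ Halt-W w)) (λ n k → proj₁ Halt-W (proj₁ K-spec k))

-- The finite-injury construction of the sets Wᵢ

-- An element k = ⟨ c , ⟨ t , a ⟩ ⟩ of the universe of Wᵢ lies in column c.  For t = 0 it is meant to be in Wᵢ iff k ∈ Aᵢ;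
-- for t = 1 it belongs to the pool with which column c serves the c-th computable colouring;
-- for t ≥ 2 it stays out of Wᵢ unless a requirement uses it.
elt : ℕ → ℕ → ℕ → ℕ
elt c t a = ⟨ c , ⟨ t , a ⟩ ⟩

col tag idx : ℕ → ℕ
col k = fst k
tag k = fst (snd k)
idx k = snd (snd k)

-- The state of the construction is the list of the actions taken.  The action cp i k m γ makes k, of colour γ, a copy of m < k;
-- fz i k r l v freezes k on behalf of the requirement r: from now on k ∈ Wᵢ iff l ∈ K, and v is the value of the
-- second function of r that is to be compared with K at l.
cp : ℕ → ℕ → ℕ → ℕ → ℕ
cp i k m γ = ⟨ 0 , ⟨ i , ⟨ k , ⟨ m , γ ⟩ ⟩ ⟩ ⟩

fz : ℕ → ℕ → ℕ → ℕ → ℕ → ℕ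
fz i k r l v = ⟨ 1 , ⟨ i , ⟨ k , ⟨ r , ⟨ l , v ⟩ ⟩ ⟩ ⟩ ⟩

eltᶠ : ∀ {n} {c t a : Vec ℕ n → ℕ} → Fn c → Fn t → Fn a → Fn (λ ρ → elt (c ρ) (t ρ) (a ρ))
eltᶠ C T A = ⟨ C , ⟨ T , A ⟩ᶠ ⟩ᶠ

cpᶠ : ∀ {n} {i k m γ : Vec ℕ n → ℕ} → Fn i → Fn k → Fn m → Fn γ → Fn (λ ρ → cp (i ρ) (k ρ) (m ρ) (γ ρ))
cpᶠ I K M G = ⟨ kn 0 , ⟨ I , ⟨ K , ⟨ M , G ⟩ᶠ ⟩ᶠ ⟩ᶠ ⟩ᶠ

fzᶠ : ∀ {n} {i k r l v : Vec ℕ n → ℕ} → Fn i → Fn k → Fn r → Fn l → Fn v → Fn (λ ρ → fz (i ρ) (k ρ) (r ρ) (l ρ) (v ρ))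
fzᶠ I K R L V = ⟨ kn 1 , ⟨ I , ⟨ K , ⟨ R , ⟨ L , V ⟩ᶠ ⟩ᶠ ⟩ᶠ ⟩ᶠ ⟩ᶠ

module _ (H i k : ℕ) where

  Copies : ℕ → Set
  Copies m = ∃ λ γ → γ < H × cp i k m γ ∈ H

  Copied : Set
  Copied = ∃ λ m → m < H × Copies m

  FrozenBy : ℕ → Set
  FrozenBy r = ∃ λ l → l < H × ∃ λ v → v < H × fz i k r l v ∈ H

  FrozenBelow : ℕ → Set
  FrozenBelow b = ∃ λ r → r < b × FrozenBy r

  Frozen : Set
  Frozen = FrozenBelow H

  -- Several requirements may freeze k one after the other; the strongest one prevails.
  InForce : (r l v : ℕ) → Set
  InForce r l v = fz i k r l v ∈ H × ¬ FrozenBelow r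

Kˢ : ℕ → ℕ → Set
Kˢ l s = Halt (fst l) (snd l) s

Held : (H i r l : ℕ) → Set
Held H i r l = ∃ λ k → k < H × ∃ λ v → v < H × InForce H i k r l v

Covered : (H i c m γ : ℕ) → Set
Covered H i c m γ = ∃ λ k → k < H × col k ≡ c × cp i k m γ ∈ H

-- Convergence is demanded on the whole initial segment of the pool, so that a colouring undefined
-- somewhere on its pool produces only finitely many copies.
PoolReady : (H s i k : ℕ) → Set
PoolReady H s i k = k ≡ elt (col k) 1 (idx k) × ¬ Copied H i k × ¬ Frozen H i k ×
  (∀ a → a < suc (idx k) → Halt (col k) (elt (col k) 1 a) s)

opaque
  Copiesᵈ : ∀ {n} {H i k m : Vec ℕ n → ℕ} → Fn H → Fn i → Fn k → Fn m → Dc (λ ρ → Copies (H ρ) (i ρ) (k ρ) (m ρ))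
  Copiesᵈ H I K M = ∃ᵈ {4} v0 (∈ᵈ (cpᶠ v2 v3 v4 v0) v1) $ᵈ H ∷ᶠ I ∷ᶠ K ∷ᶠ M ∷ᶠ []ᶠ

  Copiedᵈ : ∀ {n} {H i k : Vec ℕ n → ℕ} → Fn H → Fn i → Fn k → Dc (λ ρ → Copied (H ρ) (i ρ) (k ρ))
  Copiedᵈ H I K = ∃ᵈ {3} v0 (Copiesᵈ v1 v2 v3 v0) $ᵈ H ∷ᶠ I ∷ᶠ K ∷ᶠ []ᶠ

  FrozenByᵈ : ∀ {n} {H i k r : Vec ℕ n → ℕ} → Fn H → Fn i → Fn k → Fn r → Dc (λ ρ → FrozenBy (H ρ) (i ρ) (k ρ) (r ρ))
  FrozenByᵈ H I K R = ∃ᵈ {4} v0 (∃ᵈ v1 (∈ᵈ (fzᶠ v3 v4 v5 v1 v0) v2)) $ᵈ H ∷ᶠ I ∷ᶠ K ∷ᶠ R ∷ᶠ []ᶠ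

  FrozenBelowᵈ : ∀ {n} {H i k b : Vec ℕ n → ℕ} → Fn H → Fn i → Fn k → Fn b → Dc (λ ρ → FrozenBelow (H ρ) (i ρ) (k ρ) (b ρ))
  FrozenBelowᵈ H I K B = ∃ᵈ {4} v3 (FrozenByᵈ v1 v2 v3 v0) $ᵈ H ∷ᶠ I ∷ᶠ K ∷ᶠ B ∷ᶠ []ᶠ

  InForceᵈ : ∀ {n} {H i k r l v : Vec ℕ n → ℕ} → Fn H → Fn i → Fn k → Fn r → Fn l → Fn v →
             Dc (λ ρ → InForce (H ρ) (i ρ) (k ρ) (r ρ) (l ρ) (v ρ))
  InForceᵈ H I K R L V = ∈ᵈ (fzᶠ I K R L V) H ×ᵈ ¬ᵈ (FrozenBelowᵈ H I K R)

  Kˢᵈ : ∀ {n} {l s : Vec ℕ n → ℕ} → Fn l → Fn s → Dc (λ ρ → Kˢ (l ρ) (s ρ))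
  Kˢᵈ L S = Haltᵈ (fstᶠ L) (sndᶠ L) S

  Heldᵈ : ∀ {n} {H i r l : Vec ℕ n → ℕ} → Fn H → Fn i → Fn r → Fn l → Dc (λ ρ → Held (H ρ) (i ρ) (r ρ) (l ρ))
  Heldᵈ H I R L = ∃ᵈ {4} v0 (∃ᵈ v1 (InForceᵈ v2 v3 v1 v4 v5 v0)) $ᵈ H ∷ᶠ I ∷ᶠ R ∷ᶠ L ∷ᶠ []ᶠ

  Coveredᵈ : ∀ {n} {H i c m γ : Vec ℕ n → ℕ} → Fn H → Fn i → Fn c → Fn m → Fn γ →
             Dc (λ ρ → Covered (H ρ) (i ρ) (c ρ) (m ρ) (γ ρ))
  Coveredᵈ H I C M G = ∃ᵈ {5} v0 ((fstᶠ v0 ≡ᵈ v3) ×ᵈ ∈ᵈ (cpᶠ v2 v0 v4 v5) v1) $ᵈ H ∷ᶠ I ∷ᶠ C ∷ᶠ M ∷ᶠ G ∷ᶠ []ᶠ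

  PoolReadyᵈ : ∀ {n} {H s i k : Vec ℕ n → ℕ} → Fn H → Fn s → Fn i → Fn k → Dc (λ ρ → PoolReady (H ρ) (s ρ) (i ρ) (k ρ))
  PoolReadyᵈ H S I K = ((v3 ≡ᵈ eltᶠ (fstᶠ v3) (kn 1) (sndᶠ (sndᶠ v3))) ×ᵈ ¬ᵈ (Copiedᵈ v0 v2 v3) ×ᵈ ¬ᵈ (FrozenBelowᵈ v0 v2 v3 v0) ×ᵈ
    ∀ᵈ (sucᶠ (sndᶠ (sndᶠ v3))) (Haltᵈ (fstᶠ v4) (eltᶠ (fstᶠ v4) (kn 1) v0) v2))
    $ᵈ H ∷ᶠ S ∷ᶠ I ∷ᶠ K ∷ᶠ []ᶠ

private
  nextᵈ : Dc {4} (λ ρ → Copies (x1 ρ) (x2 ρ) (x3 ρ) (x0 ρ))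
  nextᵈ = Copiesᵈ v1 v2 v3 v0

  colourᵈ : Dc {3} (λ ρ → Comp (col (x2 ρ)) (x2 ρ) (x0 ρ) (x1 ρ))
  colourᵈ = Compᵈ (fstᶠ v2) v2 v0 v1

  -- The alternative `suc m ≡ k` is the default k ∸ 1: it keeps the target below k, so that chains
  -- of copies descend.
  targetᵈ : Dc {5} (λ ρ → ¬ Covered (x1 ρ) (x2 ρ) (col (x3 ρ)) (x0 ρ) (x4 ρ) ⊎ suc (x0 ρ) ≡ x3 ρ)
  targetᵈ = ¬ᵈ (Coveredᵈ v1 v2 (fstᶠ v3) v0 v4) ⊎ᵈ (sucᶠ v0 ≡ᵈ v3)

  labelᵈ : Dc {5} (λ ρ → ¬ Held (x1 ρ) (x3 ρ) (x4 ρ) (x0 ρ))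
  labelᵈ = ¬ᵈ Heldᵈ v1 v3 v4 v0

opaque
  next : (H i k : ℕ) → ℕ
  next H i k = min nextᵈ (H ∷ i ∷ k ∷ []) k

  next-spec : ∀ H i k → IsMin (λ m → Copies H i k m) k (next H i k)
  next-spec H i k = min-spec nextᵈ (H ∷ i ∷ k ∷ []) k

  nextᶠ : ∀ {n} {H i k : Vec ℕ n → ℕ} → Fn H → Fn i → Fn k → Fn (λ ρ → next (H ρ) (i ρ) (k ρ))
  nextᶠ H I K = Fn-ext {3} {g = λ ρ → next (x0 ρ) (x1 ρ) (x2 ρ)} (λ { (H ∷ i ∷ k ∷ []) → refl }) (minᶠ nextᵈ v2) $ᶠ H ∷ᶠ I ∷ᶠ K ∷ᶠ []ᶠ

  colour : (s k : ℕ) → ℕ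
  colour s k = min colourᵈ (s ∷ k ∷ []) s

  colour-spec : ∀ s k → IsMin (λ v → Comp (col k) k v s) s (colour s k)
  colour-spec s k = min-spec colourᵈ (s ∷ k ∷ []) s

  colourᶠ : ∀ {n} {s k : Vec ℕ n → ℕ} → Fn s → Fn k → Fn (λ ρ → colour (s ρ) (k ρ))
  colourᶠ S K = Fn-ext {2} {g = λ ρ → colour (x0 ρ) (x1 ρ)} (λ { (s ∷ k ∷ []) → refl }) (minᶠ colourᵈ v0) $ᶠ S ∷ᶠ K ∷ᶠ []ᶠ

  target : (H i k γ : ℕ) → ℕ
  target H i k γ = min targetᵈ (H ∷ i ∷ k ∷ γ ∷ []) k

  target-spec : ∀ H i k γ → IsMin (λ m → ¬ Covered H i (col k) m γ ⊎ suc m ≡ k) k (target H i k γ)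
  target-spec H i k γ = min-spec targetᵈ (H ∷ i ∷ k ∷ γ ∷ []) k

  targetᶠ : ∀ {n} {H i k γ : Vec ℕ n → ℕ} → Fn H → Fn i → Fn k → Fn γ → Fn (λ ρ → target (H ρ) (i ρ) (k ρ) (γ ρ))
  targetᶠ H I K G = Fn-ext {4} {g = λ ρ → target (x0 ρ) (x1 ρ) (x2 ρ) (x3 ρ)} (λ { (H ∷ i ∷ k ∷ γ ∷ []) → refl }) (minᶠ targetᵈ v2) $ᶠ H ∷ᶠ I ∷ᶠ K ∷ᶠ G ∷ᶠ []ᶠ

  label : (H s i r : ℕ) → ℕ
  label H s i r = min labelᵈ (H ∷ s ∷ i ∷ r ∷ []) s

  label-spec : ∀ H s i r → IsMin (λ l → ¬ Held H i r l) s (label H s i r)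
  label-spec H s i r = min-spec labelᵈ (H ∷ s ∷ i ∷ r ∷ []) s

  labelᶠ : ∀ {n} {H s i r : Vec ℕ n → ℕ} → Fn H → Fn s → Fn i → Fn r → Fn (λ ρ → label (H ρ) (s ρ) (i ρ) (r ρ))
  labelᶠ H S I R = Fn-ext {4} {g = λ ρ → label (x0 ρ) (x1 ρ) (x2 ρ) (x3 ρ)} (λ { (H ∷ s ∷ i ∷ r ∷ []) → refl }) (minᶠ labelᵈ v1) $ᶠ H ∷ᶠ S ∷ᶠ I ∷ᶠ R ∷ᶠ []ᶠ

opaque
  -- Copies point to smaller elements and `next` fixes the others, so k steps reach the end of the
  -- chain.
  root : (H i k : ℕ) → ℕ
  root H i k = nrec k (λ _ m → next H i m) k

  rootᶠ : ∀ {n} {H i k : Vec ℕ n → ℕ} → Fn H → Fn i → Fn k → Fn (λ ρ → root (H ρ) (i ρ) (k ρ))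
  rootᶠ H I K = Fn-ext {3} {g = λ ρ → root (x0 ρ) (x1 ρ) (x2 ρ)} (λ { (H ∷ i ∷ k ∷ []) → refl }) (recᶠ {3} v2 (nextᶠ v2 v3 v1) $ᶠ v2 ∷ᶠ v0 ∷ᶠ v1 ∷ᶠ v2 ∷ᶠ []ᶠ)
    $ᶠ H ∷ᶠ I ∷ᶠ K ∷ᶠ []ᶠ

-- ē and ᾱ number the c.e. sets E and A.  The i-th tower is the join of E and the Wⱼ with j < i.
module Stages (ē ᾱ : ℕ) where

  -- Only roots are decided directly; the other elements follow the root of their chain of copies.
  RootIn : (H s i k : ℕ) → Set
  RootIn H s i k =
    (∃ λ r → r < H × ∃ λ l → l < H × ∃ λ v → v < H × InForce H i k r l v × Kˢ l s) ⊎
    (¬ Frozen H i k × tag k ≡ 0 × Halt ᾱ ⟨ i , k ⟩ s)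

  Mem : (H s i k : ℕ) → Set
  Mem H s i k = RootIn H s i (root H i k)

  TowerMem : (H s i w : ℕ) → Set
  TowerMem H s i w = (fst w ≡ 0 × Halt ē (snd w) s) ⊎ (∃ λ j → j < i × fst w ≡ suc j × Mem H s j (snd w))

  TowerVal : (H s i v : ℕ) → Set
  TowerVal H s i v = v ≡ 1 ⊎ (1 < v × TowerMem H s i (v ∸ 2))

  -- A requirement acts only while `K` and the tower look alike on all labels that it holds.
  -- Infinitely many actions therefore turn l ↦ v into a correct reduction.
  Agree : (H s i r : ℕ) → Set
  Agree H s i r = ∀ k → k < H → ∀ l → l < H → ∀ v → v < H → InForce H i k r l v →
    (Kˢ l s → TowerVal H s i v) × (TowerVal H s i v → Kˢ l s)

  -- Requirement r = ⟨ f , g ⟩ works against f : Q ≤ Wᵢ and g : Q ≤ towerᵢ.  It codes K into the roots of the values of f that lie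
  -- in columns beyond r; if it could do so forever, K would be reducible to the tower via g.
  Attackable : (H s i r k : ℕ) → Set
  Attackable H s i r k = r < col k × ¬ RootIn H s i k × ¬ FrozenBelow H i k (suc r)

  -- y = ⟨ n , ⟨ f n ∸ 2 , g n ⟩ ⟩
  Attack : (H s i r y : ℕ) → Set
  Attack H s i r y = Comp (fst r) (fst y) (suc (suc (fst (snd y)))) s × Comp (snd r) (fst y) (snd (snd y)) s ×
    Attackable H s i r (root H i (fst (snd y)))

  Active : (H s i r : ℕ) → Set
  Active H s i r = Agree H s i r × ∃ λ y → y < s × Attack H s i r y

  opaque
    RootInᵈ : ∀ {n} {H s i k : Vec ℕ n → ℕ} → Fn H → Fn s → Fn i → Fn k → Dc (λ ρ → RootIn (H ρ) (s ρ) (i ρ) (k ρ))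
    RootInᵈ H S I K = (∃ᵈ {4} v0 (∃ᵈ v1 (∃ᵈ v2 (InForceᵈ v3 v5 v6 v2 v1 v0 ×ᵈ Kˢᵈ v1 v4))) ⊎ᵈ
      (¬ᵈ (FrozenBelowᵈ v0 v2 v3 v0) ×ᵈ (fstᶠ (sndᶠ v3) ≡ᵈ kn 0) ×ᵈ Haltᵈ (kn ᾱ) ⟨ v2 , v3 ⟩ᶠ v1))
      $ᵈ H ∷ᶠ S ∷ᶠ I ∷ᶠ K ∷ᶠ []ᶠ

    Memᵈ : ∀ {n} {H s i k : Vec ℕ n → ℕ} → Fn H → Fn s → Fn i → Fn k → Dc (λ ρ → Mem (H ρ) (s ρ) (i ρ) (k ρ))
    Memᵈ H S I K = RootInᵈ H S I (rootᶠ H I K)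

    TowerValᵈ : ∀ {n} {H s i v : Vec ℕ n → ℕ} → Fn H → Fn s → Fn i → Fn v → Dc (λ ρ → TowerVal (H ρ) (s ρ) (i ρ) (v ρ))
    TowerValᵈ H S I V = ((v3 ≡ᵈ kn 1) ⊎ᵈ ((kn 1 <ᵈ v3) ×ᵈ
      (((fstᶠ (v3 ∸ᶠ kn 2) ≡ᵈ kn 0) ×ᵈ Haltᵈ (kn ē) (sndᶠ (v3 ∸ᶠ kn 2)) v1) ⊎ᵈ
       ∃ᵈ {4} v2 ((fstᶠ (v4 ∸ᶠ kn 2) ≡ᵈ sucᶠ v0) ×ᵈ Memᵈ v1 v2 v0 (sndᶠ (v4 ∸ᶠ kn 2))))))
      $ᵈ H ∷ᶠ S ∷ᶠ I ∷ᶠ V ∷ᶠ []ᶠ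

    Agreeᵈ : ∀ {n} {H s i r : Vec ℕ n → ℕ} → Fn H → Fn s → Fn i → Fn r → Dc (λ ρ → Agree (H ρ) (s ρ) (i ρ) (r ρ))
    Agreeᵈ H S I R = ∀ᵈ {4} v0 (∀ᵈ v1 (∀ᵈ v2 (InForceᵈ v3 v5 v2 v6 v1 v0 →ᵈ
      ((Kˢᵈ v1 v4 →ᵈ TowerValᵈ v3 v4 v5 v0) ×ᵈ (TowerValᵈ v3 v4 v5 v0 →ᵈ Kˢᵈ v1 v4)))))
      $ᵈ H ∷ᶠ S ∷ᶠ I ∷ᶠ R ∷ᶠ []ᶠ

    Attackᵈ : ∀ {n} {H s i r y : Vec ℕ n → ℕ} → Fn H → Fn s → Fn i → Fn r → Fn y →
              Dc (λ ρ → Attack (H ρ) (s ρ) (i ρ) (r ρ) (y ρ))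
    Attackᵈ H S I R Y = (Compᵈ (fstᶠ v3) (fstᶠ v4) (sucᶠ (sucᶠ (fstᶠ (sndᶠ v4)))) v1 ×ᵈ
      Compᵈ (sndᶠ v3) (fstᶠ v4) (sndᶠ (sndᶠ v4)) v1 ×ᵈ (v3 <ᵈ fstᶠ (rootᶠ v0 v2 (fstᶠ (sndᶠ v4)))) ×ᵈ
      ¬ᵈ (RootInᵈ v0 v1 v2 (rootᶠ v0 v2 (fstᶠ (sndᶠ v4)))) ×ᵈ ¬ᵈ (FrozenBelowᵈ v0 v2 (rootᶠ v0 v2 (fstᶠ (sndᶠ v4))) (sucᶠ v3)))
      $ᵈ H ∷ᶠ S ∷ᶠ I ∷ᶠ R ∷ᶠ Y ∷ᶠ []ᶠ

    Activeᵈ : ∀ {n} {H s i r : Vec ℕ n → ℕ} → Fn H → Fn s → Fn i → Fn r → Dc (λ ρ → Active (H ρ) (s ρ) (i ρ) (r ρ))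
    Activeᵈ H S I R = (Agreeᵈ v0 v1 v2 v3 ×ᵈ ∃ᵈ {4} v1 (Attackᵈ v1 v2 v3 v4 v0)) $ᵈ H ∷ᶠ S ∷ᶠ I ∷ᶠ R ∷ᶠ []ᶠ

  private
    attackᵈ : Dc {5} (λ ρ → Attack (x1 ρ) (x2 ρ) (x3 ρ) (x4 ρ) (x0 ρ))
    attackᵈ = Attackᵈ v1 v2 v3 v4 v0

  opaque
    attack : (H s i r : ℕ) → ℕ
    attack H s i r = min attackᵈ (H ∷ s ∷ i ∷ r ∷ []) s

    attack-spec : ∀ H s i r → IsMin (Attack H s i r) s (attack H s i r)
    attack-spec H s i r = min-spec attackᵈ (H ∷ s ∷ i ∷ r ∷ []) s

    attackᶠ : ∀ {n} {H s i r : Vec ℕ n → ℕ} → Fn H → Fn s → Fn i → Fn r → Fn (λ ρ → attack (H ρ) (s ρ) (i ρ) (r ρ))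
    attackᶠ H S I R = Fn-ext {4} {g = λ ρ → attack (x0 ρ) (x1 ρ) (x2 ρ) (x3 ρ)} (λ { (H ∷ s ∷ i ∷ r ∷ []) → refl }) (minᶠ attackᵈ v1) $ᶠ H ∷ᶠ S ∷ᶠ I ∷ᶠ R ∷ᶠ []ᶠ

  private
    poolᵈ : Dc {4} (λ ρ → PoolReady (x0 ρ) (x1 ρ) (x2 ρ) (x3 ρ))
    poolᵈ = PoolReadyᵈ v0 v1 v2 v3

    activeᵈ : Dc {4} (λ ρ → Active (x0 ρ) (x1 ρ) (x2 ρ) (x3 ρ))
    activeᵈ = Activeᵈ v0 v1 v2 v3

    kindᵈ : Dc {2} (λ ρ → fst (fst (x1 ρ)) ≡ 0)
    kindᵈ = fstᶠ (fstᶠ v1) ≡ᵈ kn 0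

    -- A stage s attends to what fst s codes: ⟨ 0 , ⟨ i , k ⟩ ⟩ is the pool element k, ⟨ 1 , ⟨ i , r ⟩ ⟩ the requirement r.
    poolStep attackStep stepBody : ℕ → ℕ → ℕ
    poolStep s H = let i = fst (snd (fst s)) ; k = snd (snd (fst s)) in
      choose (dec poolᵈ (H ∷ s ∷ i ∷ k ∷ [])) (cons (cp i k (target H i k (colour s k)) (colour s k)) H) H
    attackStep s H = let i = fst (snd (fst s)) ; r = snd (snd (fst s)) ; y = attack H s i r in
      choose (dec activeᵈ (H ∷ s ∷ i ∷ r ∷ [])) (cons (fz i (root H i (fst (snd y))) r (label H s i r) (snd (snd y))) H) H
    stepBody s H = choose (dec kindᵈ (H ∷ s ∷ [])) (poolStep s H) (attackStep s H)

    stepᶠ : Fn {2} (λ ρ → stepBody (lookup ρ (suc zero)) (lookup ρ zero))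
    stepᶠ = Fn-ext (λ { (H ∷ s ∷ []) → refl })
      (ifᶠ kindᵈ
        (ifᶠ poolᵈ (consᶠ (cpᶠ v2 v3 (targetᶠ v0 v2 v3 (colourᶠ v1 v3)) (colourᶠ v1 v3)) v0) v0
          $ᶠ v0 ∷ᶠ v1 ∷ᶠ fstᶠ (sndᶠ (fstᶠ v1)) ∷ᶠ sndᶠ (sndᶠ (fstᶠ v1)) ∷ᶠ []ᶠ)
        (ifᶠ activeᵈ (consᶠ (fzᶠ v2 (rootᶠ v0 v2 (fstᶠ (sndᶠ (attackᶠ v0 v1 v2 v3)))) v3 (labelᶠ v0 v1 v2 v3)
            (sndᶠ (sndᶠ (attackᶠ v0 v1 v2 v3)))) v0) v0
          $ᶠ v0 ∷ᶠ v1 ∷ᶠ fstᶠ (sndᶠ (fstᶠ v1)) ∷ᶠ sndᶠ (sndᶠ (fstᶠ v1)) ∷ᶠ []ᶠ))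

  opaque
    St : ℕ → ℕ
    St = nrec 0 stepBody

    Stᶠ : ∀ {n} {s : Vec ℕ n → ℕ} → Fn s → Fn (λ ρ → St (s ρ))
    Stᶠ S = Fn-ext {1} {g = λ ρ → St (x0 ρ)} (λ { (s ∷ []) → refl }) (recᶠ {0} (kn 0) (stepᶠ $ᶠ v1 ∷ᶠ v0 ∷ᶠ []ᶠ)) $ᶠ S ∷ᶠ []ᶠ

    St-0 : St 0 ≡ 0
    St-0 = refl

  data Step (s : ℕ) : Set where
    idle   : St (suc s) ≡ St s →
             (fst (fst s) ≡ 0 → ¬ PoolReady (St s) s (fst (snd (fst s))) (snd (snd (fst s)))) →
             (fst (fst s) ≢ 0 → ¬ Active (St s) s (fst (snd (fst s))) (snd (snd (fst s)))) → Step s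
    copy   : ∀ {i k γ} → fst (fst s) ≡ 0 → i ≡ fst (snd (fst s)) → k ≡ snd (snd (fst s)) → PoolReady (St s) s i k → γ ≡ colour s k →
             St (suc s) ≡ cons (cp i k (target (St s) i k γ) γ) (St s) → Step s
    freeze : ∀ {i r y} → fst (fst s) ≢ 0 → i ≡ fst (snd (fst s)) → r ≡ snd (snd (fst s)) → Active (St s) s i r →
             y ≡ attack (St s) s i r →
             St (suc s) ≡ cons (fz i (root (St s) i (fst (snd y))) r (label (St s) s i r) (snd (snd y))) (St s) → Step s

  opaque
    unfolding St

    step : ∀ s → Step s
    step s = go (dec kindᵈ (H ∷ s ∷ [])) (dec poolᵈ (H ∷ s ∷ i ∷ k ∷ [])) (dec activeᵈ (H ∷ s ∷ i ∷ k ∷ [])) refl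
      where
      H i k : ℕ
      H = St s
      i = fst (snd (fst s))
      k = snd (snd (fst s))
      go : (a : Dec (fst (fst s) ≡ 0)) (b : Dec (PoolReady H s i k)) (c : Dec (Active H s i k)) →
           St (suc s) ≡ choose a (choose b (cons (cp i k (target H i k (colour s k)) (colour s k)) H) H)
             (choose c (cons (fz i (root H i (fst (snd (attack H s i k)))) k (label H s i k) (snd (snd (attack H s i k)))) H) H) →
           Step s
      go (yes a) (yes b) c e = copy a refl refl b refl e
      go (yes a) (no b) c e = idle e (λ _ → b) (λ n → ⊥-elim (n a))
      go (no a) b (yes c) e = freeze a refl refl c refl e
      go (no a) b (no c) e = idle e (λ z → ⊥-elim (a z)) (λ _ → c)

-- Components of elements and of actions

col-elt : ∀ {c t a} → col (elt c t a) ≡ c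
col-elt = fst-⟨⟩

tag-elt : ∀ {c t a} → tag (elt c t a) ≡ t
tag-elt = trans (cong fst snd-⟨⟩) fst-⟨⟩

idx-elt : ∀ {c t a} → idx (elt c t a) ≡ a
idx-elt = trans (cong snd snd-⟨⟩) snd-⟨⟩

≤elt : ∀ {c t a} → a ≤ elt c t a
≤elt = ≤-trans ≤⟨⟩ʳ ≤⟨⟩ʳ

cp-injective : ∀ {i k m γ i' k' m' γ'} → cp i k m γ ≡ cp i' k' m' γ' → i ≡ i' × k ≡ k' × m ≡ m' × γ ≡ γ'
cp-injective e with ⟨⟩-injective (proj₂ (⟨⟩-injective e))
... | a , e₁ with ⟨⟩-injective e₁
... | b , e₂ with ⟨⟩-injective e₂
... | c , d = a , b , c , d

fz-injective : ∀ {i k r l v i' k' r' l' v'} → fz i k r l v ≡ fz i' k' r' l' v' → i ≡ i' × k ≡ k' × r ≡ r' × l ≡ l' × v ≡ v'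
fz-injective e with ⟨⟩-injective (proj₂ (⟨⟩-injective e))
... | a , e₁ with ⟨⟩-injective e₁
... | b , e₂ with ⟨⟩-injective e₂
... | c , e₃ with ⟨⟩-injective e₃
... | d , f = a , b , c , d , f

cp≢fz : ∀ {i k m γ i' k' r l v} → cp i k m γ ≢ fz i' k' r l v
cp≢fz e with proj₁ (⟨⟩-injective e)
... | ()

module _ {H i k m γ} (p : cp i k m γ ∈ H) where
  private
    below : ⟨ k , ⟨ m , γ ⟩ ⟩ < H
    below = ≤-<-trans (≤-trans ≤⟨⟩ʳ ≤⟨⟩ʳ) (∈⇒< p)

  cp-k< : k < H
  cp-k< = ≤-<-trans ≤⟨⟩ˡ below

  cp-copies : Copies H i k m
  cp-copies = γ , ≤-<-trans (≤-trans ≤⟨⟩ʳ ≤⟨⟩ʳ) below , p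

  cp-copied : Copied H i k
  cp-copied = m , ≤-<-trans (≤-trans ≤⟨⟩ˡ ≤⟨⟩ʳ) below , cp-copies

module _ {H i k r l v} (p : fz i k r l v ∈ H) where
  private
    below : ⟨ k , ⟨ r , ⟨ l , v ⟩ ⟩ ⟩ < H
    below = ≤-<-trans (≤-trans ≤⟨⟩ʳ ≤⟨⟩ʳ) (∈⇒< p)

  fz-k< : k < H
  fz-k< = ≤-<-trans ≤⟨⟩ˡ below

  fz-r< : r < H
  fz-r< = ≤-<-trans (≤-trans ≤⟨⟩ˡ ≤⟨⟩ʳ) below

  fz-l< : l < H
  fz-l< = ≤-<-trans (≤-trans (≤-trans ≤⟨⟩ˡ ≤⟨⟩ʳ) ≤⟨⟩ʳ) below

  fz-v< : v < H
  fz-v< = ≤-<-trans (≤-trans (≤-trans ≤⟨⟩ʳ ≤⟨⟩ʳ) ≤⟨⟩ʳ) below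

  fz-frozenBy : FrozenBy H i k r
  fz-frozenBy = l , fz-l< , v , fz-v< , p

  fz-frozen : Frozen H i k
  fz-frozen = r , fz-r< , fz-frozenBy

  fz-frozenBelow : ∀ {b} → r < b → FrozenBelow H i k b
  fz-frozenBelow lt = r , lt , fz-frozenBy

-- Iteration of a deflationary map

module _ (f : ℕ → ℕ) (f≤ : ∀ x → f x ≤ x) where
  private
    it : ℕ → ℕ → ℕ
    it n x = nrec x (λ _ → f) n

    progress : ∀ n x → f (it n x) ≡ it n x ⊎ it n x + n ≤ x
    progress zero x = inj₂ (≤-reflexive (+-identityʳ x))
    progress (suc n) x with progress n x
    ... | inj₁ e = inj₁ (cong f e)
    ... | inj₂ le with m≤n⇒m<n∨m≡n (f≤ (it n x))
    ... | inj₁ lt = inj₂ (≤-trans (≤-reflexive (+-suc _ n)) (≤-trans (+-monoˡ-≤ n lt) le))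
    ... | inj₂ e = inj₁ (cong f e)

    stable : ∀ {n x} → x ≤ n → f (it n x) ≡ it n x
    stable {n} {x} x≤n with progress n x
    ... | inj₁ e = e
    ... | inj₂ le = subst (λ y → f y ≡ y) (sym y≡0) (n≤0⇒n≡0 (f≤ 0))
      where
      y≡0 : it n x ≡ 0
      y≡0 = n≤0⇒n≡0 (+-cancelʳ-≤ n (it n x) 0 (≤-trans le x≤n))

    beyond : ∀ x d → it (d + x) x ≡ it x x
    beyond x zero = refl
    beyond x (suc d) = trans (stable (m≤n+m x d)) (beyond x d)

    shift : ∀ n x → it (suc n) x ≡ it n (f x)
    shift zero x = refl
    shift (suc n) x = cong f (shift n x)

  iterate-fixed : ∀ x → f (it x x) ≡ it x x
  iterate-fixed x = stable {x} ≤-refl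

  iterate-≤ : ∀ n x → it n x ≤ x
  iterate-≤ zero x = ≤-refl
  iterate-≤ (suc n) x = ≤-trans (f≤ _) (iterate-≤ n x)

  iterate-at-fixed : ∀ n {x} → f x ≡ x → it n x ≡ x
  iterate-at-fixed zero e = refl
  iterate-at-fixed (suc n) e = trans (cong f (iterate-at-fixed n e)) e

  iterate-step : ∀ x → it x x ≡ it (f x) (f x)
  iterate-step zero rewrite n≤0⇒n≡0 (f≤ 0) = refl
  iterate-step (suc j) with m≤n⇒m<n∨m≡n (f≤ (suc j))
  ... | inj₂ e rewrite e = refl
  ... | inj₁ (s≤s le) = trans (shift j (suc j)) (trans (cong (λ n → it n (f (suc j))) (sym (m∸n+n≡m le))) (beyond (f (suc j)) (j ∸ f (suc j))))

-- Invariants of the list of actions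

module Invariants (ē ᾱ : ℕ) where
  open Stages ē ᾱ

  record CpFact (s i k m γ : ℕ) : Set where
    field
      kind  : fst (fst s) ≡ 0
      ready : PoolReady (St s) s i k
      γ≡    : γ ≡ colour s k
      m≡    : m ≡ target (St s) i k γ

  record FzFact (s i k r l v : ℕ) : Set where
    field
      kind       : fst (fst s) ≢ 0
      agree      : Agree (St s) s i r
      attackable : Attackable (St s) s i r k
      y          : ℕ
      fst-val    : Comp (fst r) (fst y) (suc (suc (fst (snd y)))) s
      snd-val    : Comp (snd r) (fst y) v s
      k≡         : k ≡ root (St s) i (fst (snd y))
      l≡         : l ≡ label (St s) s i r
      v≡         : v ≡ snd (snd (attack (St s) s i r))

  St-step : ∀ s {a} → a ∈ St s → a ∈ St (suc s)
  St-step s p with step s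
  ... | idle e _ _ rewrite e = p
  ... | copy _ _ _ _ _ e rewrite e = ∈-tail p
  ... | freeze _ _ _ _ _ e rewrite e = ∈-tail p

  St-mono : ∀ {s t a} → s ≤ t → a ∈ St s → a ∈ St t
  St-mono {s} {t} le p = subst (λ t → _ ∈ St t) (m∸n+n≡m le) (go (t ∸ s) p)
    where
    go : ∀ d {a} → a ∈ St s → a ∈ St (d + s)
    go zero p = p
    go (suc d) p = St-step (d + s) (go d p)

  attack-holds : ∀ {H s i r} → Active H s i r → Attack H s i r (attack H s i r)
  attack-holds {H} {s} {i} {r} (_ , y , lt , h) = holds (attack-spec H s i r)
    (≤-<-trans (≮⇒≥ (λ lt' → least (attack-spec H s i r) y lt' h)) lt)

  cp-new : ∀ {s i k m γ} → cp i k m γ ∈ St (suc s) → cp i k m γ ∈ St s ⊎ CpFact s i k m γ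
  cp-new {s} p with step s
  ... | idle e _ _ rewrite e = inj₁ p
  ... | freeze _ _ _ _ _ e rewrite e with ∈-cons⁻ p
  ... | inj₁ q = ⊥-elim (cp≢fz q)
  ... | inj₂ q = inj₁ q
  cp-new {s} p | copy {i} {k} z _ _ rd refl e rewrite e with ∈-cons⁻ p
  ... | inj₂ q = inj₁ q
  ... | inj₁ q with cp-injective q
  ... | refl , refl , refl , refl = inj₂ (record { kind = z ; ready = rd ; γ≡ = refl ; m≡ = refl })

  freeze-fact : ∀ {s i r y} → fst (fst s) ≢ 0 → Active (St s) s i r → y ≡ attack (St s) s i r →
                FzFact s i (root (St s) i (fst (snd y))) r (label (St s) s i r) (snd (snd y))
  freeze-fact {s} {i} {r} nz ac refl = record
    { kind = nz ; agree = proj₁ ac ; attackable = proj₂ (proj₂ h) ; y = attack (St s) s i r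
    ; fst-val = proj₁ h ; snd-val = proj₁ (proj₂ h) ; k≡ = refl ; l≡ = refl ; v≡ = refl }
    where
    h : Attack (St s) s i r (attack (St s) s i r)
    h = attack-holds ac

  fz-new : ∀ {s i k r l v} → fz i k r l v ∈ St (suc s) → fz i k r l v ∈ St s ⊎ FzFact s i k r l v
  fz-new {s} p with step s
  ... | idle e _ _ rewrite e = inj₁ p
  ... | copy _ _ _ _ _ e rewrite e with ∈-cons⁻ p
  ... | inj₁ q = ⊥-elim (cp≢fz (sym q))
  ... | inj₂ q = inj₁ q
  fz-new {s} p | freeze {i} {r} {y} nz _ _ ac y≡ e rewrite e with ∈-cons⁻ p
  ... | inj₂ q = inj₁ q
  ... | inj₁ q with fz-injective q
  ... | refl , refl , refl , refl , refl = inj₂ (freeze-fact nz ac y≡)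

  cp-origin : ∀ {i k m γ} s → cp i k m γ ∈ St s → ∃ λ t → t < s × CpFact t i k m γ × cp i k m γ ∈ St (suc t)
  cp-origin zero p = ⊥-elim (∉0 (subst (_ ∈_) St-0 p))
  cp-origin (suc s) p with cp-new p
  ... | inj₂ f = s , ≤-refl , f , p
  ... | inj₁ q = let t , lt , f = cp-origin s q in t , <-trans lt (n<1+n s) , f

  fz-since : ∀ {i k r l v} s₀ s → fz i k r l v ∈ St s →
             fz i k r l v ∈ St s₀ ⊎ (∃ λ t → s₀ ≤ t × FzFact t i k r l v × fz i k r l v ∈ St (suc t))
  fz-since s₀ zero p = ⊥-elim (∉0 (subst (_ ∈_) St-0 p))
  fz-since s₀ (suc s) p with ≤-total (suc s) s₀
  ... | inj₁ le = inj₁ (St-mono le p)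
  ... | inj₂ le with m≤n⇒m<n∨m≡n le
  ... | inj₂ refl = inj₁ p
  ... | inj₁ (s≤s le') with fz-new p
  ... | inj₁ q = fz-since s₀ s q
  ... | inj₂ f = inj₂ (s , le' , f , p)

  fz-origin : ∀ {i k r l v} s → fz i k r l v ∈ St s → ∃ λ t → FzFact t i k r l v
  fz-origin s p with fz-since 0 s p
  ... | inj₁ q = ⊥-elim (∉0 (subst (_ ∈_) St-0 q))
  ... | inj₂ (t , _ , f , _) = t , f

  cp-shape : ∀ {s i k m γ} → cp i k m γ ∈ St s → k ≡ elt (col k) 1 (idx k)
  cp-shape {s} p = proj₁ (CpFact.ready (proj₁ (proj₂ (proj₂ (cp-origin s p)))))

  cp-tag : ∀ {s i k m γ} → cp i k m γ ∈ St s → tag k ≡ 1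
  cp-tag {s} p = trans (cong tag (cp-shape {s} p)) tag-elt

  cp-< : ∀ {s i k m γ} → cp i k m γ ∈ St s → m < k
  cp-< {s} {i} {k} {m} {γ} p with cp-origin s p
  ... | t , _ , f , _ with m≤n⇒m<n∨m≡n (bounded (target-spec (St t) i k γ))
  ... | inj₁ lt = subst (_< k) (sym (CpFact.m≡ f)) lt
  ... | inj₂ e with k in k≡
  ... | zero = ⊥-elim (0≢1+n (trans (sym tag0) (trans (cong tag (sym k≡)) (cp-tag {s} (subst (λ k → cp i k m γ ∈ St s) (sym k≡) p)))))
    where
    tag0 : tag 0 ≡ 0
    tag0 = n≤0⇒n≡0 (≤-trans (fst≤ _) (snd≤ 0))
  ... | suc j = ⊥-elim (least (target-spec (St t) i (suc j) γ) j (subst (j <_) (sym e) ≤-refl) (inj₂ refl))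

  cp-unique : ∀ s {i k m γ m' γ'} → cp i k m γ ∈ St s → cp i k m' γ' ∈ St s → m ≡ m' × γ ≡ γ'
  cp-unique zero p q = ⊥-elim (∉0 (subst (_ ∈_) St-0 p))
  cp-unique (suc s) p q with cp-new p | cp-new q
  ... | inj₁ a | inj₁ b = cp-unique s a b
  ... | inj₁ a | inj₂ f = ⊥-elim (proj₁ (proj₂ (CpFact.ready f)) (cp-copied a))
  ... | inj₂ f | inj₁ b = ⊥-elim (proj₁ (proj₂ (CpFact.ready f)) (cp-copied b))
  ... | inj₂ f | inj₂ g with trans (CpFact.γ≡ f) (sym (CpFact.γ≡ g))
  ... | refl = trans (CpFact.m≡ f) (sym (CpFact.m≡ g)) , refl

  next≤ : ∀ H i k → next H i k ≤ k
  next≤ H i k = bounded (next-spec H i k)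

  next-copied : ∀ {s i k m γ} → cp i k m γ ∈ St s → next (St s) i k ≡ m
  next-copied {s} {i} {k} {m} p with m≤n⇒m<n∨m≡n (next≤ (St s) i k)
  ... | inj₁ lt = let γ , _ , q = holds (next-spec (St s) i k) lt in proj₁ (cp-unique s q p)
  ... | inj₂ e = ⊥-elim (least (next-spec (St s) i k) m (subst (m <_) (sym e) (cp-< {s} p)) (cp-copies p))

  next-uncopied : ∀ {s i k} → ¬ Copied (St s) i k → next (St s) i k ≡ k
  next-uncopied {s} {i} {k} nc with m≤n⇒m<n∨m≡n (next≤ (St s) i k)
  ... | inj₁ lt = ⊥-elim (nc (cp-copied (proj₂ (proj₂ (holds (next-spec (St s) i k) lt)))))
  ... | inj₂ e = e

  opaque
    unfolding root

    root≤ : ∀ H i k → root H i k ≤ k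
    root≤ H i k = iterate-≤ (next H i) (next≤ H i) k k

    root-uncopied : ∀ {s i k} → ¬ Copied (St s) i (root (St s) i k)
    root-uncopied {s} {i} {k} (m , _ , γ , _ , p) = <-irrefl (trans (sym (next-copied {s} p)) (iterate-fixed (next (St s) i) (next≤ (St s) i) k)) (cp-< {s} p)

    root-self : ∀ {s i k} → ¬ Copied (St s) i k → root (St s) i k ≡ k
    root-self {s} {i} {k} nc = iterate-at-fixed (next (St s) i) (next≤ (St s) i) k (next-uncopied nc)

    root-copy : ∀ {s i k m γ} → cp i k m γ ∈ St s → root (St s) i k ≡ root (St s) i m
    root-copy {s} {i} {k} p = trans (iterate-step (next (St s) i) (next≤ (St s) i) k) (cong (root (St s) i) (next-copied {s} p))

  -- Only roots are frozen, and a copied element is never a root again; conversely a frozen element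
  -- is not ready to be copied; and one stage cannot do both.
  cp-fz : ∀ s {i k m γ r l v} → cp i k m γ ∈ St s → fz i k r l v ∈ St s → ⊥
  cp-fz zero p q = ∉0 (subst (_ ∈_) St-0 p)
  cp-fz (suc s) p q with cp-new p | fz-new q
  ... | inj₁ a | inj₁ b = cp-fz s a b
  ... | inj₁ a | inj₂ f = root-uncopied {s} {k = fst (snd (FzFact.y f))} (subst (Copied (St s) _) (FzFact.k≡ f) (cp-copied a))
  ... | inj₂ f | inj₁ b = proj₁ (proj₂ (proj₂ (CpFact.ready f))) (fz-frozen b)
  ... | inj₂ f | inj₂ g = FzFact.kind g (CpFact.kind f)

  fz-uncopied : ∀ {s i k r l v} t → fz i k r l v ∈ St s → ¬ Copied (St t) i k
  fz-uncopied {s} t p (m , _ , γ , _ , q) = cp-fz (s ⊔ t) (St-mono (m≤n⊔m s t) q) (St-mono (m≤m⊔n s t) p)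

  fz-column : ∀ {s i k r l v} → fz i k r l v ∈ St s → r < col k
  fz-column {s} p = proj₁ (FzFact.attackable (proj₂ (fz-origin s p)))

  fz-unique : ∀ s {i k r l v l' v'} → fz i k r l v ∈ St s → fz i k r l' v' ∈ St s → l ≡ l' × v ≡ v'
  fz-unique zero p q = ⊥-elim (∉0 (subst (_ ∈_) St-0 p))
  fz-unique (suc s) {r = r} p q with fz-new p | fz-new q
  ... | inj₁ a | inj₁ b = fz-unique s a b
  ... | inj₁ a | inj₂ f = ⊥-elim (proj₂ (proj₂ (FzFact.attackable f)) (fz-frozenBelow a (n<1+n r)))
  ... | inj₂ f | inj₁ b = ⊥-elim (proj₂ (proj₂ (FzFact.attackable f)) (fz-frozenBelow b (n<1+n r)))
  ... | inj₂ f | inj₂ g = trans (FzFact.l≡ f) (sym (FzFact.l≡ g)) , trans (FzFact.v≡ f) (sym (FzFact.v≡ g))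

-- Classical limits and finite tables

module Classical (em : ExcludedMiddle 0ℓ) where

  ¬∀⇒∃¬ : {A : Set} {P : A → Set} → ¬ (∀ a → P a) → ∃ λ a → ¬ P a
  ¬∀⇒∃¬ {A} {P} h with em {∃ λ a → ¬ P a}
  ... | yes p = p
  ... | no n = ⊥-elim (h λ a → byCases a)
    where
    byCases : ∀ a → P a
    byCases a with em {P a}
    ... | yes p = p
    ... | no np = ⊥-elim (n (a , np))

  Eventually : (ℕ → Set) → Set
  Eventually P = ∃ λ t → ∀ s → t ≤ s → P s

  collect : ∀ {P : ℕ → ℕ → Set} n → (∀ a → a < n → Eventually (P a)) → Eventually (λ s → ∀ a → a < n → P a s)
  collect zero h = 0 , λ s _ a ()
  collect {P} (suc n) h with collect n (λ a lt → h a (≤-trans lt (n≤1+n n))) | h n ≤-refl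
  ... | t , p | t' , p' = t ⊔ t' , q
    where
    q : ∀ s → t ⊔ t' ≤ s → ∀ a → a < suc n → P a s
    q s le a (s≤s a≤n) with m≤n⇒m<n∨m≡n a≤n
    ... | inj₁ lt = p s (≤-trans (m≤m⊔n t t') le) a lt
    ... | inj₂ refl = p' s (≤-trans (m≤n⊔m t t') le)

  eventually-constant : ∀ (f : ℕ → ℕ) → (∀ {s t} → s ≤ t → f t ≤ f s) → ∃ λ y → Eventually λ s → f s ≡ y
  eventually-constant f anti = go (f 0) 0 ≤-refl
    where
    go : ∀ b t → f t ≤ b → ∃ λ y → Eventually λ s → f s ≡ y
    go b t le with em {∃ λ s → t ≤ s × f s < f t}
    ... | no n = f t , t , λ s ts → ≤-antisym (anti ts) (≮⇒≥ λ lt → n (s , ts , lt))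
    go zero t le | yes (s , ts , lt) = ⊥-elim (<⇒≱ lt (≤-trans le z≤n))
    go (suc b) t le | yes (s , ts , lt) = go b s (≤-pred (≤-trans lt le))

  -- Excluded middle fills in a finite table. Reductions may thus treat finitely many arguments
  -- separately without any uniform way to find the answers.
  finiteᵈ : ∀ (P : ℕ → Set) N → Dc {1} (λ ρ → x0 ρ < N × P (x0 ρ))
  finiteᵈ P zero = Dc-ext (λ ρ ()) (λ { ρ (() , _) }) falseᵈ
  finiteᵈ P (suc N) with em {P N}
  ... | yes p = Dc-ext to from (finiteᵈ P N ⊎ᵈ (v0 ≡ᵈ kn N))
    where
    to : ∀ ρ → (x0 ρ < N × P (x0 ρ)) ⊎ x0 ρ ≡ N → x0 ρ < suc N × P (x0 ρ)
    to ρ (inj₁ (lt , q)) = ≤-trans lt (n≤1+n N) , q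
    to ρ (inj₂ e) = ≤-reflexive (cong suc e) , subst P (sym e) p
    from : ∀ ρ → x0 ρ < suc N × P (x0 ρ) → (x0 ρ < N × P (x0 ρ)) ⊎ x0 ρ ≡ N
    from ρ (s≤s le , q) with m≤n⇒m<n∨m≡n le
    ... | inj₁ lt = inj₁ (lt , q)
    ... | inj₂ e = inj₂ e
  ... | no np = Dc-ext (λ { ρ (lt , q) → ≤-trans lt (n≤1+n N) , q }) from (finiteᵈ P N)
    where
    from : ∀ ρ → x0 ρ < suc N × P (x0 ρ) → x0 ρ < N × P (x0 ρ)
    from ρ (s≤s le , q) with m≤n⇒m<n∨m≡n le
    ... | inj₁ lt = lt , q
    ... | inj₂ e = ⊥-elim (np (subst P e q))

record Index (f : ℕ → ℕ) : Set where
  field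
    number : ℕ
    only   : ∀ n v s → Comp number n v s → v ≡ f n
    halts  : ∀ n → ∃ λ s → Comp number n (f n) s

index : ∀ {f : ℕ → ℕ} → Fn {1} (λ ρ → f (x0 ρ)) → Index f
index F = record
  { number = ⌜ code F ⌝
  ; only = λ n v s h → deterministic (Comp-sound h) (eval F (n ∷ []))
  ; halts = λ n → Comp-complete (eval F (n ∷ [])) }

-- Membership in the limit, and finite injury

module Verification (em : ExcludedMiddle 0ℓ) (ē ᾱ : ℕ) where
  open Classical em
  open Stages ē ᾱ
  open Invariants ē ᾱ

  M : (s i k : ℕ) → Set
  M s i k = Mem (St s) s i k

  InSet : ℕ → ℕ → Set
  InSet i k = ∃ λ s → M s i k

  Tower : ℕ → ℕ → Set
  Tower i w = (fst w ≡ 0 × ∃ λ s → Halt ē (snd w) s) ⊎ (∃ λ j → j < i × fst w ≡ suc j × InSet j (snd w))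

  A : ℕ → ℕ → Set
  A i k = ∃ λ s → Halt ᾱ ⟨ i , k ⟩ s

  opaque
    unfolding root

    -- Chains are only extended at their ends: an old root may become a copy, and the new chain
    -- continues from there.
    root-later : ∀ {s t} → s ≤ t → ∀ i k → root (St t) i (root (St s) i k) ≡ root (St t) i k
    root-later {s} {t} le i k = go k
      where
      go : ∀ n → root (St t) i (nrec k (λ _ → next (St s) i) n) ≡ root (St t) i k
      go zero = refl
      go (suc n) with em {Copied (St s) i (nrec k (λ _ → next (St s) i) n)}
      ... | no nc = trans (cong (root (St t) i) (next-uncopied nc)) (go n)
      ... | yes (m , _ , γ , _ , p) = trans (cong (root (St t) i) (next-copied p)) (trans (sym (root-copy (St-mono le p))) (go n))

  -- Requirements attack only roots that are still outside, and neither frozen elements nor those of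
  -- tag 0 are ever copied. So nothing leaves the set once it is in, which makes `InSet i` c.e.
  rootIn-step : ∀ {s i k} → ¬ Copied (St s) i k → RootIn (St s) s i k → ¬ Copied (St (suc s)) i k × RootIn (St (suc s)) (suc s) i k
  rootIn-step {s} {i} {k} nc (inj₁ (r , _ , l , _ , v , _ , (p , nf) , h)) = nc' , inj₁ (r , fz-r< q , l , fz-l< q , v , fz-v< q , (q , nf') , Halt-mono (n≤1+n s) h)
    where
    q : fz i k r l v ∈ St (suc s)
    q = St-step s p
    nc' : ¬ Copied (St (suc s)) i k
    nc' = fz-uncopied (suc s) q
    nf' : ¬ FrozenBelow (St (suc s)) i k r
    nf' (r' , lt , l' , _ , v' , _ , p') with fz-new p'
    ... | inj₁ o = nf (fz-frozenBelow o lt)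
    ... | inj₂ f = proj₁ (proj₂ (FzFact.attackable f)) (inj₁ (r , fz-r< p , l , fz-l< p , v , fz-v< p , (p , nf) , h))
  rootIn-step {s} {i} {k} nc (inj₂ (nf , t0 , h)) = nc' , inj₂ (nf' , t0 , Halt-mono (n≤1+n s) h)
    where
    nc' : ¬ Copied (St (suc s)) i k
    nc' (m , _ , γ , _ , p) with trans (sym t0) (cp-tag p)
    ... | ()
    nf' : ¬ Frozen (St (suc s)) i k
    nf' (r' , lt , l' , _ , v' , _ , p') with fz-new p'
    ... | inj₁ o = nf (fz-frozen o)
    ... | inj₂ f = proj₁ (proj₂ (FzFact.attackable f)) (inj₂ (nf , t0 , h))

  rootIn-mono : ∀ {s t i k} → s ≤ t → ¬ Copied (St s) i k → RootIn (St s) s i k → ¬ Copied (St t) i k × RootIn (St t) t i k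
  rootIn-mono {s} {t} {i} {k} le nc h = subst (λ t → ¬ Copied (St t) i k × RootIn (St t) t i k) (m∸n+n≡m le) (go (t ∸ s))
    where
    go : ∀ d → ¬ Copied (St (d + s)) i k × RootIn (St (d + s)) (d + s) i k
    go zero = nc , h
    go (suc d) = let nc' , h' = go d in rootIn-step nc' h'

  M-mono : ∀ {s t i k} → s ≤ t → M s i k → M t i k
  M-mono {s} {t} {i} {k} le h with rootIn-mono le (root-uncopied {s} {i} {k}) h
  ... | nc , h' = subst (RootIn (St t) t i) (trans (sym (root-self nc)) (root-later le i k)) h'

  inSet-same-root : ∀ {t i k k'} → root (St t) i k ≡ root (St t) i k' → InSet i k → InSet i k'
  inSet-same-root {t} {i} {k} {k'} e (s , h) = u , subst (RootIn (St u) u i) e' (M-mono (m≤m⊔n s t) h)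
    where
    u = s ⊔ t
    e' : root (St u) i k ≡ root (St u) i k'
    e' = trans (sym (root-later (m≤n⊔m s t) i k)) (trans (cong (root (St u) i) e) (root-later (m≤n⊔m s t) i k'))

  root-root : ∀ s i k → root (St s) i (root (St s) i k) ≡ root (St s) i k
  root-root s i k = root-self (root-uncopied {s} {i} {k})

  inSet-root : ∀ s {i k} → InSet i k ⟺ InSet i (root (St s) i k)
  inSet-root s {i} {k} = inSet-same-root (sym (root-root s i k)) , inSet-same-root (root-root s i k)

  towerVal-mono : ∀ {s t i v} → s ≤ t → TowerVal (St s) s i v → TowerVal (St t) t i v
  towerVal-mono le (inj₁ e) = inj₁ e
  towerVal-mono le (inj₂ (lt , inj₁ (z , h))) = inj₂ (lt , inj₁ (z , Halt-mono le h))
  towerVal-mono le (inj₂ (lt , inj₂ (j , ji , e , h))) = inj₂ (lt , inj₂ (j , ji , e , M-mono le h))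

  towerVal-interp : ∀ {i v} → (∃ λ s → TowerVal (St s) s i v) ⟺ interp (Tower i) v
  towerVal-interp {i} {v} = to , from v
    where
    to : ∀ {v} → (∃ λ s → TowerVal (St s) s i v) → interp (Tower i) v
    to (s , inj₁ refl) = tt
    to {suc (suc w)} (s , inj₂ (_ , inj₁ (z , h))) = inj₁ (z , s , h)
    to {suc (suc w)} (s , inj₂ (_ , inj₂ (j , ji , e , h))) = inj₂ (j , ji , e , s , h)
    to {zero} (s , inj₂ (() , _))
    to {suc zero} _ = tt
    from : ∀ v → interp (Tower i) v → ∃ λ s → TowerVal (St s) s i v
    from (suc zero) _ = 0 , inj₁ refl
    from (suc (suc w)) (inj₁ (z , s , h)) = s , inj₂ (s≤s (s≤s z≤n) , inj₁ (z , h))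
    from (suc (suc w)) (inj₂ (j , ji , e , s , h)) = s , inj₂ (s≤s (s≤s z≤n) , inj₂ (j , ji , e , h))

  -- Each requirement acts finitely often: otherwise its labels l exhaust ℕ, and l ↦ v reduces K to the tower.

  Quiet : (i r s₀ : ℕ) → Set
  Quiet i r s₀ = ∀ {k l v} s → fz i k r l v ∈ St s → fz i k r l v ∈ St s₀

  QuietBelow : (i b s₀ : ℕ) → Set
  QuietBelow i b s₀ = ∀ r → r < b → Quiet i r s₀

  inForce-later : ∀ {i r s₀ s t k l v} → QuietBelow i r s₀ → s₀ ≤ s → s ≤ t → InForce (St s) i k r l v → InForce (St t) i k r l v
  inForce-later {t = t} qb le le' (p , nf) = St-mono le' p , λ (r' , lt , _ , _ , _ , _ , p') → nf (fz-frozenBelow (St-mono le (qb r' lt t p')) lt)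

  module _ {i : ℕ} (incomplete : ¬ (K ≤ₘ Tower i)) where

    private
      module Restless {r s₁} (qb : QuietBelow i r s₁)
        (restless : ∀ s₀ → ∃ λ t → s₀ ≤ t × ∃ λ k → ∃ λ l → ∃ λ v → FzFact t i k r l v × fz i k r l v ∈ St (suc t)) where

        HeldAt : ℕ → ℕ → Set
        HeldAt s l = ∃ λ k → ∃ λ v → InForce (St s) i k r l v

        held-later : ∀ {s t l} → s₁ ≤ s → s ≤ t → HeldAt s l → HeldAt t l
        held-later le le' (k , v , h) = k , v , inForce-later qb le le' h

        all-held : ∀ l → ∃ λ s → s₁ ≤ s × (∀ j → j < l → HeldAt s j)
        all-held zero = s₁ , ≤-refl , λ j ()
        all-held (suc l) with all-held l
        -- The search for a free label stops at the stage number, so the stage must exceed l. An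
        -- action at such a stage fills the first gap, namely l.
        ... | s , le , h with restless (s ⊔ suc l)
        ... | t , le' , k , l' , v , f , p with em {HeldAt t l}
        ... | yes hl = t , ≤-trans le s≤t , new
          where
          s≤t : s ≤ t
          s≤t = ≤-trans (m≤m⊔n s (suc l)) le'
          new : ∀ j → j < suc l → HeldAt t j
          new j (s≤s j≤l) with m≤n⇒m<n∨m≡n j≤l
          ... | inj₁ lt = held-later le s≤t (h j lt)
          ... | inj₂ refl = hl
        ... | no nl = suc t , ≤-trans le (≤-trans s≤t (n≤1+n t)) , new
          where
          s≤t : s ≤ t
          s≤t = ≤-trans (m≤m⊔n s (suc l)) le'
          L = label-spec (St t) t i r
          label≤ : label (St t) t i r ≤ l
          label≤ = ≮⇒≥ λ lt → least L l lt λ (k , _ , v , _ , q) → nl (k , v , q)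
          label≡ : label (St t) t i r ≡ l
          label≡ with m≤n⇒m<n∨m≡n label≤
          ... | inj₂ e = e
          ... | inj₁ lt = ⊥-elim (holds L (≤-<-trans label≤ (≤-trans (m≤n⊔m s (suc l)) le'))
                  (let k , v , q = held-later le s≤t (h _ lt) in k , fz-k< (proj₁ q) , v , fz-v< (proj₁ q) , q))
          force : InForce (St (suc t)) i k r l v
          force = subst (λ l → fz i k r l v ∈ St (suc t)) (trans (FzFact.l≡ f) label≡) p ,
            λ (r' , lt , _ , _ , _ , _ , p') → proj₂ (proj₂ (FzFact.attackable f))
              (fz-frozenBelow (St-mono (≤-trans le s≤t) (qb r' lt (suc t) p')) (<-trans lt (n<1+n r)))
          new : ∀ j → j < suc l → HeldAt (suc t) j
          new j (s≤s j≤l) with m≤n⇒m<n∨m≡n j≤l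
          ... | inj₁ lt = held-later le (≤-trans s≤t (n≤1+n t)) (h j lt)
          ... | inj₂ refl = k , v , force

        -- Whatever enters `K` or the tower is seen by some later action of r, and that action has
        -- tested l against v once more.
        agreement : ∀ {s k l v} → s₁ ≤ s → InForce (St s) i k r l v → K l ⟺ interp (Tower i) v
        agreement {s} {k} {l} {v} le q = to , from
          where
          to : K l → interp (Tower i) v
          to kl with proj₁ K-halt kl
          ... | u , h with restless (s ⊔ u)
          ... | t , le' , _ , _ , _ , f , _ = proj₁ towerVal-interp (t ,
                proj₁ (FzFact.agree f k (fz-k< (proj₁ q')) l (fz-l< (proj₁ q')) v (fz-v< (proj₁ q')) q') (Halt-mono (≤-trans (m≤n⊔m s u) le') h))
            where
            q' = inForce-later qb le (≤-trans (m≤m⊔n s u) le') q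
          from : interp (Tower i) v → K l
          from tv with proj₂ towerVal-interp tv
          ... | u , h with restless (s ⊔ u)
          ... | t , le' , _ , _ , _ , f , _ = proj₂ K-halt (t ,
                proj₂ (FzFact.agree f k (fz-k< (proj₁ q')) l (fz-l< (proj₁ q')) v (fz-v< (proj₁ q')) q') (towerVal-mono (≤-trans (m≤n⊔m s u) le') h))
            where
            q' = inForce-later qb le (≤-trans (m≤m⊔n s u) le') q

        certificate : Dc {2} (λ ρ → s₁ ≤ fst (x0 ρ) × InForce (St (fst (x0 ρ))) i (fst (snd (x0 ρ))) r (x1 ρ) (snd (snd (x0 ρ))))
        certificate = (kn s₁ ≤ᵈ fstᶠ v0) ×ᵈ InForceᵈ (Stᶠ (fstᶠ v0)) (kn i) (fstᶠ (sndᶠ v0)) (kn r) v1 (sndᶠ (sndᶠ v0))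

        total : ∀ l → ∃ λ y → s₁ ≤ fst y × InForce (St (fst y)) i (fst (snd y)) r l (snd (snd y))
        total l with all-held (suc l)
        ... | s , le , h with h l ≤-refl
        ... | k , v , q = ⟨ s , ⟨ k , v ⟩ ⟩ , subst (s₁ ≤_) (sym fst-⟨⟩) le , q'
          where
          q' : InForce (St (fst ⟨ s , ⟨ k , v ⟩ ⟩)) i (fst (snd ⟨ s , ⟨ k , v ⟩ ⟩)) r l (snd (snd ⟨ s , ⟨ k , v ⟩ ⟩))
          q' rewrite fst-⟨⟩ {s} {⟨ k , v ⟩} | snd-⟨⟩ {s} {⟨ k , v ⟩} | fst-⟨⟩ {k} {v} | snd-⟨⟩ {k} {v} = q

        complete-tower : K ≤ₘ Tower i
        complete-tower = search-reduction certificate (sndᶠ (sndᶠ v0)) total (λ l y (le , q) → agreement le q)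

    quiet : ∀ {r s₁} → QuietBelow i r s₁ → ∃ λ s₀ → Quiet i r s₀
    quiet {r} {s₁} qb with em {∃ λ s₀ → ∀ t → s₀ ≤ t → ¬ (∃ λ k → ∃ λ l → ∃ λ v → FzFact t i k r l v × fz i k r l v ∈ St (suc t))}
    ... | yes (s₀ , h) = s₀ , calm
      where
      calm : Quiet i r s₀
      calm s p with fz-since s₀ s p
      ... | inj₁ q = q
      ... | inj₂ (t , le , f , q) = ⊥-elim (h t le (_ , _ , _ , f , q))
    ... | no n = ⊥-elim (incomplete (Restless.complete-tower qb restless))
      where
      restless : ∀ s₀ → ∃ λ t → s₀ ≤ t × ∃ λ k → ∃ λ l → ∃ λ v → FzFact t i k r l v × fz i k r l v ∈ St (suc t)
      restless s₀ with em {∃ λ t → s₀ ≤ t × ∃ λ k → ∃ λ l → ∃ λ v → FzFact t i k r l v × fz i k r l v ∈ St (suc t)}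
      ... | yes p = p
      ... | no np = ⊥-elim (n (s₀ , λ t le p → np (t , le , p)))

    opaque
      quietBelow : ∀ b → ∃ λ s₀ → QuietBelow i b s₀
      quietBelow zero = 0 , λ r ()
      quietBelow (suc b) with quietBelow b
      ... | s₁ , qb with quiet qb
      ... | s₂ , q = s₁ ⊔ s₂ , both
        where
        both : QuietBelow i (suc b) (s₁ ⊔ s₂)
        both r (s≤s le) s p with m≤n⇒m<n∨m≡n le
        ... | inj₁ lt = St-mono (m≤m⊔n s₁ s₂) (qb r lt s p)
        ... | inj₂ refl = St-mono (m≤n⊔m s₁ s₂) (q s p)

data Join (X Y : ℕ → Set) (w : ℕ) : Set where
  inj₁ : fst w ≡ 0 × X (snd w) → Join X Y w
  inj₂ : fst w ≡ 1 × Y (snd w) → Join X Y w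

JoinPrime : (ℕ → Set) → Set₁
JoinPrime Z = ∀ X Y → Z ≤ₘ Join X Y → Z ≤ₘ X ⊎ Z ≤ₘ Y

-- Final values of elements, and requirements that face genuine reductions

module Outcome (em : ExcludedMiddle 0ℓ) (ē ᾱ : ℕ) {i : ℕ} where
  open Classical em
  open Stages ē ᾱ
  open Invariants ē ᾱ
  open Verification em ē ᾱ

  inForce-value : ∀ {r s₀ s k l v} → QuietBelow i r s₀ → s₀ ≤ s → InForce (St s) i k r l v → InSet i k ⟺ K l
  inForce-value {r} {s₀} {s} {k} {l} {v} qb le q@(p , _) = to , from
    where
    own : ∀ t → root (St t) i k ≡ k
    own t = root-self (fz-uncopied t p)
    to : InSet i k → K l
    to (u , h) = known (subst (RootIn (St t) t i) (own t) (M-mono (m≤n⊔m s u) h))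
      where
      t = s ⊔ u
      qt : InForce (St t) i k r l v
      qt = inForce-later qb le (m≤m⊔n s u) q
      known : RootIn (St t) t i k → K l
      known (inj₂ (nf , _)) = ⊥-elim (nf (fz-frozen (proj₁ qt)))
      known (inj₁ (r' , _ , l' , _ , v' , _ , (p' , nf) , h')) with <-cmp r r'
      ... | tri< lt _ _ = ⊥-elim (nf (fz-frozenBelow (proj₁ qt) lt))
      ... | tri> _ _ gt = ⊥-elim (proj₂ qt (fz-frozenBelow p' gt))
      ... | tri≈ _ refl _ with fz-unique t p' (proj₁ qt)
      ... | refl , refl = proj₂ K-halt (t , h')
    from : K l → InSet i k
    from kl with proj₁ K-halt kl
    ... | u , h = t , subst (RootIn (St t) t i) (sym (own t)) (inj₁ (r , fz-r< pt , l , fz-l< pt , v , fz-v< pt , qt , Halt-mono (m≤n⊔m s u) h))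
      where
      t = s ⊔ u
      qt : InForce (St t) i k r l v
      qt = inForce-later qb le (m≤m⊔n s u) q
      pt = proj₁ qt

  limit-root : ∀ a → ∃ λ ρ → Eventually λ s → root (St s) i a ≡ ρ
  limit-root a = eventually-constant (λ s → root (St s) i a)
    (λ {s} {t} le → subst (_≤ root (St s) i a) (root-later le i a) (root≤ (St t) i (root (St s) i a)))

  never-copied-root : ∀ {ρ} → (∀ s → ¬ Copied (St s) i ρ) → InSet i ρ → ∃ λ s → RootIn (St s) s i ρ
  never-copied-root nc (s , h) = s , subst (RootIn (St s) s i) (root-self (nc s)) h

  tag≢1-uncopied : ∀ {k} → tag k ≢ 1 → ∀ s → ¬ Copied (St s) i k
  tag≢1-uncopied ne s (m , _ , γ , _ , p) = ne (cp-tag p)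

  unfrozen-value : ∀ {ρ} → tag ρ ≡ 0 → (∀ s → ¬ Frozen (St s) i ρ) → InSet i ρ ⟺ A i ρ
  unfrozen-value {ρ} t0 nf = to , from
    where
    nc : ∀ s → ¬ Copied (St s) i ρ
    nc = tag≢1-uncopied λ t1 → 0≢1+n (trans (sym t0) t1)
    to : InSet i ρ → A i ρ
    to h with never-copied-root nc h
    ... | s , inj₁ (_ , _ , _ , _ , _ , _ , (p , _) , _) = ⊥-elim (nf s (fz-frozen p))
    ... | s , inj₂ (_ , _ , h') = s , h'
    from : A i ρ → InSet i ρ
    from (s , h) = s , subst (RootIn (St s) s i) (sym (root-self (nc s))) (inj₂ (nf s , t0 , h))

  -- Only requirements r < c freeze elements of column c.
  frozen-small : ∀ {b s₀ k} s → QuietBelow i b s₀ → col k ≤ b → Frozen (St s) i k → k < St s₀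
  frozen-small s qb le (r , _ , _ , _ , _ , _ , p) = fz-k< (qb r (<-≤-trans (fz-column p) le) s p)

  -- Every task q recurs at arbitrarily late stages, since a stage attends to its first component.
  stage≥ : ∀ q N → ∃ λ s → fst s ≡ q × N ≤ s
  stage≥ q N = ⟨ q , N ⟩ , fst-⟨⟩ , ≤⟨⟩ʳ

  pool-acts : ∀ {c} → (∀ a → ∃ λ s → Halt c (elt c 1 a) s) → ∀ a → ∃ λ s → Copied (St s) i (elt c 1 a) ⊎ Frozen (St s) i (elt c 1 a)
  pool-acts {c} tot a with em {∃ λ s → Copied (St s) i (elt c 1 a) ⊎ Frozen (St s) i (elt c 1 a)}
  ... | yes p = p
  ... | no n with collect (suc a) (λ a' _ → proj₁ (tot a') , λ s le → Halt-mono le (proj₂ (tot a')))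
  ... | t , h with stage≥ ⟨ 0 , ⟨ i , elt c 1 a ⟩ ⟩ t
  ... | s , q , le with step s
  ... | freeze nz _ _ _ _ _ = ⊥-elim (nz (trans (cong fst q) fst-⟨⟩))
  ... | copy {i'} {k} {γ} _ i≡ k≡ _ _ e = ⊥-elim (n (suc s , inj₁ (cp-copied (subst₂ (λ j x → cp j x (target (St s) i' k γ) γ ∈ St (suc s))
          (trans i≡ (trans (cong fst (trans (cong snd q) snd-⟨⟩)) fst-⟨⟩)) (trans k≡ (trans (cong snd (trans (cong snd q) snd-⟨⟩)) snd-⟨⟩))
          (subst (cp i' k (target (St s) i' k γ) γ ∈_) (sym e) ∈-head)))))
  ... | idle _ nr _ = ⊥-elim (nr (trans (cong fst q) fst-⟨⟩) (subst₂ (PoolReady (St s) s)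
          (sym (trans (cong fst (trans (cong snd q) snd-⟨⟩)) fst-⟨⟩)) (sym (trans (cong snd (trans (cong snd q) snd-⟨⟩)) snd-⟨⟩)) ready))
    where
    ready : PoolReady (St s) s i (elt c 1 a)
    ready = sym (cong₂ (λ c a → elt c 1 a) col-elt idx-elt) , (λ p → n (s , inj₁ p)) , (λ p → n (s , inj₂ p)) ,
      λ a' lt → subst (λ c → Halt c (elt c 1 a') s) (sym col-elt) (h s le a' (subst (λ x → a' < suc x) idx-elt lt))

  module Settling (incomplete : ¬ (K ≤ₘ Tower i)) {f g : ℕ → ℕ} (F : Index f) (G : Index g)
                  (same : ∀ n → interp (InSet i) (f n) ⟺ interp (Tower i) (g n)) where

    r : ℕ
    r = ⟨ Index.number F , Index.number G ⟩

    s₀ : ℕ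
    s₀ = proj₁ (quietBelow incomplete (suc r))

    qb : QuietBelow i (suc r) s₀
    qb = proj₂ (quietBelow incomplete (suc r))

    private
      Agreement : ℕ → ℕ → ℕ → Set
      Agreement l v s = (Kˢ l s → TowerVal (St s) s i v) × (TowerVal (St s) s i v → Kˢ l s)

      qb' : QuietBelow i r s₀
      qb' r' lt = qb r' (<-trans lt (n<1+n r))

      correct : ∀ {k l v} → InForce (St s₀) i k r l v → K l ⟺ interp (Tower i) v
      correct {k} {l} {v} q@(p , _) with fz-origin s₀ p
      ... | t , fact = to , from
        where
        n = fst (FzFact.y fact)
        a = fst (snd (FzFact.y fact))
        f≡ : suc (suc a) ≡ f n
        f≡ = Index.only F n _ t (subst (λ e → Comp e n _ t) fst-⟨⟩ (FzFact.fst-val fact))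
        g≡ : v ≡ g n
        g≡ = Index.only G n _ t (subst (λ e → Comp e n _ t) snd-⟨⟩ (FzFact.snd-val fact))
        value = inForce-value qb' ≤-refl q
        to : K l → interp (Tower i) v
        to kl = subst (interp (Tower i)) (sym g≡) (proj₁ (same n) (subst (interp (InSet i)) f≡
          (proj₂ (inSet-root t) (subst (InSet i) (FzFact.k≡ fact) (proj₂ value kl)))))
        from : interp (Tower i) v → K l
        from tv = proj₁ value (subst (InSet i) (sym (FzFact.k≡ fact)) (proj₁ (inSet-root t)
          (subst (interp (InSet i)) (sym f≡) (proj₂ (same n) (subst (interp (Tower i)) g≡ tv)))))

      eventual : ∀ k l v → Eventually λ s → InForce (St s₀) i k r l v → Agreement l v s
      eventual k l v with em {InForce (St s₀) i k r l v}
      ... | no n = 0 , λ s _ q → ⊥-elim (n q)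
      ... | yes q with em {K l}
      ... | no nk = 0 , λ s _ _ → (λ h → ⊥-elim (nk (proj₂ K-halt (s , h)))) ,
                                  (λ tv → ⊥-elim (nk (proj₂ (correct q) (proj₁ towerVal-interp (s , tv)))))
      ... | yes kl with proj₁ K-halt kl | proj₂ towerVal-interp (proj₁ (correct q) kl)
      ... | t , h | u , tv = t ⊔ u , λ s le _ → (λ _ → towerVal-mono (≤-trans (m≤n⊔m t u) le) tv) ,
                                               (λ _ → Halt-mono (≤-trans (m≤m⊔n t u) le) h)

      inForce-back : ∀ {s k l v} → s₀ ≤ s → InForce (St s) i k r l v → InForce (St s₀) i k r l v
      inForce-back {s} le (p , nf) = qb r (n<1+n r) s p , λ (r' , lt , _ , _ , _ , _ , p') → nf (fz-frozenBelow (St-mono le p') lt)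

      agree : Eventually λ s → s₀ ≤ s × Agree (St s) s i r
      agree with collect (St s₀) (λ k _ → collect (St s₀) (λ l _ → collect (St s₀) (λ v _ → eventual k l v)))
      ... | t , h = s₀ ⊔ t , λ s le → ≤-trans (m≤m⊔n s₀ t) le , λ k _ l _ v _ q →
            let q₀ = inForce-back (≤-trans (m≤m⊔n s₀ t) le) q ; p = proj₁ q₀ in
            h s (≤-trans (m≤n⊔m s₀ t) le) k (fz-k< p) l (fz-l< p) v (fz-v< p) q₀

    private
     -- At a late stage devoted to r an attackable root would make r active. The ensuing freeze
     -- would already be recorded at `s₀`, when r has finished, whereas a requirement never freezes
     -- an element twice.
     settle : ∀ {n a} → f n ≡ suc (suc a) → ∀ t → ∃ λ s → t ≤ s × ¬ Attackable (St s) s i r (root (St s) i a)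
     settle {n} {a} f≡ t = proj₁ stage , ≤-trans (m≤m⊔n t _) (proj₂ (proj₂ stage)) ,
      λ at → late (proj₁ (proj₂ stage)) (proj₂ (proj₂ stage)) (proj₂ (Index.halts F n)) (proj₂ (Index.halts G n)) (proj₂ agree) at (step _)
      where
      stage = stage≥ ⟨ 1 , ⟨ i , r ⟩ ⟩ (t ⊔ (proj₁ agree ⊔ (proj₁ (Index.halts F n) ⊔ (proj₁ (Index.halts G n) ⊔ suc ⟨ n , ⟨ a , g n ⟩ ⟩))))
      late : ∀ {s t' u w} → fst s ≡ ⟨ 1 , ⟨ i , r ⟩ ⟩ → t ⊔ (t' ⊔ (u ⊔ (w ⊔ suc ⟨ n , ⟨ a , g n ⟩ ⟩))) ≤ s →
             Comp (Index.number F) n (f n) u → Comp (Index.number G) n (g n) w →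
             (∀ s → t' ≤ s → s₀ ≤ s × Agree (St s) s i r) → Attackable (St s) s i r (root (St s) i a) → Step s → ⊥
      late {s} {t'} {u} {w} q le hf hg ag = conflict
       where
       le₁ = ≤-trans (m≤n⊔m t _) le
       le₂ = ≤-trans (m≤n⊔m t' _) le₁
       le₃ = ≤-trans (m≤n⊔m u _) le₂
       i≡ : fst (snd (fst s)) ≡ i
       i≡ = trans (cong fst (trans (cong snd q) snd-⟨⟩)) fst-⟨⟩
       r≡ : snd (snd (fst s)) ≡ r
       r≡ = trans (cong snd (trans (cong snd q) snd-⟨⟩)) snd-⟨⟩
       kind : fst (fst s) ≢ 0
       kind e with trans (sym e) (trans (cong fst q) fst-⟨⟩)
       ... | ()
       active : Attackable (St s) s i r (root (St s) i a) → Active (St s) s i r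
       active at = proj₂ (ag s (≤-trans (m≤m⊔n t' _) le₁)) , y , ≤-trans (m≤n⊔m w _) le₃ ,
         subst₂ (λ e n → Comp e n (suc (suc (fst (snd y)))) s) (sym fst-⟨⟩) (sym fst-⟨⟩)
           (subst (λ v → Comp (Index.number F) n v s) (trans f≡ (cong (λ x → suc (suc x)) (sym a≡))) (Comp-mono (≤-trans (m≤m⊔n u _) le₂) hf)) ,
         subst₂ (λ e n → Comp e n (snd (snd y)) s) (sym snd-⟨⟩) (sym fst-⟨⟩)
           (subst (λ v → Comp (Index.number G) n v s) (sym (trans (cong snd snd-⟨⟩) snd-⟨⟩)) (Comp-mono (≤-trans (m≤m⊔n w _) le₃) hg)) ,
         subst (λ a → Attackable (St s) s i r (root (St s) i a)) (sym a≡) at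
         where
         y = ⟨ n , ⟨ a , g n ⟩ ⟩
         a≡ : fst (snd y) ≡ a
         a≡ = trans (cong fst snd-⟨⟩) fst-⟨⟩
       conflict : Attackable (St s) s i r (root (St s) i a) → Step s → ⊥
       conflict at (idle _ _ na) = na kind (subst₂ (Active (St s) s) (sym i≡) (sym r≡) (active at))
       conflict at (copy z _ _ _ _ _) = kind z
       conflict at (freeze {i'} {r'} {y} nz i'≡ r'≡ ac y≡ e) with trans i'≡ i≡ | trans r'≡ r≡
       ... | refl | refl = proj₂ (proj₂ (FzFact.attackable (freeze-fact nz ac y≡)))
             (fz-frozenBelow (St-mono (proj₁ (ag s (≤-trans (m≤m⊔n t' _) le₁)))
               (qb r (n<1+n r) (suc s) (subst (λ H → fz i' (root (St s) i' (fst (snd y))) r (label (St s) s i' r) (snd (snd y)) ∈ H) (sym e) ∈-head))) (n<1+n r))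

    opaque
      settled : ∀ {n a} → f n ≡ suc (suc a) → ∀ t → ∃ λ s → t ≤ s × ¬ Attackable (St s) s i r (root (St s) i a)
      settled = settle

  module _ (incomplete : ¬ (K ≤ₘ Tower i)) where

    not-below-tower : ¬ (InSet i ≤ₘ Tower i)
    not-below-tower red = conflict (settled {k} refl 0)
      where
      R = unpack red
      open Settling incomplete {λ n → suc (suc n)} {fun R} (index (sucᶠ (sucᶠ v0))) (index (funᶠ R v0)) (λ n → forth R n , back R n)
      -- Column `suc r` is open to r, tag 2 rules out copying and entry through A, and index `St s₀`
      -- lies beyond all that is ever frozen in this column. So k remains attackable for good.
      k = elt (suc r) 2 (St s₀)
      tag-k : tag k ≡ 2
      tag-k = tag-elt
      nc : ∀ s → ¬ Copied (St s) i k
      nc = tag≢1-uncopied λ e → 0≢1+n (suc-injective (trans (sym e) tag-k))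
      small : ∀ {s} → Frozen (St s) i k → ⊥
      small {s} fr = <⇒≱ (frozen-small s qb (≤-reflexive col-elt) fr) ≤elt
      notIn : ∀ {s} → ¬ RootIn (St s) s i k
      notIn {s} (inj₁ (_ , _ , _ , _ , _ , _ , (p , _) , _)) = small {s} (fz-frozen p)
      notIn (inj₂ (_ , t0 , _)) with trans (sym t0) tag-k
      ... | ()
      conflict : (∃ λ s → 0 ≤ s × ¬ Attackable (St s) s i r (root (St s) i k)) → ⊥
      conflict (s , _ , na) = na (subst (Attackable (St s) s i r) (sym (root-self (nc s)))
        (≤-reflexive (sym col-elt) , notIn , λ { (r' , _ , _ , _ , _ , _ , p) → small {s} (fz-frozen p) }))

    -- Column c is frozen only by requirements below c, hence below N; past N an element of tag 0 is
    -- in the set iff it is in A, and a table answers the rest.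
    column-below : ∀ c → (λ a → A i (elt c 0 a)) ≤ₘ InSet i
    column-below c = reduction F (λ a → to (cases (elt c 0 a)) refl) (λ a → from (cases (elt c 0 a)) refl)
      where
      N = St (proj₁ (quietBelow incomplete c))
      small : Dc {1} (λ ρ → x0 ρ < N × A i (x0 ρ))
      small = finiteᵈ (A i) N
      value : ℕ → ℕ
      value k = choose (dec (v0 {0} <ᵈ kn N) (k ∷ [])) (choose (dec small (k ∷ [])) 1 0) (suc (suc k))
      F : Fn {1} (λ ρ → value (elt c 0 (x0 ρ)))
      F = ifᶠ (v0 <ᵈ kn N) (ifᶠ small (kn 1) (kn 0)) (sucᶠ (sucᶠ v0)) $ᶠ eltᶠ (kn c) (kn 0) v0 ∷ᶠ []ᶠ
      data Cases (k : ℕ) : Set where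
        inside  : A i k → value k ≡ 1 → Cases k
        outside : ¬ A i k → value k ≡ 0 → Cases k
        large   : N ≤ k → value k ≡ suc (suc k) → Cases k
      cases : ∀ k → Cases k
      cases k = go (dec (v0 {0} <ᵈ kn N) (k ∷ [])) (dec small (k ∷ [])) refl
        where
        go : (d : Dec (k < N)) (e : Dec (k < N × A i k)) → value k ≡ choose d (choose e 1 0) (suc (suc k)) → Cases k
        go (yes _) (yes (_ , h)) e = inside h e
        go (yes lt) (no nh) e = outside (λ h → nh (lt , h)) e
        go (no ge) _ e = large (≮⇒≥ ge) e
      value-large : ∀ {a} → N ≤ elt c 0 a → InSet i (elt c 0 a) ⟺ A i (elt c 0 a)
      value-large le = unfrozen-value tag-elt λ s fr →
        <⇒≱ (frozen-small s (proj₂ (quietBelow incomplete c)) (≤-reflexive col-elt) fr) le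
      to : ∀ {k a} → Cases k → k ≡ elt c 0 a → A i k → interp (InSet i) (value k)
      to (inside _ e) _ h = subst (interp (InSet i)) (sym e) tt
      to (outside n e) _ h = ⊥-elim (n h)
      to (large le e) refl h = subst (interp (InSet i)) (sym e) (proj₂ (value-large le) h)
      from : ∀ {k a} → Cases k → k ≡ elt c 0 a → interp (InSet i) (value k) → A i k
      from (inside h e) _ _ = h
      from (outside n e) _ v = ⊥-elim (subst (interp (InSet i)) e v)
      from (large le e) refl v = proj₁ (value-large le) (subst (interp (InSet i)) e v)

-- The summand addressed by an output of a reduction to a join: colour 0 stands for the first summand and the constants

colourOf : ℕ → ℕ
colourOf v = 1 ∸ (1 ∸ fst (v ∸ 2))

colourOfᶠ : ∀ {n} {f : Vec ℕ n → ℕ} → Fn f → Fn (λ ρ → colourOf (f ρ))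
colourOfᶠ F = kn 1 ∸ᶠ (kn 1 ∸ᶠ fstᶠ (F ∸ᶠ kn 2))

colourOf-binary : ∀ v → colourOf v ≢ 0 → colourOf v ≡ 1
colourOf-binary v n with fst (v ∸ 2)
... | zero = ⊥-elim (n refl)
... | suc m = cong (1 ∸_) (0∸n≡0 m)

leftPart : ℕ → ℕ
leftPart w = suc (suc (snd w))

private
  isRightᵈ : Dc {1} (λ ρ → fst (x0 ρ) ≡ 1)
  isRightᵈ = fstᶠ v0 ≡ᵈ kn 1

opaque
  -- A first component above 1 receives colour 1 but belongs to neither summand; the value 0, FALSE,
  -- accounts for it.
  rightPart : ℕ → ℕ
  rightPart w = choose (dec isRightᵈ (w ∷ [])) (suc (suc (snd w))) 0

  rightPartᶠ : ∀ {n} {f : Vec ℕ n → ℕ} → Fn f → Fn (λ ρ → rightPart (f ρ))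
  rightPartᶠ F = Fn-ext {1} {g = λ ρ → rightPart (x0 ρ)} (λ { (w ∷ []) → refl }) (ifᶠ isRightᵈ (sucᶠ (sucᶠ (sndᶠ v0))) (kn 0)) $ᶠ F ∷ᶠ []ᶠ

  rightPart-1 : ∀ {w} → fst w ≡ 1 → rightPart w ≡ suc (suc (snd w))
  rightPart-1 {w} = choose-yes (dec isRightᵈ (w ∷ []))

  rightPart-0 : ∀ {w} → fst w ≢ 1 → rightPart w ≡ 0
  rightPart-0 {w} = choose-no (dec isRightᵈ (w ∷ []))

join-left : ∀ {X Y} v → colourOf v ≡ 0 → interp (Join X Y) v ⟺ interp X (bind leftPart v)
join-left zero _ = (λ ()) , (λ ())
join-left (suc zero) _ = (λ p → p) , (λ p → p)
join-left {X} {Y} (suc (suc w)) e with fst w in eq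
... | zero = (λ { (inj₁ (_ , x)) → x ; (inj₂ (o , _)) → ⊥-elim (0≢1+n (trans (sym eq) o)) }) , (λ x → inj₁ (eq , x))
... | suc m = ⊥-elim (0≢1+n (trans (sym e) (cong (1 ∸_) (0∸n≡0 m))))

join-right : ∀ {X Y} v → colourOf v ≡ 1 → interp (Join X Y) v ⟺ interp Y (bind rightPart v)
join-right zero e = ⊥-elim (0≢1+n (trans (sym (cong (λ n → 1 ∸ (1 ∸ n)) fst0)) e))
  where
  fst0 : fst 0 ≡ 0
  fst0 = n≤0⇒n≡0 (fst≤ 0)
join-right (suc zero) e = ⊥-elim (0≢1+n (trans (sym (cong (λ n → 1 ∸ (1 ∸ n)) (n≤0⇒n≡0 (fst≤ 0)))) e))
join-right {X} {Y} (suc (suc w)) e with fst w ≟ 1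
... | yes o rewrite rightPart-1 {w} o = (λ { (inj₁ (z , _)) → ⊥-elim (0≢1+n (trans (sym z) o)) ; (inj₂ (_ , y)) → y }) , (λ y → inj₂ (o , y))
... | no n rewrite rightPart-0 {w} n = (λ { (inj₁ (z , _)) → ⊥-elim (0≢1+n (trans (sym (cong (λ n → 1 ∸ (1 ∸ n)) z)) e)) ; (inj₂ (o , _)) → n o }) , (λ ())

-- Join-primality through colour classes

module Primality (em : ExcludedMiddle 0ℓ) (ē ᾱ : ℕ) {i : ℕ} where
  open Classical em
  open Stages ē ᾱ
  open Invariants ē ᾱ
  open Verification em ē ᾱ
  open Outcome em ē ᾱ {i}

  module Coloured (incomplete : ¬ (K ≤ₘ Tower i)) {γ : ℕ → ℕ} (I : Index γ) where

    c : ℕ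
    c = Index.number I

    private
      s₀ : ℕ
      s₀ = proj₁ (quietBelow incomplete c)

      total : ∀ a → ∃ λ s → Halt c (elt c 1 a) s
      total a = let s , h = Index.halts I (elt c 1 a) in s , γ (elt c 1 a) , Comp-< h , h

      copied : ∀ {a} → St s₀ ≤ elt c 1 a → ∃ λ s → Copied (St s) i (elt c 1 a)
      copied {a} le with pool-acts total a
      ... | s , inj₁ p = s , p
      ... | s , inj₂ fr = ⊥-elim (<⇒≱ (frozen-small s (proj₂ (quietBelow incomplete c)) (≤-reflexive col-elt) fr) le)

      colour-correct : ∀ {s k m γ'} → col k ≡ c → CpFact s i k m γ' → γ' ≡ γ k
      colour-correct {s} {k} {m} {γ'} refl fact with proj₂ (proj₂ (proj₂ (CpFact.ready fact))) (idx k) ≤-refl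
      ... | v , v<s , h = trans (CpFact.γ≡ fact) (Index.only I k _ s (holds C lt))
        where
        C = colour-spec s k
        h' : Comp (col k) k v s
        h' = subst (λ x → Comp (col k) x v s) (sym (proj₁ (CpFact.ready fact))) h
        lt : colour s k < s
        lt = ≤-<-trans (≮⇒≥ λ lt' → least C v lt' h') v<s

    Many : ℕ → Set
    Many γ₀ = ∀ b → ∃ λ a → b ≤ a × γ (elt c 1 a) ≡ γ₀

    private
      module _ {γ₀} (many : Many γ₀) where

        covered-later : ∀ {s t m} → s ≤ t → Covered (St s) i c m γ₀ → Covered (St t) i c m γ₀
        covered-later le (k , _ , e , p) = k , cp-k< (St-mono le p) , e , St-mono le p

        all-covered : ∀ m → ∃ λ s → ∀ j → j < m → Covered (St s) i c j γ₀
        all-covered zero = 0 , λ j ()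
        all-covered (suc m) with all-covered m | em {∃ λ t → Covered (St t) i c m γ₀}
        ... | s , h | yes (t , q) = s ⊔ t , new
          where
          new : ∀ j → j < suc m → Covered (St (s ⊔ t)) i c j γ₀
          new j (s≤s le) with m≤n⇒m<n∨m≡n le
          ... | inj₁ lt = covered-later (m≤m⊔n s t) (h j lt)
          ... | inj₂ refl = covered-later (m≤n⊔m s t) q
        -- An index past `St s` forces k to be copied no earlier than s, when all j < m are covered;
        -- past `St s₀` it escapes freezing; and k ≥ m + 2 keeps the default target k ∸ 1 above m.
        ... | s , h | no n with many (St s ⊔ (St s₀ ⊔ suc (suc m)))
        ... | a , le , γ≡ with copied {a} (≤-trans (≤-trans (m≤m⊔n (St s₀) _) (m≤n⊔m (St s) _)) (≤-trans le ≤elt))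
        ... | u , m' , _ , γ' , _ , p with cp-origin u p
        ... | t , _ , fact , p' = ⊥-elim (n (suc t , k , cp-k< p'' , col-elt , p''))
          where
          k = elt c 1 a
          k≥ : suc (suc m) ≤ k
          k≥ = ≤-trans (≤-trans (m≤n⊔m (St s₀) _) (m≤n⊔m (St s) _)) (≤-trans le ≤elt)
          s≤t : s ≤ t
          s≤t with ≤-total s t
          ... | inj₁ l = l
          ... | inj₂ l with m≤n⇒m<n∨m≡n l
          ... | inj₂ e = ≤-reflexive (sym e)
          ... | inj₁ lt = ⊥-elim (<⇒≱ (cp-k< (St-mono lt p')) (≤-trans (m≤m⊔n (St s) _) (≤-trans le ≤elt)))
          γ'≡ : γ' ≡ γ₀
          γ'≡ = trans (colour-correct col-elt fact) γ≡
          T = target-spec (St t) i k γ'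
          uncovered : ∀ {j} → Covered (St t) i (col k) j γ' → ∃ λ t → Covered (St t) i c j γ₀
          uncovered {j} q = t , subst₂ (λ c γ → Covered (St t) i c j γ) col-elt γ'≡ q
          ≤m : target (St t) i k γ' ≤ m
          ≤m = ≮⇒≥ λ lt → least T m lt (inj₁ λ q → n (uncovered q))
          ≡m : target (St t) i k γ' ≡ m
          ≡m with m≤n⇒m<n∨m≡n ≤m
          ... | inj₂ e = e
          ... | inj₁ lt with holds T (≤-<-trans ≤m (≤-trans (n≤1+n (suc m)) k≥))
          ... | inj₁ nc = ⊥-elim (nc (subst₂ (λ c γ → Covered (St t) i c (target (St t) i k γ') γ) (sym col-elt) (sym γ'≡) (covered-later s≤t (h _ lt))))
          ... | inj₂ e = ⊥-elim (<-irrefl refl (≤-trans (s≤s (≤-trans (≤-reflexive (sym e)) (s≤s ≤m))) k≥))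
          p'' : cp i k m γ₀ ∈ St (suc t)
          p'' = subst₂ (λ m γ → cp i k m γ ∈ St (suc t)) (trans (CpFact.m≡ fact) ≡m) γ'≡ p'

    -- Every m has a copy of colour γ₀ in this column, with the same membership as m; the reduction
    -- finds such a copy and applies h to it.
    colour-class-complete : ∀ {γ₀} {Z : ℕ → Set} {h : ℕ → ℕ} → (∀ {n} {f : Vec ℕ n → ℕ} → Fn f → Fn (λ ρ → h (f ρ))) → Many γ₀ →
      (∀ k → γ k ≡ γ₀ → InSet i k ⟺ interp Z (h k)) → InSet i ≤ₘ Z
    colour-class-complete {γ₀} {Z} {h} H many eq = search-reduction cert (H (sndᶠ v0)) tot correct
      where
      cert : Dc {2} (λ ρ → cp i (snd (x0 ρ)) (x1 ρ) γ₀ ∈ St (fst (x0 ρ)) × col (snd (x0 ρ)) ≡ c)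
      cert = ∈ᵈ (cpᶠ (kn i) (sndᶠ v0) v1 (kn γ₀)) (Stᶠ (fstᶠ v0)) ×ᵈ (fstᶠ (sndᶠ v0) ≡ᵈ kn c)
      tot : ∀ m → ∃ λ y → cp i (snd y) m γ₀ ∈ St (fst y) × col (snd y) ≡ c
      tot m with all-covered many (suc m)
      ... | s , h' with h' m ≤-refl
      ... | k , _ , e , p = ⟨ s , k ⟩ , subst₂ (λ k s → cp i k m γ₀ ∈ St s) (sym snd-⟨⟩) (sym fst-⟨⟩) p , trans (cong col snd-⟨⟩) e
      correct : ∀ m y → cp i (snd y) m γ₀ ∈ St (fst y) × col (snd y) ≡ c → InSet i m ⟺ interp Z (h (snd y))
      correct m y (p , e) = (λ q → proj₁ e' (inSet-same-root (sym (root-copy p)) q)) , (λ q → inSet-same-root (root-copy p) (proj₂ e' q))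
        where
        γ≡ : γ (snd y) ≡ γ₀
        γ≡ with cp-origin (fst y) p
        ... | t , _ , fact , _ = sym (colour-correct e fact)
        e' = eq (snd y) γ≡

  -- One of the two colours occurs infinitely often in the pool for this colouring, so its class contains copies of all elements.
  joinPrime : ¬ (K ≤ₘ Tower i) → JoinPrime (InSet i)
  joinPrime incomplete X Y red = byMajority
    where
    R = unpack red
    open Coloured incomplete {λ k → colourOf (fun R k)} (index (colourOfᶠ (funᶠ R v0)))
    left : ∀ k → colourOf (fun R k) ≡ 0 → InSet i k ⟺ interp X (bind leftPart (fun R k))
    left k e = (λ p → proj₁ (join-left {X} {Y} (fun R k) e) (forth R k p)) , (λ x → back R k (proj₂ (join-left {X} {Y} (fun R k) e) x))
    right : ∀ k → colourOf (fun R k) ≡ 1 → InSet i k ⟺ interp Y (bind rightPart (fun R k))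
    right k e = (λ p → proj₁ (join-right {X} {Y} (fun R k) e) (forth R k p)) , (λ x → back R k (proj₂ (join-right {X} {Y} (fun R k) e) x))
    byMajority : InSet i ≤ₘ X ⊎ InSet i ≤ₘ Y
    byMajority with em {Many 0}
    ... | yes m = inj₁ (colour-class-complete {h = λ k → bind leftPart (fun R k)} (λ F → bindᶠ {g = leftPart} (funᶠ R F) (λ G → sucᶠ (sucᶠ (sndᶠ G)))) m left)
    ... | no n with ¬∀⇒∃¬ n
    ... | b , nb = inj₂ (colour-class-complete {h = λ k → bind rightPart (fun R k)} (λ F → bindᶠ {g = rightPart} (funᶠ R F) rightPartᶠ) (λ b' → b ⊔ b' , m≤n⊔m b b' ,
            colourOf-binary (fun R (elt c 1 (b ⊔ b'))) (λ z → nb (b ⊔ b' , m≤m⊔n b b' , z))) right)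

-- Common lower bounds of a set and its tower

module Meets (em : ExcludedMiddle 0ℓ) (ē ᾱ : ℕ) {i : ℕ} where
  open Classical em
  open Stages ē ᾱ
  open Invariants ē ᾱ
  open Verification em ē ᾱ
  open Outcome em ē ᾱ {i}

  Columns : ℕ → ℕ → Set
  Columns r k = col k ≤ r × tag k ≡ 0 × A i k

  Total : ℕ → Set
  Total c = ∀ a → ∃ λ s → Halt c (elt c 1 a) s

  module _ {r s₀ : ℕ} (qb : QuietBelow i (suc r) s₀) where

    private
      Bound : ℕ → ℕ → Set
      Bound c b = ¬ Total c → ∃ λ a → (∀ s → ¬ Halt c (elt c 1 a) s) × elt c 1 a ≤ b

      bounds : ∀ c → Eventually (Bound c)
      bounds c with em {Total c}
      ... | yes t = 0 , λ b _ n → ⊥-elim (n t)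
      ... | no n with ¬∀⇒∃¬ n
      ... | a , h = elt c 1 a , λ b le _ → a , (λ s p → h (s , p)) , le

    opaque
      -- Beyond B the columns ≤ r contain no frozen elements and, if their colouring is partial, no copies.
      B : ℕ
      B = St s₀ ⊔ proj₁ (collect (suc r) (λ c _ → bounds c))

      frozen-B : ∀ {k} s → col k ≤ r → Frozen (St s) i k → k < B
      frozen-B s le (r' , _ , _ , _ , _ , _ , p) = <-≤-trans (fz-k< (qb r' (s≤s (≤-trans (<⇒≤ (fz-column p)) le)) s p)) (m≤m⊔n (St s₀) _)

      frozenBelow-B : ∀ {k} s → FrozenBelow (St s) i k (suc r) → k < B
      frozenBelow-B s (r' , lt , _ , _ , _ , _ , p) = <-≤-trans (fz-k< (qb r' lt s p)) (m≤m⊔n (St s₀) _)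

      copied-B : ∀ {k} s → col k ≤ r → ¬ Total (col k) → Copied (St s) i k → k < B
      copied-B {k} s le nt (m , _ , γ , _ , p) with proj₂ (collect (suc r) (λ c _ → bounds c)) B (m≤n⊔m (St s₀) _) (col k) (s≤s le) nt
                                                 | cp-origin s p
      ... | a , none , a≤ | t , _ , fact , _ = <-≤-trans (subst (_< elt (col k) 1 a) (sym (cp-shape p)) (⟨⟩-<ʳ (⟨⟩-<ʳ idx<))) a≤
        where
        idx< : idx k < a
        idx< = ≰⇒> λ le' → none t (proj₂ (proj₂ (proj₂ (CpFact.ready fact))) a (s≤s le'))

    InPool : ℕ → Set
    InPool ρ = ρ ≡ elt (col ρ) 1 (idx ρ) × col ρ < suc r × Total (col ρ)

    -- The cases in which `Columns r` decides a root: table lookup, already in, a question about A,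
    -- or beyond the reach of every rule. The last one consults which of the colourings up to r are
    -- total, a finite amount of information.
    Final : ℕ → ℕ → Set
    Final s ρ = ρ < B ⊎ RootIn (St s) s i ρ ⊎ (col ρ ≤ r × tag ρ ≡ 0) ⊎ (col ρ ≤ r × ¬ InPool ρ)

    Finalᵈ : Dc {2} (λ ρ → Final (x0 ρ) (x1 ρ))
    Finalᵈ = (v1 <ᵈ kn B) ⊎ᵈ RootInᵈ (Stᶠ v0) v0 (kn i) v1 ⊎ᵈ ((fstᶠ v1 ≤ᵈ kn r) ×ᵈ (fstᶠ (sndᶠ v1) ≡ᵈ kn 0)) ⊎ᵈ
      ((fstᶠ v1 ≤ᵈ kn r) ×ᵈ ¬ᵈ ((v1 ≡ᵈ eltᶠ (fstᶠ v1) (kn 1) (sndᶠ (sndᶠ v1))) ×ᵈ (finiteᵈ Total (suc r) $ᵈ fstᶠ v1 ∷ᶠ []ᶠ)))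

    private
      largeᵈ : Dc {2} (λ ρ → x1 ρ < B)
      largeᵈ = v1 <ᵈ kn B
      smallᵈ : Dc {2} (λ ρ → x1 ρ < B × InSet i (x1 ρ))
      smallᵈ = finiteᵈ (InSet i) B $ᵈ v1 ∷ᶠ []ᶠ
      inᵈ : Dc {2} (λ ρ → RootIn (St (x0 ρ)) (x0 ρ) i (x1 ρ))
      inᵈ = RootInᵈ (Stᶠ v0) v0 (kn i) v1
      columnᵈ : Dc {2} (λ ρ → tag (x1 ρ) ≡ 0)
      columnᵈ = fstᶠ (sndᶠ v1) ≡ᵈ kn 0

    opaque
      outcome : ℕ → ℕ → ℕ
      outcome s ρ = choose (dec largeᵈ (s ∷ ρ ∷ [])) (choose (dec smallᵈ (s ∷ ρ ∷ [])) 1 0)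
        (choose (dec inᵈ (s ∷ ρ ∷ [])) 1 (choose (dec columnᵈ (s ∷ ρ ∷ [])) (suc (suc ρ)) 0))

      outcomeᶠ : ∀ {n} {f g : Vec ℕ n → ℕ} → Fn f → Fn g → Fn (λ ρ → outcome (f ρ) (g ρ))
      outcomeᶠ F G = Fn-ext {2} {g = λ ρ → outcome (x0 ρ) (x1 ρ)} (λ { (s ∷ ρ ∷ []) → refl })
        (ifᶠ largeᵈ (ifᶠ smallᵈ (kn 1) (kn 0)) (ifᶠ inᵈ (kn 1) (ifᶠ columnᵈ (sucᶠ (sucᶠ v1)) (kn 0)))) $ᶠ F ∷ᶠ G ∷ᶠ []ᶠ

      outcome-small : ∀ {s ρ} → ρ < B → InSet i ρ ⟺ interp (Columns r) (outcome s ρ)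
      outcome-small {s} {ρ} lt with em {InSet i ρ}
      ... | yes p = (λ _ → subst (interp (Columns r)) (sym e) tt) , (λ _ → p)
        where
        e : outcome s ρ ≡ 1
        e = trans (choose-yes (dec largeᵈ (s ∷ ρ ∷ [])) lt) (choose-yes (dec smallᵈ (s ∷ ρ ∷ [])) (lt , p))
      ... | no n = (λ p → ⊥-elim (n p)) , (λ q → ⊥-elim (subst (interp (Columns r)) e q))
        where
        e : outcome s ρ ≡ 0
        e = trans (choose-yes (dec largeᵈ (s ∷ ρ ∷ [])) lt) (choose-no (dec smallᵈ (s ∷ ρ ∷ [])) (λ p → n (proj₂ p)))

      outcome-in : ∀ {s ρ} → ¬ ρ < B → RootIn (St s) s i ρ → outcome s ρ ≡ 1
      outcome-in {s} {ρ} nl h = trans (choose-no (dec largeᵈ (s ∷ ρ ∷ [])) nl) (choose-yes (dec inᵈ (s ∷ ρ ∷ [])) h)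

      outcome-column : ∀ {s ρ} → ¬ ρ < B → ¬ RootIn (St s) s i ρ → tag ρ ≡ 0 → outcome s ρ ≡ suc (suc ρ)
      outcome-column {s} {ρ} nl nh t0 = trans (choose-no (dec largeᵈ (s ∷ ρ ∷ [])) nl)
        (trans (choose-no (dec inᵈ (s ∷ ρ ∷ [])) nh) (choose-yes (dec columnᵈ (s ∷ ρ ∷ [])) t0))

      outcome-free : ∀ {s ρ} → ¬ ρ < B → ¬ RootIn (St s) s i ρ → tag ρ ≢ 0 → outcome s ρ ≡ 0
      outcome-free {s} {ρ} nl nh t0 = trans (choose-no (dec largeᵈ (s ∷ ρ ∷ [])) nl)
        (trans (choose-no (dec inᵈ (s ∷ ρ ∷ [])) nh) (choose-no (dec columnᵈ (s ∷ ρ ∷ [])) t0))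

    never-in : ∀ {ρ} → ¬ ρ < B → col ρ ≤ r → tag ρ ≢ 0 → ¬ InPool ρ → ¬ InSet i ρ
    never-in {ρ} nl le nt np h with never-copied-root nc h
      where
      nc : ∀ s → ¬ Copied (St s) i ρ
      nc s q@(_ , _ , _ , _ , p) = nl (copied-B s le (λ t → np (cp-shape p , s≤s le , t)) q)
    ... | s , inj₁ (_ , _ , _ , _ , _ , _ , (p , _) , _) = nl (frozen-B s le (fz-frozen p))
    ... | s , inj₂ (_ , t0 , _) = nt t0

    outcome-correct : ∀ {s ρ} → (RootIn (St s) s i ρ → InSet i ρ) → Final s ρ → InSet i ρ ⟺ interp (Columns r) (outcome s ρ)
    outcome-correct {s} {ρ} rooted fin with em {ρ < B} | em {RootIn (St s) s i ρ}
    ... | yes lt | _ = outcome-small lt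
    ... | no nl | yes h = (λ _ → subst (interp (Columns r)) (sym (outcome-in nl h)) tt) , (λ _ → rooted h)
    ... | no nl | no nh with fin
    ... | inj₁ lt = ⊥-elim (nl lt)
    ... | inj₂ (inj₁ h) = ⊥-elim (nh h)
    ... | inj₂ (inj₂ (inj₁ (le , t0))) = (λ p → subst (interp (Columns r)) (sym e) (le , t0 , proj₁ val p)) ,
                                         (λ q → proj₂ val (proj₂ (proj₂ (subst (interp (Columns r)) e q))))
      where
      e = outcome-column nl nh t0
      val = unfrozen-value t0 (λ s fr → nl (frozen-B s le fr))
    ... | inj₂ (inj₂ (inj₂ (le , np))) with em {tag ρ ≡ 0}
    ... | yes t0 = (λ p → subst (interp (Columns r)) (sym e) (le , t0 , proj₁ val p)) ,
                   (λ q → proj₂ val (proj₂ (proj₂ (subst (interp (Columns r)) e q))))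
      where
      e = outcome-column nl nh t0
      val = unfrozen-value t0 (λ s fr → nl (frozen-B s le fr))
    ... | no nt = (λ p → ⊥-elim (never-in nl le nt np p)) , (λ q → ⊥-elim (subst (interp (Columns r)) (outcome-free nl nh nt) q))

    -- A root that stays in a total pool would be copied or frozen, and only the requirements below r could freeze it.
    final-of-settled : ∀ {t ρ} → (∀ s → t ≤ s → ¬ Copied (St s) i ρ) → ∀ s → ¬ Attackable (St s) s i r ρ → Final s ρ
    final-of-settled {t} {ρ} nc s na with em {ρ < B} | em {RootIn (St s) s i ρ} | em {col ρ ≤ r}
    ... | yes lt | _ | _ = inj₁ lt
    ... | no _ | yes h | _ = inj₂ (inj₁ h)
    ... | no nl | no nh | no gt = ⊥-elim (na (≰⇒> gt , nh , λ fr → nl (frozenBelow-B s fr)))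
    ... | no nl | no nh | yes le = inj₂ (inj₂ (inj₂ (le , notPool)))
      where
      notPool : ¬ InPool ρ
      notPool (e , _ , tot) with pool-acts tot (idx ρ)
      ... | u , inj₂ fr = nl (frozen-B u le (subst (Frozen (St u) i) (sym e) fr))
      ... | u , inj₁ (m , _ , γ , _ , p) = nc (t ⊔ u) (m≤m⊔n t u)
              (cp-copied (St-mono (m≤n⊔m t u) (subst (λ k → cp i k m γ ∈ St u) (sym e) p)))

  -- The reduction waits until the root of the value of the first reduction is final. Such a stage
  -- comes, because roots stabilise and, by `settled`, the limit root is unattackable at some late
  -- stage.
  meet : ¬ (K ≤ₘ Tower i) → ∀ Q → Q ≤ₘ InSet i → Q ≤ₘ Tower i → ∃ λ r → Q ≤ₘ Columns r
  meet incomplete Q red red' = r , search-reduction cert value total correct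
    where
    R = unpack red
    S = unpack red'
    open Settling incomplete {fun R} {fun S} (index (funᶠ R v0)) (index (funᶠ S v0))
      (λ n → (λ p → forth S n (back R n p)) , (λ q → forth R n (back S n q)))
    cert : Dc {2} (λ ρ → fun R (x1 ρ) < 2 ⊎ Final qb (x0 ρ) (root (St (x0 ρ)) i (fun R (x1 ρ) ∸ 2)))
    cert = (funᶠ R v1 <ᵈ kn 2) ⊎ᵈ (Finalᵈ qb $ᵈ v0 ∷ᶠ rootᶠ (Stᶠ v0) (kn i) (funᶠ R v1 ∸ᶠ kn 2) ∷ᶠ []ᶠ)
    isConstᵈ : Dc {2} (λ ρ → x0 ρ < 2)
    isConstᵈ = v0 <ᵈ kn 2
    output : ℕ → ℕ → ℕ
    output s v = choose (dec isConstᵈ (v ∷ s ∷ [])) v (outcome qb s (root (St s) i (v ∸ 2)))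
    value : Fn {2} (λ ρ → output (x0 ρ) (fun R (x1 ρ)))
    value = ifᶠ isConstᵈ v0 (outcomeᶠ qb v1 (rootᶠ (Stᶠ v1) (kn i) (v0 ∸ᶠ kn 2))) $ᶠ funᶠ R v1 ∷ᶠ v0 ∷ᶠ []ᶠ

    eventually-final : ∀ {n a} → fun R n ≡ suc (suc a) → ∃ λ s → Final qb s (root (St s) i a)
    eventually-final {n} {a} e with limit-root a
    ... | ρ , t , lim with settled {n} {a} e t
    ... | s , le , na = s , subst (Final qb s) (sym (lim s le)) (final-of-settled qb {t} {ρ}
            (λ s' le' → subst (λ x → ¬ Copied (St s') i x) (lim s' le') (root-uncopied {s'} {i} {a}))
            s (subst (λ x → ¬ Attackable (St s) s i r x) (lim s le) na))

    total : ∀ n → ∃ λ s → fun R n < 2 ⊎ Final qb s (root (St s) i (fun R n ∸ 2))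
    total n = go (fun R n) refl
      where
      go : ∀ v → fun R n ≡ v → ∃ λ s → fun R n < 2 ⊎ Final qb s (root (St s) i (fun R n ∸ 2))
      go zero e = 0 , inj₁ (subst (_< 2) (sym e) (s≤s z≤n))
      go (suc zero) e = 0 , inj₁ (subst (_< 2) (sym e) (s≤s (s≤s z≤n)))
      go (suc (suc a)) e = let s , h = eventually-final e in s , inj₂ (subst (λ v → Final qb s (root (St s) i (v ∸ 2))) (sym e) h)

    output-correct : ∀ s v → v < 2 ⊎ Final qb s (root (St s) i (v ∸ 2)) → interp (InSet i) v ⟺ interp (Columns r) (output s v)
    output-correct s zero _ = (λ ()) , subst (interp (Columns r)) e
      where
      e : output s 0 ≡ 0
      e = choose-yes {0 < 2} (dec isConstᵈ (0 ∷ s ∷ [])) {0} {outcome qb s (root (St s) i 0)} (s≤s z≤n)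
    output-correct s (suc zero) _ = (λ _ → subst (interp (Columns r)) (sym e) tt) , (λ _ → tt)
      where
      e : output s 1 ≡ 1
      e = choose-yes {1 < 2} (dec isConstᵈ (1 ∷ s ∷ [])) {1} {outcome qb s (root (St s) i 0)} (s≤s (s≤s z≤n))
    output-correct s (suc (suc a)) (inj₁ (s≤s (s≤s ())))
    output-correct s (suc (suc a)) (inj₂ fin) = (λ p → subst (interp (Columns r)) (sym e) (proj₁ oc (proj₁ (inSet-root s) p))) ,
                                               (λ q → proj₂ (inSet-root s) (proj₂ oc (subst (interp (Columns r)) e q)))
      where
      e : output s (suc (suc a)) ≡ outcome qb s (root (St s) i a)
      e = choose-no {suc (suc a) < 2} (dec isConstᵈ (suc (suc a) ∷ s ∷ [])) {suc (suc a)} {outcome qb s (root (St s) i a)} (λ { (s≤s (s≤s ())) })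
      oc = outcome-correct qb {s} {root (St s) i a} (λ h → s , subst (RootIn (St s) s i) (sym (root-root s i a)) h) fin

    correct : ∀ n s → fun R n < 2 ⊎ Final qb s (root (St s) i (fun R n ∸ 2)) → Q n ⟺ interp (Columns r) (output s (fun R n))
    correct n s c = (λ q → proj₁ (output-correct s (fun R n) c) (forth R n q)) , (λ p → back R n (proj₂ (output-correct s (fun R n) c) p))

-- Joins in the semilattice of many-one degrees

piece : ∀ {Q X : ℕ → Set} {P : Vec ℕ 1 → Set} {h : Vec ℕ 1 → ℕ} → Dc P → Fn h →
        (∀ n → P (n ∷ []) → Q n ⟺ interp X (h (n ∷ []))) → (λ n → Q n × P (n ∷ [])) ≤ₘ X
piece {Q} {X} {P} {h} D H e = reduction (ifᶠ D H (kn 0)) to from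
  where
  to : ∀ n → Q n × P (n ∷ []) → interp X (choose (dec D (n ∷ [])) (h (n ∷ [])) 0)
  to n (q , p) = subst (interp X) (sym (choose-yes (dec D (n ∷ [])) p)) (proj₁ (e n p) q)
  from : ∀ n → interp X (choose (dec D (n ∷ [])) (h (n ∷ [])) 0) → Q n × P (n ∷ [])
  from n v with dec D (n ∷ [])
  ... | yes p = proj₂ (e n p) v , p

glue : ∀ {Q Z : ℕ → Set} {P : Vec ℕ 1 → Set} → Dc P → (λ n → Q n × P (n ∷ [])) ≤ₘ Z → (λ n → Q n × ¬ P (n ∷ [])) ≤ₘ Z → Q ≤ₘ Z
glue {Q} {Z} {P} D a b = reduction (ifᶠ D (funᶠ R v0) (funᶠ S v0)) to from
  where
  R = unpack a
  S = unpack b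
  to : ∀ n → Q n → interp Z (choose (dec D (n ∷ [])) (fun R n) (fun S n))
  to n q with dec D (n ∷ [])
  ... | yes p = forth R n (q , p)
  ... | no p = forth S n (q , p)
  from : ∀ n → interp Z (choose (dec D (n ∷ [])) (fun R n) (fun S n)) → Q n
  from n v with dec D (n ∷ [])
  ... | yes p = proj₁ (back R n v)
  ... | no p = proj₁ (back S n v)

-- The semilattice is distributive: it suffices to treat the parts of Q below X and below Y.
join-split : ∀ {Q X Y Z : ℕ → Set} → Q ≤ₘ Join X Y → (∀ Q' → Q' ≤ₘ Q → Q' ≤ₘ X → Q' ≤ₘ Z) → (∀ Q' → Q' ≤ₘ Q → Q' ≤ₘ Y → Q' ≤ₘ Z) → Q ≤ₘ Z
join-split {Q} {X} {Y} {Z} red f g = glue D (f _ (piece D (sucᶠ (sucᶠ v0)) (λ n _ → (λ q → q) , (λ q → q))) (piece D (bindᶠ {g = leftPart} (funᶠ R v0) (λ G → sucᶠ (sucᶠ (sndᶠ G)))) left))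
    (g _ (piece (¬ᵈ D) (sucᶠ (sucᶠ v0)) (λ n _ → (λ q → q) , (λ q → q))) (piece (¬ᵈ D) (bindᶠ {g = rightPart} (funᶠ R v0) rightPartᶠ) right))
  where
  R = unpack red
  D : Dc {1} (λ ρ → colourOf (fun R (x0 ρ)) ≡ 0)
  D = colourOfᶠ (funᶠ R v0) ≡ᵈ kn 0
  left : ∀ n → colourOf (fun R n) ≡ 0 → Q n ⟺ interp X (bind leftPart (fun R n))
  left n e = (λ p → proj₁ (join-left {X} {Y} (fun R n) e) (forth R n p)) , (λ x → back R n (proj₂ (join-left {X} {Y} (fun R n) e) x))
  right : ∀ n → colourOf (fun R n) ≢ 0 → Q n ⟺ interp Y (bind rightPart (fun R n))
  right n ne = (λ p → proj₁ (join-right {X} {Y} (fun R n) e) (forth R n p)) , (λ x → back R n (proj₂ (join-right {X} {Y} (fun R n) e) x))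
    where
    e = colourOf-binary (fun R n) ne

join-ˡ : ∀ {X Y} → X ≤ₘ Join X Y
join-ˡ {X} {Y} = reduction (sucᶠ (sucᶠ ⟨ kn 0 , v0 ⟩ᶠ)) (λ n x → inj₁ (fst-⟨⟩ , subst X (sym snd-⟨⟩) x)) from
  where
  from : ∀ n → Join X Y ⟨ 0 , n ⟩ → X n
  from n (inj₁ (_ , x)) = subst X snd-⟨⟩ x
  from n (inj₂ (o , _)) = ⊥-elim (0≢1+n (trans (sym fst-⟨⟩) o))

join-ʳ : ∀ {X Y} → Y ≤ₘ Join X Y
join-ʳ {X} {Y} = reduction (sucᶠ (sucᶠ ⟨ kn 1 , v0 ⟩ᶠ)) (λ n x → inj₂ (fst-⟨⟩ , subst Y (sym snd-⟨⟩) x)) from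
  where
  from : ∀ n → Join X Y ⟨ 1 , n ⟩ → Y n
  from n (inj₂ (_ , x)) = subst Y snd-⟨⟩ x
  from n (inj₁ (o , _)) = ⊥-elim (0≢1+n (trans (sym o) fst-⟨⟩))

join-lub : ∀ {X Y Z} → X ≤ₘ Z → Y ≤ₘ Z → Join X Y ≤ₘ Z
join-lub p q = join-split ≤ₘ-refl (λ _ _ h → ≤ₘ-trans h p) (λ _ _ h → ≤ₘ-trans h q)

joinPrime-≤ : ∀ {Z Z'} → Z ≤ₘ Z' → Z' ≤ₘ Z → JoinPrime Z → JoinPrime Z'
joinPrime-≤ p q jp X Y h = map (≤ₘ-trans q) (≤ₘ-trans q) (jp X Y (≤ₘ-trans p h))

-- Finite joins

record FinJoin (P : ℕ → ℕ → Set) (r w : ℕ) : Set where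
  constructor _,_
  field
    bound : fst w ≤ r
    entry : P (fst w) (snd w)

private
  row : ∀ {P : ℕ → ℕ → Set} {r} c → c ≤ r → (λ w → FinJoin P r w × fst w ≡ c) ≤ₘ P c
  row {P} {r} c le = piece {Q = FinJoin P r} {X = P c} {P = λ ρ → fst (x0 ρ) ≡ c} (fstᶠ v0 ≡ᵈ kn c) (sucᶠ (sucᶠ (sndᶠ v0)))
    (λ w e → (λ { (_ , p) → subst (λ c → P c (snd w)) e p }) , (λ p → subst (_≤ r) (sym e) le , subst (λ c → P c (snd w)) (sym e) p))

finJoin-zero : ∀ {P : ℕ → ℕ → Set} → FinJoin P 0 ≤ₘ P 0
finJoin-zero {P} = ≤ₘ-trans (⇔-≤ₘ (λ w p → p , n≤0⇒n≡0 (FinJoin.bound p)) (λ w → proj₁)) (row 0 z≤n)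

finJoin-suc : ∀ {P : ℕ → ℕ → Set} {r} → FinJoin P (suc r) ≤ₘ Join (FinJoin P r) (P (suc r))
finJoin-suc {P} {r} = glue {P = λ ρ → fst (x0 ρ) ≡ suc r} (fstᶠ v0 ≡ᵈ kn (suc r))
  (≤ₘ-trans (row (suc r) ≤-refl) join-ʳ)
  (≤ₘ-trans (piece {X = FinJoin P r} (¬ᵈ (fstᶠ v0 ≡ᵈ kn (suc r))) (sucᶠ (sucᶠ v0))
    (λ w ne → (λ { (le , p) → ≤-pred (≤∧≢⇒< le ne) , p }) , (λ { (le , p) → ≤-trans le (n≤1+n r) , p }))) join-ˡ)

finJoin-split : ∀ {Q Z : ℕ → Set} {P : ℕ → ℕ → Set} r → Q ≤ₘ FinJoin P r → (∀ c → c ≤ r → ∀ Q' → Q' ≤ₘ Q → Q' ≤ₘ P c → Q' ≤ₘ Z) → Q ≤ₘ Z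
finJoin-split {Q} {P = P} zero q h = h 0 z≤n Q (≤ₘ-refl {Q}) (≤ₘ-trans {Q} {FinJoin P 0} {P 0} q finJoin-zero)
finJoin-split {Q} {Z} {P} (suc r) q h = join-split {Q} {FinJoin P r} {P (suc r)} {Z}
  (≤ₘ-trans {Q} {FinJoin P (suc r)} {Join (FinJoin P r) (P (suc r))} q finJoin-suc)
  (λ Q' q' p → finJoin-split {Q'} {Z} {P} r p (λ c le Q'' q'' → h c (≤-trans le (n≤1+n r)) Q'' (≤ₘ-trans {Q''} {Q'} {Q} q'' q')))
  (λ Q' q' p → h (suc r) ≤-refl Q' q' p)

finJoin-lub : ∀ {Z : ℕ → Set} {P : ℕ → ℕ → Set} r → (∀ c → c ≤ r → P c ≤ₘ Z) → FinJoin P r ≤ₘ Z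
finJoin-lub {Z} {P} r h = finJoin-split {FinJoin P r} {Z} {P} r (≤ₘ-refl {FinJoin P r}) (λ c le Q _ p → ≤ₘ-trans {Q} {P c} {Z} p (h c le))

-- Preimages and joins of c.e. sets

preimage : ∀ {f : ℕ → ℕ} → Code 1 → Fn {1} (λ ρ → f (x0 ρ)) → Code 1
preimage c F = comp c (code F ∷ [])

preimage-W : ∀ {f : ℕ → ℕ} {c : Code 1} (F : Fn {1} (λ ρ → f (x0 ρ))) {n} → W (preimage {f} c F) n ⟺ W c (f n)
preimage-W {f} {c} F {n} = to , (λ { (v , d) → v , ev-comp (ev-∷ (eval F (n ∷ [])) ev-[]) d })
  where
  to : W (preimage {f} c F) n → W c (f n)
  to (v , ev-comp (ev-∷ d ev-[]) d') = v , subst (λ x → c ∙ (x ∷ []) ⇓ v) (deterministic d (eval F (n ∷ []))) d'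

opaque
  Row : Code 1 → ℕ → Code 1
  Row ω i = preimage {λ n → ⟨ i , n ⟩} ω ⟨ kn i , v0 ⟩ᶠ

  Row-W : ∀ {ω i n} → W (Row ω i) n ⟺ W ω ⟨ i , n ⟩
  Row-W {ω} {i} = preimage-W {λ n → ⟨ i , n ⟩} {ω} ⟨ kn i , v0 ⟩ᶠ

  private
    JoinAt : Code 1 → Code 1 → Vec ℕ 2 → Set
    JoinAt a b ρ = (fst (x1 ρ) ≡ 0 × Halt ⌜ a ⌝ (snd (x1 ρ)) (x0 ρ)) ⊎ (fst (x1 ρ) ≡ 1 × Halt ⌜ b ⌝ (snd (x1 ρ)) (x0 ρ))

    joinᵈ : ∀ a b → Dc {2} (JoinAt a b)
    joinᵈ a b = ((fstᶠ v1 ≡ᵈ kn 0) ×ᵈ Haltᵈ (kn ⌜ a ⌝) (sndᶠ v1) v0) ⊎ᵈ ((fstᶠ v1 ≡ᵈ kn 1) ×ᵈ Haltᵈ (kn ⌜ b ⌝) (sndᶠ v1) v0)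

  infixr 6 _∨_
  _∨_ : Code 1 → Code 1 → Code 1
  a ∨ b = enum {JoinAt a b} (joinᵈ a b)

  ∨-W : ∀ {a b n} → W (a ∨ b) n ⟺ Join (W a) (W b) n
  ∨-W {a} {b} {n} = to , from
    where
    forget : (∃ λ s → JoinAt a b (s ∷ n ∷ [])) → Join (W a) (W b) n
    forget (s , inj₁ (z , h)) = inj₁ (z , proj₁ Halt-W (s , h))
    forget (s , inj₂ (o , h)) = inj₂ (o , proj₁ Halt-W (s , h))
    find : Join (W a) (W b) n → ∃ λ s → JoinAt a b (s ∷ n ∷ [])
    find (inj₁ (z , p)) = let s , h = proj₂ Halt-W p in s , inj₁ (z , h)
    find (inj₂ (o , p)) = let s , h = proj₂ Halt-W p in s , inj₂ (o , h)
    to : W (a ∨ b) n → Join (W a) (W b) n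
    to w = forget (proj₁ (enum-spec {JoinAt a b} (joinᵈ a b)) w)
    from : Join (W a) (W b) n → W (a ∨ b) n
    from j = proj₂ (enum-spec {JoinAt a b} (joinᵈ a b)) (find j)

∨-≤Join : ∀ {a b} → W (a ∨ b) ≤ₘ Join (W a) (W b)
∨-≤Join = ⇔-≤ₘ (λ n → proj₁ ∨-W) (λ n → proj₂ ∨-W)

Join-≤∨ : ∀ {a b} → Join (W a) (W b) ≤ₘ W (a ∨ b)
Join-≤∨ = ⇔-≤ₘ (λ n → proj₂ ∨-W) (λ n → proj₁ ∨-W)

-- Below i stands for the degree of the i-th tower.

record Generic (e α : Code 1) : Set₁ where
  field
    ω     : Code 1
    Below : ℕ → ℕ → Set
  u : ℕ → Code 1
  u = Row ω
  Part : ℕ → ℕ → ℕ → Set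
  Part i c a = W α ⟨ i , ⟨ c , a ⟩ ⟩
  field
    below-zero  : Below 0 ≤ₘ W e
    base        : ∀ i → W e ≤ₘ Below i
    earlier     : ∀ {i j} → j < i → W (u j) ≤ₘ Below i
    below-suc   : ∀ i → Below (suc i) ≤ₘ Join (Below i) (W (u i))
    prime       : ∀ {i} → ¬ (K ≤ₘ Below i) → JoinPrime (W (u i))
    new         : ∀ {i} → ¬ (K ≤ₘ Below i) → ¬ (W (u i) ≤ₘ Below i)
    part        : ∀ {i} → ¬ (K ≤ₘ Below i) → ∀ c → Part i c ≤ₘ W (u i)
    meet        : ∀ {i} → ¬ (K ≤ₘ Below i) → ∀ Q → Q ≤ₘ W (u i) → Q ≤ₘ Below i → ∃ λ r → Q ≤ₘ FinJoin (Part i) r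

private
  construction : ExcludedMiddle 0ℓ → (e α : Code 1) → Generic e α
  construction em e α = record
    { ω = ω ; Below = Tower
    ; below-zero = below-zero ; base = base ; earlier = earlier ; below-suc = below-suc
    ; prime = λ inc → joinPrime-≤ in≤u u≤in (Primality.joinPrime em ē ᾱ inc)
    ; new = λ inc h → Outcome.not-below-tower em ē ᾱ inc (≤ₘ-trans in≤u h)
    ; part = λ {i} inc c → ≤ₘ-trans (⇔-≤ₘ (λ a → proj₂ (part-A i c a)) (λ a → proj₁ (part-A i c a))) (≤ₘ-trans (Outcome.column-below em ē ᾱ inc c) in≤u)
    ; meet = λ {i} inc Q q q' → let r , h = Meets.meet em ē ᾱ inc Q (≤ₘ-trans q u≤in) q' in r , ≤ₘ-trans h (columns i r)
    }
    where
    -- α knows columns and indices only, so the tag is dropped.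
    arrange : ℕ → ℕ
    arrange n = ⟨ fst n , ⟨ col (snd n) , idx (snd n) ⟩ ⟩
    arrangeᶠ : Fn {1} (λ ρ → arrange (x0 ρ))
    arrangeᶠ = ⟨ fstᶠ v0 , ⟨ fstᶠ (sndᶠ v0) , sndᶠ (sndᶠ (sndᶠ v0)) ⟩ᶠ ⟩ᶠ
    α' = preimage {arrange} α arrangeᶠ
    ē = ⌜ e ⌝
    ᾱ = ⌜ α' ⌝
    open Stages ē ᾱ
    open Verification em ē ᾱ
    memᵈ : Dc {2} (λ ρ → Mem (St (x0 ρ)) (x0 ρ) (fst (x1 ρ)) (snd (x1 ρ)))
    memᵈ = Memᵈ (Stᶠ v0) v0 (fstᶠ v1) (sndᶠ v1)
    ω = enum memᵈ
    u-in : ∀ {i n} → W (Row ω i) n ⟺ InSet i n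
    u-in {i} {n} = (λ w → subst₂ InSet fst-⟨⟩ snd-⟨⟩ (proj₁ (enum-spec memᵈ) (proj₁ Row-W w))) ,
                   (λ p → proj₂ Row-W (proj₂ (enum-spec memᵈ) (subst₂ InSet (sym fst-⟨⟩) (sym snd-⟨⟩) p)))
    in≤u : ∀ {i} → InSet i ≤ₘ W (Row ω i)
    in≤u = ⇔-≤ₘ (λ n → proj₂ u-in) (λ n → proj₁ u-in)
    u≤in : ∀ {i} → W (Row ω i) ≤ₘ InSet i
    u≤in = ⇔-≤ₘ (λ n → proj₁ u-in) (λ n → proj₂ u-in)
    A-arrange : ∀ {i k} → A i k ⟺ W α ⟨ i , ⟨ col k , idx k ⟩ ⟩
    A-arrange {i} {k} = (λ p → subst (W α) eq (proj₁ (preimage-W {arrange} {α} arrangeᶠ) (proj₁ Halt-W p))) ,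
                        (λ w → proj₂ Halt-W (proj₂ (preimage-W {arrange} {α} arrangeᶠ) (subst (W α) (sym eq) w)))
      where
      eq : arrange ⟨ i , k ⟩ ≡ ⟨ i , ⟨ col k , idx k ⟩ ⟩
      eq = cong₂ ⟨_,_⟩ fst-⟨⟩ (cong (λ k → ⟨ col k , idx k ⟩) snd-⟨⟩)
    part-A : ∀ i c a → A i (elt c 0 a) ⟺ W α ⟨ i , ⟨ c , a ⟩ ⟩
    part-A i c a = subst₂ (λ c' a' → A i (elt c 0 a) ⟺ W α ⟨ i , ⟨ c' , a' ⟩ ⟩) col-elt idx-elt A-arrange
    columns : ∀ i r → Meets.Columns em ē ᾱ {i} r ≤ₘ FinJoin (λ c a → W α ⟨ i , ⟨ c , a ⟩ ⟩) r
    columns i r = ≤ₘ-trans (⇔-≤ₘ (λ k (le , t , p) → (le , p) , t) (λ k ((le , p) , t) → le , t , p))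
      (piece {Q = λ k → col k ≤ r × A i k} (fstᶠ (sndᶠ v0) ≡ᵈ kn 0) (sucᶠ (sucᶠ ⟨ fstᶠ v0 , sndᶠ (sndᶠ v0) ⟩ᶠ))
        (λ k _ → (λ { (le , p) → subst (_≤ r) (sym fst-⟨⟩) le , subst₂ (λ c a → W α ⟨ i , ⟨ c , a ⟩ ⟩) (sym fst-⟨⟩) (sym snd-⟨⟩) (proj₁ A-arrange p) }) ,
                 (λ { (le , w) → subst (_≤ r) fst-⟨⟩ le , proj₂ A-arrange (subst₂ (λ c a → W α ⟨ i , ⟨ c , a ⟩ ⟩) fst-⟨⟩ snd-⟨⟩ w) })))
    base : ∀ i → W e ≤ₘ Tower i
    base i = reduction (sucᶠ (sucᶠ ⟨ kn 0 , v0 ⟩ᶠ)) (λ n w → inj₁ (fst-⟨⟩ , let s , h = proj₂ Halt-W w in s , subst (λ x → Halt ē x s) (sym snd-⟨⟩) h)) from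
      where
      from : ∀ n → Tower i ⟨ 0 , n ⟩ → W e n
      from n (inj₁ (_ , s , h)) = proj₁ Halt-W (s , subst (λ x → Halt ē x s) snd-⟨⟩ h)
      from n (inj₂ (j , _ , o , _)) = ⊥-elim (0≢1+n (trans (sym fst-⟨⟩) o))
    earlier : ∀ {i j} → j < i → W (Row ω j) ≤ₘ Tower i
    earlier {i} {j} lt = ≤ₘ-trans u≤in (reduction (sucᶠ (sucᶠ ⟨ kn (suc j) , v0 ⟩ᶠ)) (λ n p → inj₂ (j , lt , fst-⟨⟩ , subst (InSet j) (sym snd-⟨⟩) p)) from)
      where
      from : ∀ n → Tower i ⟨ suc j , n ⟩ → InSet j n
      from n (inj₁ (z , _)) = ⊥-elim (0≢1+n (trans (sym z) fst-⟨⟩))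
      from n (inj₂ (j' , _ , o , p)) with trans (sym fst-⟨⟩) o
      ... | refl = subst (InSet j) snd-⟨⟩ p
    below-zero : Tower 0 ≤ₘ W e
    below-zero = ≤ₘ-trans (⇔-≤ₘ to from) (piece {Q = λ w → ∃ λ s → Halt ē (snd w) s} (fstᶠ v0 ≡ᵈ kn 0) (sucᶠ (sucᶠ (sndᶠ v0)))
        (λ n _ → proj₁ Halt-W , proj₂ Halt-W))
      where
      to : ∀ w → Tower 0 w → (∃ λ s → Halt ē (snd w) s) × fst w ≡ 0
      to w (inj₁ (z , h)) = h , z
      from : ∀ w → (∃ λ s → Halt ē (snd w) s) × fst w ≡ 0 → Tower 0 w
      from w (h , z) = inj₁ (z , h)
    below-suc : ∀ i → Tower (suc i) ≤ₘ Join (Tower i) (W (Row ω i))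
    below-suc i = glue {P = λ ρ → fst (x0 ρ) ≡ suc i} (fstᶠ v0 ≡ᵈ kn (suc i))
        (≤ₘ-trans (≤ₘ-trans (piece {X = InSet i} (fstᶠ v0 ≡ᵈ kn (suc i)) (sucᶠ (sucᶠ (sndᶠ v0))) top) in≤u) (join-ʳ {Tower i} {W (Row ω i)}))
        (≤ₘ-trans (piece {X = Tower i} (¬ᵈ (fstᶠ v0 ≡ᵈ kn (suc i))) (sucᶠ (sucᶠ v0)) rest) (join-ˡ {Tower i} {W (Row ω i)}))
      where
      top : ∀ w → fst w ≡ suc i → Tower (suc i) w ⟺ InSet i (snd w)
      top w e = to , (λ p → inj₂ (i , ≤-refl , e , p))
        where
        to : Tower (suc i) w → InSet i (snd w)
        to (inj₁ (z , _)) = ⊥-elim (0≢1+n (trans (sym z) e))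
        to (inj₂ (j , _ , o , p)) with trans (sym e) o
        ... | refl = p
      rest : ∀ w → fst w ≢ suc i → Tower (suc i) w ⟺ Tower i w
      rest w ne = to , from
        where
        to : Tower (suc i) w → Tower i w
        to (inj₁ h) = inj₁ h
        to (inj₂ (j , s≤s le , o , p)) = inj₂ (j , ≤∧≢⇒< le (λ { refl → ne o }) , o , p)
        from : Tower i w → Tower (suc i) w
        from (inj₁ h) = inj₁ h
        from (inj₂ (j , lt , o , p)) = inj₂ (j , ≤-trans lt (n≤1+n i) , o , p)

opaque
  generic : ExcludedMiddle 0ℓ → (e α : Code 1) → Generic e α
  generic = construction

opaque
  𝟎 : Code 1
  𝟎 = enum {P = λ _ → ⊥} falseᵈ

  𝟎-W : ∀ {n} → ¬ W 𝟎 n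
  𝟎-W w = proj₂ (proj₁ (enum-spec {P = λ _ → ⊥} falseᵈ) w)

𝟎≤∅ : W 𝟎 ≤ₘ ∅
𝟎≤∅ = ⇔-≤ₘ (λ n → 𝟎-W) (λ n ())

Incomplete NonZero : Code 1 → Set
Incomplete a = ¬ (K ≤ₘ W a)
NonZero a = ¬ (W a ≤ₘ ∅)

∨-upperˡ : ∀ {a b} → W a ≤ₘ W (a ∨ b)
∨-upperˡ {a} {b} = ≤ₘ-trans {W a} {Join (W a) (W b)} join-ˡ Join-≤∨

∨-upperʳ : ∀ {a b} → W b ≤ₘ W (a ∨ b)
∨-upperʳ {a} {b} = ≤ₘ-trans {W b} {Join (W a) (W b)} join-ʳ Join-≤∨

∨-lub : ∀ {a b} {Z : ℕ → Set} → W a ≤ₘ Z → W b ≤ₘ Z → W (a ∨ b) ≤ₘ Z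
∨-lub {a} {b} {Z} p q = ≤ₘ-trans {W (a ∨ b)} {Join (W a) (W b)} {Z} ∨-≤Join (join-lub p q)

-- Prime degrees over an incomplete base

module Degrees (em : ExcludedMiddle 0ℓ) (K≰∅ : ¬ (K ≤ₘ ∅)) where

  -- Take `K` as a column over the base `𝟎`: the resulting prime is c.e. and bounds `K`, so it has
  -- the degree of `K`.
  K-prime : JoinPrime K
  K-prime = joinPrime-≤ (K-top (G.u 0))
      (≤ₘ-trans {K} {G.Part 0 0} (⇔-≤ₘ (λ n k → proj₂ α-row (subst K (sym eq) k)) (λ n p → subst K eq (proj₁ α-row p))) (G.part inc 0))
      (G.prime inc)
    where
    second : Fn {1} (λ ρ → snd (snd (x0 ρ)))
    second = sndᶠ (sndᶠ v0)
    α = preimage {λ n → snd (snd n)} universal second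
    module G = Generic (generic em 𝟎 α)
    α-row : ∀ {n} → W α n ⟺ K (snd (snd n))
    α-row = preimage-W {λ n → snd (snd n)} {universal} second
    eq : ∀ {n} → snd (snd ⟨ 0 , ⟨ 0 , n ⟩ ⟩) ≡ n
    eq = trans (cong snd snd-⟨⟩) snd-⟨⟩
    inc : ¬ (K ≤ₘ G.Below 0)
    inc h = K≰∅ (≤ₘ-trans h (≤ₘ-trans G.below-zero 𝟎≤∅))

  ∨-incomplete : ∀ {a b} → Incomplete a → Incomplete b → Incomplete (a ∨ b)
  ∨-incomplete {a} {b} p q h = [ p , q ]′ (K-prime (W a) (W b) (≤ₘ-trans h ∨-≤Join))

  record Hull (E ω : Code 1) : Set₁ where
    field
      hull    : Code 1
      prime   : JoinPrime (W hull)
      new     : ¬ (W hull ≤ₘ W E)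
      row≤    : ∀ c → W (Row ω c) ≤ₘ W hull
      meet    : ∀ Q → Q ≤ₘ W hull → Q ≤ₘ W E → ∃ λ r → Q ≤ₘ FinJoin (λ c → W (Row ω c)) r

  hullOf : ∀ {E} ω → Incomplete E → Hull E ω
  hullOf {E} ω incE = record
    { hull = G.u 0 ; prime = G.prime inc
    ; new = λ h → G.new inc (≤ₘ-trans h (G.base 0))
    ; row≤ = λ c → ≤ₘ-trans (⇔-≤ₘ (λ n w → proj₂ same w) (λ n p → proj₁ same p)) (G.part inc c)
    ; meet = λ Q q q' → let r , h = G.meet inc Q q (≤ₘ-trans q' (G.base 0)) in r , ≤ₘ-trans h
        (⇔-≤ₘ (λ n → λ { (le , p) → le , proj₁ same p }) (λ n → λ { (le , p) → le , proj₂ same p })) }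
    where
    -- Dropping i makes the rows of ω the columns of each generic set; the set with index 0 serves
    -- as the hull.
    α = preimage {snd} ω (sndᶠ v0)
    module G = Generic (generic em E α)
    inc : ¬ (K ≤ₘ G.Below 0)
    inc h = incE (≤ₘ-trans h G.below-zero)
    same : ∀ {c a} → W α ⟨ 0 , ⟨ c , a ⟩ ⟩ ⟺ W (Row ω c) a
    same {c} {a} = (λ p → proj₂ Row-W (subst (W ω) snd-⟨⟩ (proj₁ (preimage-W {snd} {ω} (sndᶠ v0)) p))) ,
                   (λ p → proj₂ (preimage-W {snd} {ω} (sndᶠ v0)) (subst (W ω) (sym snd-⟨⟩) (proj₁ Row-W p)))

  record Hull₁ (E a : Code 1) : Set₁ where
    field
      hull  : Code 1
      prime : JoinPrime (W hull)
      above : W a ≤ₘ W hull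
      meet  : ∀ Q → Q ≤ₘ W hull → Q ≤ₘ W E → Q ≤ₘ W a

  hull₁Of : ∀ {E} a → Incomplete E → Hull₁ E a
  hull₁Of {E} a incE = record
    { hull = H.hull ; prime = H.prime
    ; above = ≤ₘ-trans (⇔-≤ₘ (λ n → proj₂ same) (λ n → proj₁ same)) (H.row≤ 0)
    ; meet = λ Q q q' → let r , h = H.meet Q q q' in ≤ₘ-trans h (finJoin-lub r (λ c _ → ⇔-≤ₘ (λ n → proj₁ same) (λ n → proj₂ same))) }
    where
    -- All rows equal a, so that a finite join of rows collapses to a.
    α = preimage {snd} a (sndᶠ v0)
    module H = Hull (hullOf {E} α incE)
    same : ∀ {c n} → W (Row α c) n ⟺ W a n
    same = (λ p → subst (W a) snd-⟨⟩ (proj₁ (preimage-W {snd} {a} (sndᶠ v0)) (proj₁ Row-W p))) ,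
           (λ p → proj₂ Row-W (proj₂ (preimage-W {snd} {a} (sndᶠ v0)) (subst (W a) (sym snd-⟨⟩) p)))

  record Independent (E : Code 1) : Set₁ where
    field
      ω          : Code 1
      Below      : ℕ → ℕ → Set
      base       : ∀ i → W E ≤ₘ Below i
      earlier    : ∀ {i j} → j < i → W (Row ω j) ≤ₘ Below i
      incomplete : ∀ i → ¬ (K ≤ₘ Below i)
      prime      : ∀ i → JoinPrime (W (Row ω i))
      new        : ∀ i → ¬ (W (Row ω i) ≤ₘ Below i)
      meet       : ∀ i Q → Q ≤ₘ W (Row ω i) → Q ≤ₘ Below i → Q ≤ₘ ∅

    incomparable : ∀ {i j} → W (Row ω i) ≤ₘ W (Row ω j) → i ≡ j
    incomparable {i} {j} h with <-cmp i j
    ... | tri≈ _ e _ = e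
    ... | tri> _ _ gt = ⊥-elim (new i (≤ₘ-trans h (earlier gt)))
    ... | tri< lt _ _ = ⊥-elim (new i (≤ₘ-trans (meet j _ h (earlier lt)) ∅-least))

  -- With empty columns each new prime meets its tower in zero. If the next tower were complete,
  -- primality of `K` would make the new prime complete; then E would lie below both it and the
  -- tower, and be zero.
  independent : ∀ {E} → Incomplete E → NonZero E → Independent E
  independent {E} incE nz = record
    { ω = G.ω ; Below = G.Below ; base = G.base ; earlier = G.earlier ; incomplete = inc
    ; prime = λ i → G.prime (inc i) ; new = λ i → G.new (inc i) ; meet = λ i → meet (inc i) }
    where
    module G = Generic (generic em E 𝟎)
    meet : ∀ {i} → ¬ (K ≤ₘ G.Below i) → ∀ Q → Q ≤ₘ W (G.u i) → Q ≤ₘ G.Below i → Q ≤ₘ ∅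
    meet inc Q q q' = let r , h = G.meet inc Q q q' in ≤ₘ-trans h (⇔-≤ₘ (λ n → λ { (_ , w) → 𝟎-W w }) (λ n ()))
    inc : ∀ i → ¬ (K ≤ₘ G.Below i)
    inc zero h = incE (≤ₘ-trans h G.below-zero)
    inc (suc i) h = [ inc i , (λ h' → nz (meet (inc i) (W E) (≤ₘ-trans (K-top E) h') (G.base i))) ]′
      (K-prime (G.Below i) (W (G.u i)) (≤ₘ-trans h (G.below-suc i)))

-- The rows of ξ run through all degrees below e.  An element ⟨ m , ⟨ v , s ⟩ ⟩ of row i carries a certificate that the i-th function
-- takes the value v at m; this keeps every row below e although the i-th function may be partial.

module Numbering (e : Code 1) where

  private
    Cert : ℕ → ℕ → Set
    Cert i y = Comp i (fst y) (fst (snd y)) (snd (snd y))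

    EVal : ℕ → ℕ → Set
    EVal v s = v ≡ 1 ⊎ (1 < v × Halt ⌜ e ⌝ (v ∸ 2) s)

    EnumAt : Vec ℕ 2 → Set
    EnumAt ρ = Cert (fst (x1 ρ)) (snd (x1 ρ)) × EVal (fst (snd (snd (x1 ρ)))) (x0 ρ)

    certᵈ : ∀ {n} {f g : Vec ℕ n → ℕ} → Fn f → Fn g → Dc (λ ρ → Cert (f ρ) (g ρ))
    certᵈ F G = Compᵈ F (fstᶠ G) (fstᶠ (sndᶠ G)) (sndᶠ (sndᶠ G))

    enumᵈ : Dc EnumAt
    enumᵈ = certᵈ (fstᶠ v1) (sndᶠ v1) ×ᵈ ((fstᶠ (sndᶠ (sndᶠ v1)) ≡ᵈ kn 1) ⊎ᵈ
      ((kn 1 <ᵈ fstᶠ (sndᶠ (sndᶠ v1))) ×ᵈ Haltᵈ (kn ⌜ e ⌝) (fstᶠ (sndᶠ (sndᶠ v1)) ∸ᶠ kn 2) v0))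

    eval⟺ : ∀ v → (∃ λ s → EVal v s) ⟺ interp (W e) v
    eval⟺ zero = (λ { (s , inj₁ ()) ; (s , inj₂ (() , _)) }) , λ ()
    eval⟺ (suc zero) = (λ _ → tt) , (λ _ → 0 , inj₁ refl)
    eval⟺ (suc (suc w)) = (λ { (s , inj₁ ()) ; (s , inj₂ (_ , h)) → proj₁ Halt-W (s , h) }) ,
                          (λ p → let s , h = proj₂ Halt-W p in s , inj₂ (s≤s (s≤s z≤n) , h))

  opaque
    ξ : Code 1
    ξ = enum enumᵈ

    ξ-row : ∀ {i y} → W (Row ξ i) y ⟺ (interp (W e) (fst (snd y)) × Cert i y)
    ξ-row {i} {y} = (λ w → unstage (proj₁ (enum-spec enumᵈ) (proj₁ Row-W w))) , (λ p → proj₂ Row-W (proj₂ (enum-spec enumᵈ) (stage p)))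
      where
      unstage : (∃ λ s → EnumAt (s ∷ ⟨ i , y ⟩ ∷ [])) → interp (W e) (fst (snd y)) × Cert i y
      unstage (s , c , v) = subst (λ y → interp (W e) (fst (snd y))) snd-⟨⟩ (proj₁ (eval⟺ _) (s , v)) , subst₂ Cert fst-⟨⟩ snd-⟨⟩ c
      stage : interp (W e) (fst (snd y)) × Cert i y → ∃ λ s → EnumAt (s ∷ ⟨ i , y ⟩ ∷ [])
      stage (p , c) = let s , h = proj₂ (eval⟺ (fst (snd y))) p in
        s , subst₂ Cert (sym fst-⟨⟩) (sym snd-⟨⟩) c , subst (λ y → EVal (fst (snd y)) s) (sym snd-⟨⟩) h

    ξ≤ : ∀ i → W (Row ξ i) ≤ₘ W e
    ξ≤ i = ≤ₘ-trans (⇔-≤ₘ (λ y → proj₁ ξ-row) (λ y → proj₂ ξ-row))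
      (piece {Q = λ y → interp (W e) (fst (snd y))} (certᵈ (kn i) v0) (fstᶠ (sndᶠ v0)) (λ y _ → (λ p → p) , (λ p → p)))

    -- The row is that of the code of the given reduction: from n one searches for a certificate,
    -- and a certificate reveals its n.
    ξ-onto : ∀ {a} → a ≤R e → ∃ λ i → a ≡R Row ξ i
    ξ-onto {a} (f , h) = ⌜ f ⌝ , a≤ , ≤a
      where
      F : ℕ → ℕ
      F n = proj₁ (h n)
      correct : ∀ {n v s} → Comp ⌜ f ⌝ n v s → W a n ⟺ interp (W e) v
      correct {n} {v} {s} c = (λ w → subst (interp (W e)) v≡ (Equivalence.to (proj₂ (proj₂ (h n))) w)) ,
                              (λ p → Equivalence.from (proj₂ (proj₂ (h n))) (subst (interp (W e)) (sym v≡) p))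
        where
        v≡ : F n ≡ v
        v≡ = deterministic (proj₁ (proj₂ (h n))) (Comp-sound c)
      searchᵈ : Dc {2} (λ ρ → fst (x0 ρ) ≡ x1 ρ × Cert ⌜ f ⌝ (x0 ρ))
      searchᵈ = (fstᶠ v0 ≡ᵈ v1) ×ᵈ certᵈ (kn ⌜ f ⌝) v0
      total : ∀ n → ∃ λ y → fst y ≡ n × Cert ⌜ f ⌝ y
      total n = let s , c = Comp-complete (proj₁ (proj₂ (h n))) in ⟨ n , ⟨ F n , s ⟩ ⟩ , fst-⟨⟩ ,
        subst₂ (λ m z → Comp ⌜ f ⌝ m (fst z) (snd z)) (sym fst-⟨⟩) (sym snd-⟨⟩)
          (subst₂ (Comp ⌜ f ⌝ n) (sym fst-⟨⟩) (sym snd-⟨⟩) c)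
      a≤ : a ≤R Row ξ ⌜ f ⌝
      a≤ = search-reduction searchᵈ (sucᶠ (sucᶠ v0)) total (λ { n y (refl , c) →
        (λ w → proj₂ ξ-row (proj₁ (correct c) w , c)) , (λ w → proj₂ (correct c) (proj₁ (proj₁ ξ-row w))) })
      ≤a : Row ξ ⌜ f ⌝ ≤R a
      ≤a = ≤ₘ-trans (⇔-≤ₘ (λ y → proj₁ ξ-row) (λ y → proj₂ ξ-row))
        (piece {Q = λ y → interp (W e) (fst (snd y))} {X = W a} (certᵈ (kn ⌜ f ⌝) v0) (sucᶠ (sucᶠ (fstᶠ v0)))
          (λ y c → proj₂ (correct c) , proj₁ (correct c)))

-- The first-order properties used in the definition

-- The language has no join symbol; z ≤ x ∨ y is expressed through all upper bounds of x and y.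
Prime : Code 1 → Set
Prime z = ∀ x y → (∀ m → x ≤R m → y ≤R m → z ≤R m) → (z ≤R x) ⊎ (z ≤R y)

MaxPrime : (c d a : Code 1) → Set
MaxPrime c d a = Prime a × (a ≤R c) × (a ≤R d) × (∀ z → Prime z → z ≤R c → z ≤R d → a ≤R z → z ≤R a)

Meet : (e a x : Code 1) → Set
Meet e a x = (x ≤R e) × (x ≤R a) × (∀ q → q ≤R e → q ≤R a → q ≤R x)

Before : (b a a' : Code 1) → Set
Before b a a' = ∀ q → q ≤R b → q ≤R a → q ≤R a'

prime : ∀ {z} → JoinPrime (W z) → Prime z
prime {z} jp x y h = jp (W x) (W y) (≤ₘ-trans (h (x ∨ y) ∨-upperˡ ∨-upperʳ) ∨-≤Join)

finJoin : (ℕ → Code 1) → ℕ → Code 1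
finJoin f zero = f zero
finJoin f (suc r) = finJoin f r ∨ f (suc r)

finJoin-≥ : ∀ {f} r {c} → c ≤ r → f c ≤R finJoin f r
finJoin-≥ zero z≤n = ≤ₘ-refl
finJoin-≥ {f} (suc r) {c} le = [ (λ { (s≤s lt) → ≤ₘ-trans (finJoin-≥ {f} r lt) ∨-upperˡ }) , (λ { refl → ∨-upperʳ }) ]′ (m≤n⇒m<n∨m≡n le)

finJoin-≤ : ∀ {f} r {Z : ℕ → Set} → (∀ c → c ≤ r → W (f c) ≤ₘ Z) → W (finJoin f r) ≤ₘ Z
finJoin-≤ zero h = h 0 z≤n
finJoin-≤ {f} (suc r) h = ∨-lub {finJoin f r} {f (suc r)} (finJoin-≤ {f} r (λ c le → h c (≤-trans le (n≤1+n r)))) (h (suc r) ≤-refl)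

prime-finJoin : ∀ {f z} r → Prime z → z ≤R finJoin f r → ∃ λ c → c ≤ r × (z ≤R f c)
prime-finJoin zero p h = 0 , z≤n , h
prime-finJoin {f} {z} (suc r) p h = [ (λ q → let c , le , q' = prime-finJoin {f} r p q in c , ≤-trans le (n≤1+n r) , q') , (λ q → suc r , ≤-refl , q) ]′
  (p (finJoin f r) (f (suc r)) (λ m a b → ≤ₘ-trans h (∨-lub {finJoin f r} {f (suc r)} {W m} a b)))

-- The degrees β, γ, δ and the primes u i

module Structure (em : ExcludedMiddle 0ℓ) (K≰∅ : ¬ (K ≤ₘ ∅)) (e : Code 1) (incE : Incomplete e) (nzE : NonZero e) where

  open Degrees em K≰∅
  open Numbering e public

  module B = Independent (independent incE nzE)

  b : ℕ → Code 1
  b = Row B.ω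

  module β-hull = Hull (hullOf {e} B.ω incE)

  β : Code 1
  β = β-hull.hull

  b≤β : ∀ c → b c ≤R β
  b≤β = β-hull.row≤

  -- A common part splits into pieces below single `b c`, and each `b c` meets its tower, which
  -- contains e, in zero.
  e∧β : ∀ Q → Q ≤ₘ W e → Q ≤ₘ W β → Q ≤ₘ ∅
  e∧β Q q q' = let r , h = β-hull.meet Q q' q in
    finJoin-split {Q} {∅} {λ c → W (b c)} r h (λ c _ Q' p p' → B.meet c Q' p' (≤ₘ-trans p (≤ₘ-trans q (B.base c))))

  incβ : Incomplete β
  incβ h = nzE (e∧β (W e) ≤ₘ-refl (≤ₘ-trans (K-top e) h))

  private
    PartAt : Vec ℕ 2 → Set
    PartAt ρ = (fst (snd (x1 ρ)) ≡ 0 × Halt ⌜ ξ ⌝ ⟨ fst (x1 ρ) , snd (snd (x1 ρ)) ⟩ (x0 ρ)) ⊎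
               (0 < fst (snd (x1 ρ)) × fst (snd (x1 ρ)) ≤ suc (fst (x1 ρ)) × Halt ⌜ B.ω ⌝ ⟨ fst (snd (x1 ρ)) ∸ 1 , snd (snd (x1 ρ)) ⟩ (x0 ρ))

    partᵈ : Dc PartAt
    partᵈ = ((fstᶠ (sndᶠ v1) ≡ᵈ kn 0) ×ᵈ Haltᵈ (kn ⌜ ξ ⌝) ⟨ fstᶠ v1 , sndᶠ (sndᶠ v1) ⟩ᶠ v0) ⊎ᵈ
            ((kn 0 <ᵈ fstᶠ (sndᶠ v1)) ×ᵈ (fstᶠ (sndᶠ v1) ≤ᵈ sucᶠ (fstᶠ v1)) ×ᵈ
             Haltᵈ (kn ⌜ B.ω ⌝) ⟨ fstᶠ (sndᶠ v1) ∸ᶠ kn 1 , sndᶠ (sndᶠ v1) ⟩ᶠ v0)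

    -- Column 0 determines the meet of `u i` with e; the columns `b 0` to `b i` determine what it
    -- shares with β, from which its position is read off.
    Part : ℕ → ℕ → ℕ → Set
    Part i zero a = W (Row ξ i) a
    Part i (suc c) a = c ≤ i × W (b c) a

  opaque
    α : Code 1
    α = enum partᵈ

    private
      α-part : ∀ {i} c {a} → W α ⟨ i , ⟨ c , a ⟩ ⟩ ⟺ Part i c a
      α-part {i} c {a} = (λ w → to c (simplify (proj₁ (enum-spec partᵈ) w))) , (λ p → proj₂ (enum-spec partᵈ) (unsimplify (from c p)))
        where
        e₁ : fst (snd ⟨ i , ⟨ c , a ⟩ ⟩) ≡ c
        e₁ = trans (cong fst snd-⟨⟩) fst-⟨⟩
        e₂ : snd (snd ⟨ i , ⟨ c , a ⟩ ⟩) ≡ a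
        e₂ = trans (cong snd snd-⟨⟩) snd-⟨⟩
        Raw : ℕ → ℕ → ℕ → Set
        Raw i c a = ∃ λ s → (c ≡ 0 × Halt ⌜ ξ ⌝ ⟨ i , a ⟩ s) ⊎ (0 < c × c ≤ suc i × Halt ⌜ B.ω ⌝ ⟨ c ∸ 1 , a ⟩ s)
        simplify : (∃ λ s → PartAt (s ∷ ⟨ i , ⟨ c , a ⟩ ⟩ ∷ [])) → Raw i c a
        simplify h = subst (λ i → Raw i c a) fst-⟨⟩ (subst₂ (Raw (fst ⟨ i , ⟨ c , a ⟩ ⟩)) e₁ e₂ h)
        unsimplify : Raw i c a → ∃ λ s → PartAt (s ∷ ⟨ i , ⟨ c , a ⟩ ⟩ ∷ [])
        unsimplify h = subst₂ (Raw (fst ⟨ i , ⟨ c , a ⟩ ⟩)) (sym e₁) (sym e₂) (subst (λ i → Raw i c a) (sym fst-⟨⟩) h)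
        to : ∀ c → Raw i c a → Part i c a
        to zero (s , inj₁ (_ , h)) = proj₂ Row-W (proj₁ Halt-W (s , h))
        to zero (s , inj₂ (() , _))
        to (suc c) (s , inj₁ (() , _))
        to (suc c) (s , inj₂ (_ , s≤s le , h)) = le , proj₂ Row-W (proj₁ Halt-W (s , h))
        from : ∀ c → Part i c a → Raw i c a
        from zero p = let s , h = proj₂ Halt-W (proj₁ Row-W p) in s , inj₁ (refl , h)
        from (suc c) (le , p) = let s , h = proj₂ Halt-W (proj₁ Row-W p) in s , inj₂ (s≤s z≤n , s≤s le , h)

    part-zero : ∀ {i} → W (Row ξ i) ≤ₘ (λ a → W α ⟨ i , ⟨ 0 , a ⟩ ⟩)
    part-zero = ⇔-≤ₘ (λ n → proj₂ (α-part 0)) (λ n → proj₁ (α-part 0))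

    part-zero⁻ : ∀ {i} → (λ a → W α ⟨ i , ⟨ 0 , a ⟩ ⟩) ≤ₘ W (Row ξ i)
    part-zero⁻ = ⇔-≤ₘ (λ n → proj₁ (α-part 0)) (λ n → proj₂ (α-part 0))

    part-suc : ∀ {i c} → c ≤ i → W (b c) ≤ₘ (λ a → W α ⟨ i , ⟨ suc c , a ⟩ ⟩)
    part-suc {i} {c} le = ⇔-≤ₘ (λ n p → proj₂ (α-part (suc c)) (le , p)) (λ n w → proj₂ (proj₁ (α-part (suc c)) w))

    part-suc⁻ : ∀ {i c} → c ≤ i → (λ a → W α ⟨ i , ⟨ suc c , a ⟩ ⟩) ≤ₘ W (b c)
    part-suc⁻ {i} {c} le = ⇔-≤ₘ (λ n w → proj₂ (proj₁ (α-part (suc c)) w)) (λ n p → proj₂ (α-part (suc c)) (le , p))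

    part-empty : ∀ {i c} → i < c → (λ a → W α ⟨ i , ⟨ suc c , a ⟩ ⟩) ≤ₘ ∅
    part-empty {i} {c} lt = ⇔-≤ₘ (λ n w → <⇒≱ lt (proj₁ (proj₁ (α-part (suc c)) w))) (λ n ())

  x : ℕ → Code 1
  x = Row ξ

  module U = Generic (generic em (e ∨ β) α)

  u : ℕ → Code 1
  u = U.u

  parts-≤ : ∀ {i} {Z : ℕ → Set} r → W (x i) ≤ₘ Z → (∀ c → c ≤ i → W (b c) ≤ₘ Z) → FinJoin (U.Part i) r ≤ₘ Z
  parts-≤ {i} {Z} r h h' = finJoin-lub {Z} {U.Part i} r λ c _ → each c
    where
    each : ∀ c → U.Part i c ≤ₘ Z
    each zero = ≤ₘ-trans {U.Part i 0} {W (x i)} {Z} part-zero⁻ h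
    each (suc c) = [ (λ le → ≤ₘ-trans {U.Part i (suc c)} {W (b c)} {Z} (part-suc⁻ le) (h' c le)) ,
                     (λ lt → ≤ₘ-trans {U.Part i (suc c)} {∅} {Z} (part-empty lt) ∅-least) ]′ (≤-<-connex c i)

  parts-≤B : ∀ {i} r {j} → i < j → FinJoin (U.Part i) r ≤ₘ B.Below j
  parts-≤B {i} r {j} lt = parts-≤ r (≤ₘ-trans {W (x i)} {W e} (ξ≤ i) (B.base j)) (λ c le → B.earlier (≤-<-trans le lt))

  -- A complete `u i` would bound β, which lies in its tower; β would then be below the columns of
  -- `u i`, although `b (suc i)` is new over these.
  incU : ∀ i → ¬ (K ≤ₘ U.Below i)
  incU zero h = ∨-incomplete incE incβ (≤ₘ-trans h U.below-zero)
  incU (suc i) h = [ incU i , (λ h' → contradict h') ]′ (K-prime (U.Below i) (W (u i)) (≤ₘ-trans h (U.below-suc i)))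
    where
    contradict : ¬ (K ≤ₘ W (u i))
    contradict h' = let r , q = U.meet (incU i) (W β) (≤ₘ-trans (K-top β) h') (≤ₘ-trans ∨-upperʳ (U.base i)) in
      B.new (suc i) (≤ₘ-trans (b≤β (suc i)) (≤ₘ-trans q (parts-≤B r ≤-refl)))

  e≤Below : ∀ i → W e ≤ₘ U.Below i
  e≤Below i = ≤ₘ-trans {W e} {W (e ∨ β)} ∨-upperˡ (U.base i)

  β≤Below : ∀ i → W β ≤ₘ U.Below i
  β≤Below i = ≤ₘ-trans {W β} {W (e ∨ β)} ∨-upperʳ (U.base i)

  u-prime : ∀ i → JoinPrime (W (u i))
  u-prime i = U.prime (incU i)

  x≤u : ∀ i → x i ≤R u i
  x≤u i = ≤ₘ-trans {W (x i)} {U.Part i 0} {W (u i)} part-zero (U.part (incU i) 0)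

  b≤u : ∀ {i c} → c ≤ i → b c ≤R u i
  b≤u {i} {c} le = ≤ₘ-trans {W (b c)} {U.Part i (suc c)} {W (u i)} (part-suc le) (U.part (incU i) (suc c))

  u-nonzero : ∀ i → NonZero (u i)
  u-nonzero i h = U.new (incU i) (≤ₘ-trans h ∅-least)

  -- For i < j, `u i` lies in the tower of `u j`. If it were below `u j` it would be below the
  -- columns, hence below e ∨ β, and so below its own tower.
  u-antichain : ∀ {i j} → u i ≤R u j → i ≡ j
  u-antichain {i} {j} h with <-cmp i j
  ... | tri≈ _ e _ = e
  ... | tri> _ _ gt = ⊥-elim (U.new (incU i) (≤ₘ-trans h (U.earlier gt)))
  ... | tri< lt _ _ = ⊥-elim (U.new (incU i) (let r , q = U.meet (incU j) (W (u i)) h (U.earlier lt) in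
          ≤ₘ-trans q (parts-≤ r (≤ₘ-trans {W (x j)} {W e} (ξ≤ j) (e≤Below i)) (λ c _ → ≤ₘ-trans {W (b c)} {W β} (b≤β c) (β≤Below i)))))

  u-meet-e : ∀ i → Meet e (u i) (x i)
  u-meet-e i = ξ≤ i , x≤u i , λ q q≤e q≤u → let r , h = U.meet (incU i) (W q) q≤u (≤ₘ-trans q≤e (e≤Below i)) in
    finJoin-split {W q} {W (x i)} {U.Part i} r h (λ c _ Q Q≤q Q≤ → each q≤e c Q Q≤q Q≤)
    where
    each : ∀ {q} → q ≤R e → ∀ c Q → Q ≤ₘ W q → Q ≤ₘ U.Part i c → Q ≤ₘ W (x i)
    each q≤e zero Q _ h = ≤ₘ-trans {Q} {U.Part i 0} h part-zero⁻
    each {q} q≤e (suc c) Q Q≤q h = [ (λ le → ≤ₘ-trans {Q} {∅} (e∧β Q (≤ₘ-trans {Q} {W q} Q≤q q≤e)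
                                       (≤ₘ-trans {Q} {W (b c)} (≤ₘ-trans {Q} {U.Part i (suc c)} h (part-suc⁻ le)) (b≤β c))) ∅-least) ,
                                     (λ lt → ≤ₘ-trans {Q} {∅} (≤ₘ-trans {Q} {U.Part i (suc c)} h (part-empty lt)) ∅-least) ]′ (≤-<-connex c i)

  before : ∀ {i j} → i ≤ j → Before β (u i) (u j)
  before {i} {j} le q q≤β q≤u = let r , h = U.meet (incU i) (W q) q≤u (≤ₘ-trans q≤β (β≤Below i)) in
    finJoin-split {W q} {W (u j)} {U.Part i} r h each
    where
    each : ∀ c → c ≤ _ → ∀ Q → Q ≤ₘ W q → Q ≤ₘ U.Part i c → Q ≤ₘ W (u j)
    each zero _ Q Q≤q h = ≤ₘ-trans {Q} {∅} (e∧β Q (≤ₘ-trans {Q} {W (x i)} (≤ₘ-trans {Q} {U.Part i 0} h part-zero⁻) (ξ≤ i)) (≤ₘ-trans {Q} {W q} Q≤q q≤β)) ∅-least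
    each (suc c) _ Q _ h = [ (λ le' → ≤ₘ-trans {Q} {W (b c)} (≤ₘ-trans {Q} {U.Part i (suc c)} h (part-suc⁻ le')) (b≤u (≤-trans le' le))) ,
                             (λ lt → ≤ₘ-trans {Q} {∅} (≤ₘ-trans {Q} {U.Part i (suc c)} h (part-empty lt)) ∅-least) ]′ (≤-<-connex c i)

  -- The witness is `b i`: below β and `u i`, but for j < i not below `u j`, whose columns all lie
  -- in the tower of `b i`.
  before⁻ : ∀ {i j} → Before β (u i) (u j) → i ≤ j
  before⁻ {i} {j} h = ≮⇒≥ λ j<i → let r , q = U.meet (incU j) (W (b i)) (h (b i) (b≤β i) (b≤u ≤-refl)) (≤ₘ-trans {W (b i)} {W β} (b≤β i) (β≤Below j)) in
    B.new i (≤ₘ-trans q (parts-≤B r j<i))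

  -- γ and δ are an exact pair for the ideal generated by the u i.
  module γ-hull = Hull (hullOf {β} U.ω incβ)

  γ : Code 1
  γ = γ-hull.hull

  u≤γ : ∀ i → u i ≤R γ
  u≤γ = γ-hull.row≤

  -- Otherwise β would be below finitely many `u c`. Their common parts with β involve only x c and
  -- b up to c, so a later b would fail to be new.
  incγ : Incomplete γ
  incγ h = let r , q = γ-hull.meet (W β) (≤ₘ-trans (K-top β) h) ≤ₘ-refl in B.new (suc r) (≤ₘ-trans (b≤β (suc r))
    (finJoin-split {W β} {B.Below (suc r)} {λ c → W (u c)} r q (λ c le Q Q≤β Q≤u → let r' , q' = U.meet (incU c) Q Q≤u (≤ₘ-trans Q≤β (β≤Below c)) in
      ≤ₘ-trans {Q} {FinJoin (U.Part c) r'} q' (parts-≤B r' (s≤s le)))))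

  module δ-hull = Hull (hullOf {γ} U.ω incγ)

  δ : Code 1
  δ = δ-hull.hull

  -- δ is a hull over γ, so the common part is below a finite join of the u, and a prime picks one
  -- of them.
  prime-below : ∀ {z} → Prime z → z ≤R γ → z ≤R δ → ∃ λ i → z ≤R u i
  prime-below {z} p h h' = let r , q = δ-hull.meet (W z) h' h
                               i , _ , q' = prime-finJoin {u} {z} r p (≤ₘ-trans q (finJoin-lub {P = λ c → W (u c)} r (λ c le → finJoin-≥ {u} r le))) in i , q'

  top-u : ∀ i → MaxPrime γ δ (u i)
  top-u i = prime (u-prime i) , u≤γ i , δ-hull.row≤ i , λ z p z≤γ z≤δ u≤z → let j , z≤u = prime-below p z≤γ z≤δ in
    subst (λ j → z ≤R u j) (sym (u-antichain (≤ₘ-trans u≤z z≤u))) z≤u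

  top-is-u : ∀ {a} → MaxPrime γ δ a → ∃ λ i → a ≡R u i
  top-is-u {a} (p , a≤γ , a≤δ , max) = let i , a≤u = prime-below p a≤γ a≤δ in
    i , a≤u , max (u i) (prime (u-prime i)) (u≤γ i) (δ-hull.row≤ i) a≤u

-- Formulas and automorphisms

open Aut renaming (map to app)

≤R-refl : ∀ {a} → a ≤R a
≤R-refl = ≤ₘ-refl

≤R-trans : ∀ {a b c} → a ≤R b → b ≤R c → a ≤R c
≤R-trans = ≤ₘ-trans

≡R-refl : ∀ {a} → a ≡R a
≡R-refl {a} = ≤R-refl {a} , ≤R-refl {a}

≡R-sym : ∀ {a b} → a ≡R b → b ≡R a
≡R-sym (p , q) = q , p

≡R-trans : ∀ {a b c} → a ≡R b → b ≡R c → a ≡R c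
≡R-trans {a} {b} {c} (p , q) (p' , q') = ≤R-trans {a} {b} {c} p p' , ≤R-trans {c} {b} {a} q' q

app-≤ : ∀ (Φ : Aut) {a b} → a ≤R b → app Φ a ≤R app Φ b
app-≤ Φ = Equivalence.to (order Φ _ _)

app-≤⁻ : ∀ (Φ : Aut) {a b} → app Φ a ≤R app Φ b → a ≤R b
app-≤⁻ Φ = Equivalence.from (order Φ _ _)

app-≡ : ∀ (Φ : Aut) {a b} → a ≡R b → app Φ a ≡R app Φ b
app-≡ Φ (p , q) = app-≤ Φ p , app-≤ Φ q

module _ (Φ : Aut) where

  Matches : ∀ {n} → Vec (Code 1) n → Vec (Code 1) n → Set
  Matches ρ σ = ∀ i → app Φ (lookup ρ i) ≡R lookup σ i

  private
    extend : ∀ {n} {ρ σ : Vec (Code 1) n} {d d'} → app Φ d ≡R d' → Matches ρ σ → Matches (d ∷ ρ) (d' ∷ σ)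
    extend e m zero = e
    extend e m (suc i) = m i

    ≤-transport : ∀ {a b c d} → app Φ a ≡R c → app Φ b ≡R d → (a ≤R b) ⟺ (c ≤R d)
    ≤-transport {a} {b} {c} {d} (p , p') (q , q') =
      (λ h → ≤R-trans {c} {app Φ a} {d} p' (≤R-trans {app Φ a} {app Φ b} {d} (app-≤ Φ h) q)) ,
      (λ h → app-≤⁻ Φ (≤R-trans {app Φ a} {c} {app Φ b} p (≤R-trans {c} {d} {app Φ b} h q')))

  Sat-invariant : ∀ {n} (φ : Formula n) {ρ σ} → Matches ρ σ → Sat φ ρ ⟺ Sat φ σ
  Sat-invariant (i ≐ j) m = (λ { (p , q) → proj₁ (≤-transport (m i) (m j)) p , proj₁ (≤-transport (m j) (m i)) q }) ,
                            (λ { (p , q) → proj₂ (≤-transport (m i) (m j)) p , proj₂ (≤-transport (m j) (m i)) q })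
  Sat-invariant (i ≼ j) m = ≤-transport (m i) (m j)
  Sat-invariant ⊥f m = (λ p → p) , (λ p → p)
  Sat-invariant (¬f φ) m = let f , g = Sat-invariant φ m in (λ n p → n (g p)) , (λ n p → n (f p))
  Sat-invariant (φ ∧f ψ) m = let f , g = Sat-invariant φ m ; f' , g' = Sat-invariant ψ m in
    (λ { (p , q) → f p , f' q }) , (λ { (p , q) → g p , g' q })
  Sat-invariant (φ ∨f ψ) m = let f , g = Sat-invariant φ m ; f' , g' = Sat-invariant ψ m in map f f' , map g g'
  Sat-invariant (φ ⇒f ψ) m = let f , g = Sat-invariant φ m ; f' , g' = Sat-invariant ψ m in
    (λ h p → f' (h (g p))) , (λ h p → g' (h (f p)))
  Sat-invariant (∀f φ) m = (λ h d → let a , e = onto Φ d in proj₁ (Sat-invariant φ (extend e m)) (h a)) ,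
                           (λ h d → proj₂ (Sat-invariant φ (extend (≡R-refl {app Φ d}) m)) (h (app Φ d)))
  Sat-invariant (∃f φ) m = (λ { (d , p) → app Φ d , proj₁ (Sat-invariant φ (extend (≡R-refl {app Φ d}) m)) p }) ,
                           (λ { (d , p) → let a , e = onto Φ d in a , proj₂ (Sat-invariant φ (extend e m)) p })

-- The connectives of Formula come without fixities.
infixr 5 _⇒_
_⇒_ : ∀ {n} → Formula n → Formula n → Formula n
_⇒_ = _⇒f_
infixr 7 _∧_
_∧_ : ∀ {n} → Formula n → Formula n → Formula n
_∧_ = _∧f_

infix 30 ↑_
↑_ : ∀ {n} → Fin n → Fin (suc n)
↑_ = suc

primeF : ∀ {n} → Fin n → Formula n
primeF z = ∀f (∀f (∀f ((#2 ≼ #0) ⇒ (#1 ≼ #0) ⇒ (↑ ↑ ↑ z ≼ #0)) ⇒ ((↑ ↑ z ≼ #1) ∨f (↑ ↑ z ≼ #0))))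

maxPrimeF : ∀ {n} → (c d a : Fin n) → Formula n
maxPrimeF c d a = primeF a ∧ (a ≼ c) ∧ (a ≼ d) ∧ ∀f (primeF #0 ⇒ (#0 ≼ ↑ c) ⇒ (#0 ≼ ↑ d) ⇒ (↑ a ≼ #0) ⇒ (#0 ≼ ↑ a))

meetF : ∀ {n} → (e a x : Fin n) → Formula n
meetF e a x = (x ≼ e) ∧ (x ≼ a) ∧ ∀f ((#0 ≼ ↑ e) ⇒ (#0 ≼ ↑ a) ⇒ (#0 ≼ ↑ x))

beforeF : ∀ {n} → (b a a' : Fin n) → Formula n
beforeF b a a' = ∀f ((#0 ≼ ↑ b) ⇒ (#0 ≼ ↑ a) ⇒ (#0 ≼ ↑ a'))

Joined : (w a τ : Code 1) → Set
Joined w a τ = ∃ λ z → Prime z × (z ≤R w) × (a ≤R z) × (τ ≤R z)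

joinedF : ∀ {n} → (w a τ : Fin n) → Formula n
joinedF w a τ = ∃f (primeF #0 ∧ (#0 ≼ ↑ w) ∧ (↑ a ≼ #0) ∧ (↑ τ ≼ #0))

-- The maximal primes below t serve as names τ. Below w and w', primes bounding both an element and
-- a name attach that name to elements of the two sides.
Linked : (t w w' a a' : Code 1) → Set
Linked t w w' a a' = ∃ λ τ → MaxPrime t t τ × Joined w a τ × Joined w' a' τ

linkedF : ∀ {n} → (t w w' a a' : Fin n) → Formula n
linkedF t w w' a a' = ∃f (maxPrimeF (↑ t) (↑ t) #0 ∧ joinedF (↑ w) (↑ a) #0 ∧ joinedF (↑ w') (↑ a') #0)

Precedes : (c d b a a' : Code 1) → Set
Precedes c d b a a' = MaxPrime c d a × Before b a a' × ¬ Before b a' a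

precedesF : ∀ {n} → (c d b a a' : Fin n) → Formula n
precedesF c d b a a' = maxPrimeF c d a ∧ beforeF b a a' ∧ (¬f beforeF b a' a)

-- Closure under predecessors on both sides lets a finite set of links pin down positions: no
-- minimal link can join different ones.
BackAndForth : (c d b c' d' b' t w w' : Code 1) → Set
BackAndForth c d b c' d' b' t w w' = ∀ a a' → MaxPrime c d a → MaxPrime c' d' a' → Linked t w w' a a' →
  (∀ p → Precedes c d b p a → ∃ λ p' → Precedes c' d' b' p' a' × Linked t w w' p p') ×
  (∀ p' → Precedes c' d' b' p' a' → ∃ λ p → Precedes c d b p a × Linked t w w' p p')

backAndForthF : ∀ {n} → (c d b c' d' b' t w w' : Fin n) → Formula n
backAndForthF c d b c' d' b' t w w' = ∀f (∀f (maxPrimeF (↑ ↑ c) (↑ ↑ d) #1 ⇒ maxPrimeF (↑ ↑ c') (↑ ↑ d') #0 ⇒ linkedF (↑ ↑ t) (↑ ↑ w) (↑ ↑ w') #1 #0 ⇒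
  (∀f (precedesF (↑ ↑ ↑ c) (↑ ↑ ↑ d) (↑ ↑ ↑ b) #0 #2 ⇒
    ∃f (precedesF (↑ ↑ ↑ ↑ c') (↑ ↑ ↑ ↑ d') (↑ ↑ ↑ ↑ b') #0 #2 ∧ linkedF (↑ ↑ ↑ ↑ t) (↑ ↑ ↑ ↑ w) (↑ ↑ ↑ ↑ w') #1 #0)) ∧
  (∀f (precedesF (↑ ↑ ↑ c') (↑ ↑ ↑ d') (↑ ↑ ↑ b') #0 #1 ⇒
    ∃f (precedesF (↑ ↑ ↑ ↑ c) (↑ ↑ ↑ ↑ d) (↑ ↑ ↑ ↑ b) #0 (↑ #2) ∧ linkedF (↑ ↑ ↑ ↑ t) (↑ ↑ ↑ ↑ w) (↑ ↑ ↑ ↑ w') #0 #1))))))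

SamePlace : (c d b c' d' b' a a' : Code 1) → Set
SamePlace c d b c' d' b' a a' = ∃ λ t → ∃ λ w → ∃ λ w' → Linked t w w' a a' × BackAndForth c d b c' d' b' t w w'

samePlaceF : ∀ {n} → (c d b c' d' b' a a' : Fin n) → Formula n
samePlaceF c d b c' d' b' a a' = ∃f (∃f (∃f (linkedF #2 #1 #0 (↑ ↑ ↑ a) (↑ ↑ ↑ a') ∧
  backAndForthF (↑ ↑ ↑ c) (↑ ↑ ↑ d) (↑ ↑ ↑ b) (↑ ↑ ↑ c') (↑ ↑ ↑ d') (↑ ↑ ↑ b') #2 #1 #0)))

Corresponds : (e c d b e' c' d' b' x y : Code 1) → Set
Corresponds e c d b e' c' d' b' x y = ∃ λ a → ∃ λ a' → MaxPrime c d a × MaxPrime c' d' a' × Meet e a x × Meet e' a' y × SamePlace c d b c' d' b' a a'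

correspondsF : ∀ {n} → (e c d b e' c' d' b' x y : Fin n) → Formula n
correspondsF e c d b e' c' d' b' x y = ∃f (∃f (maxPrimeF (↑ ↑ c) (↑ ↑ d) #1 ∧ maxPrimeF (↑ ↑ c') (↑ ↑ d') #0 ∧ meetF (↑ ↑ e) #1 (↑ ↑ x) ∧ meetF (↑ ↑ e') #0 (↑ ↑ y) ∧
  samePlaceF (↑ ↑ c) (↑ ↑ d) (↑ ↑ b) (↑ ↑ c') (↑ ↑ d') (↑ ↑ b') #1 #0))

Least : Code 1 → Set
Least e = ∀ d → e ≤R d

leastF : ∀ {n} → Fin n → Formula n
leastF e = ∀f (↑ e ≼ #0)

-- The coding presupposes a nonzero e. For least e the graph consists of the least degree paired
-- with itself.
Graph : (e c d b e' c' d' b' x y : Code 1) → Set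
Graph e c d b e' c' d' b' x y = (Least e × (x ≤R e) × (y ≤R e)) ⊎ (¬ Least e × Corresponds e c d b e' c' d' b' x y)

graphF : ∀ {n} → (e c d b e' c' d' b' x y : Fin n) → Formula n
graphF e c d b e' c' d' b' x y = (leastF e ∧ (x ≼ e) ∧ (y ≼ e)) ∨f ((¬f leastF e) ∧ correspondsF e c d b e' c' d' b' x y)

-- Variables 0 and 1 are x and y; 2 to 5 hold e, γ, δ, β and 6 to 9 their images.
ψ : Formula 10
ψ = graphF #2 #3 #4 #5 #6 #7 #8 #9 #0 #1

-- Ladders, their images, and equality of positions

prime-∨ : ∀ {z a b} → Prime z → z ≤R (a ∨ b) → (z ≤R a) ⊎ (z ≤R b)
prime-∨ {z} {a} {b} p h = p a b (λ m q r → ≤ₘ-trans h (∨-lub {a} {b} {W m} q r))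

before-resp : ∀ {b a a' c c'} → c ≤R a → a' ≤R c' → Before b a a' → Before b c c'
before-resp {b} {a} {a'} {c} {c'} p p' h q q≤b q≤c = ≤R-trans {q} {a'} {c'} (h q q≤b (≤R-trans {q} {c} {a} q≤c p)) p'

joined-resp : ∀ {w a τ a₁ τ₁} → a₁ ≤R a → τ₁ ≤R τ → Joined w a τ → Joined w a₁ τ₁
joined-resp {w} {a} {τ} {a₁} {τ₁} p q (z , pz , z≤ , a≤ , τ≤) = z , pz , z≤ , ≤R-trans {a₁} {a} {z} p a≤ , ≤R-trans {τ₁} {τ} {z} q τ≤

linked-resp : ∀ {t w w' a a' c c'} → c ≤R a → c' ≤R a' → Linked t w w' a a' → Linked t w w' c c'
linked-resp {t} {w} {w'} {a} {a'} {c} {c'} p p' (τ , top , j , j') =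
  τ , top , joined-resp {w} {a} {τ} {c} {τ} p (≤R-refl {τ}) j , joined-resp {w'} {a'} {τ} {c'} {τ} p' (≤R-refl {τ}) j'

-- c and d code the set of the v i, and b codes its order.
record Ladder (c d b : Code 1) (v : ℕ → Code 1) : Set where
  field
    top       : ∀ i → MaxPrime c d (v i)
    only      : ∀ {a} → MaxPrime c d a → ∃ λ i → a ≡R v i
    up        : ∀ {i j} → i ≤ j → Before b (v i) (v j)
    down      : ∀ {i j} → Before b (v i) (v j) → i ≤ j
    antichain : ∀ {i j} → v i ≤R v j → i ≡ j
    nonzero   : ∀ i → NonZero (v i)

  primes : ∀ i → Prime (v i)
  primes i = proj₁ (top i)

  v≤c : ∀ i → v i ≤R c
  v≤c i = proj₁ (proj₂ (top i))

  predecessor : ∀ {p a i} → a ≡R v i → Precedes c d b p a → ∃ λ k → k < i × (p ≡R v k)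
  predecessor {p} {a} {i} e (t , bf , nbf) = let k , e' = only t in
    k , ≰⇒> (λ i≤k → nbf (before-resp {b} {v i} {v k} {a} {p} (proj₁ e) (proj₂ e') (up i≤k))) , e'

  precedes : ∀ {a i k} → a ≡R v i → k < i → Precedes c d b (v k) a
  precedes {a} {i} {k} e lt = top k , before-resp {b} {v k} {v i} {v k} {a} (≤R-refl {v k}) (proj₂ e) (up (<⇒≤ lt)) ,
    λ h → <⇒≱ lt (down (before-resp {b} {a} {v k} {v i} {v k} (proj₂ e) (≤R-refl {v k}) h))

private
  matches₃ : ∀ (Φ : Aut) {a b c a' b' c'} → app Φ a ≡R a' → app Φ b ≡R b' → app Φ c ≡R c' → Matches Φ (a ∷ b ∷ c ∷ []) (a' ∷ b' ∷ c' ∷ [])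
  matches₃ Φ p q r zero = p
  matches₃ Φ p q r (suc zero) = q
  matches₃ Φ p q r (suc (suc zero)) = r

≡R-app : ∀ (Φ : Aut) {a} → app Φ a ≡R app Φ a
≡R-app Φ {a} = ≡R-refl {app Φ a}

-- Being a maximal prime and preceding are first-order, so Φ preserves them; nonzero is preserved as
-- it means not being least.
image : ∀ {c d b v} (Φ : Aut) → Ladder c d b v → Ladder (app Φ c) (app Φ d) (app Φ b) (λ i → app Φ (v i))
image {c} {d} {b} {v} Φ L = record
  { top = λ i → proj₁ (tops (≡R-app Φ {v i})) (L.top i)
  ; only = λ {a} t → let a₀ , e = onto Φ a ; i , e' = L.only (proj₂ (tops {a₀} {a} e) t) in
      i , ≡R-trans {a} {app Φ a₀} {app Φ (v i)} (≡R-sym {app Φ a₀} {a} e) (app-≡ Φ {a₀} {v i} e')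
  ; up = λ le → proj₁ befores (L.up le)
  ; down = λ h → L.down (proj₂ befores h)
  ; antichain = λ h → L.antichain (app-≤⁻ Φ h)
  ; nonzero = λ i h → L.nonzero i (≤ₘ-trans (app-≤⁻ Φ {v i} {𝟎} (≤ₘ-trans h ∅-least)) 𝟎≤∅) }
  where
  module L = Ladder L
  tops : ∀ {a a'} → app Φ a ≡R a' → MaxPrime c d a ⟺ MaxPrime (app Φ c) (app Φ d) a'
  tops {a} {a'} e = Sat-invariant Φ {3} (maxPrimeF #0 #1 #2) {c ∷ d ∷ a ∷ []} {app Φ c ∷ app Φ d ∷ a' ∷ []} (matches₃ Φ (≡R-app Φ {c}) (≡R-app Φ {d}) e)
  befores : ∀ {i j} → Before b (v i) (v j) ⟺ Before (app Φ b) (app Φ (v i)) (app Φ (v j))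
  befores {i} {j} = Sat-invariant Φ {3} (beforeF #0 #1 #2) {b ∷ v i ∷ v j ∷ []} {app Φ b ∷ app Φ (v i) ∷ app Φ (v j) ∷ []}
    (matches₃ Φ (≡R-app Φ {b}) (≡R-app Φ {v i}) (≡R-app Φ {v j}))

-- Suppose i < j. Then `v' i` precedes `v' j` and must be linked to some `v k` with k < i, for which
-- induction gives k = i. The case j < i is similar, by the other half of the system.
same-index : ∀ {c d b v c' d' b' v' t w w'} → Ladder c d b v → Ladder c' d' b' v' → BackAndForth c d b c' d' b' t w w' →
             ∀ i j → Linked t w w' (v i) (v' j) → i ≡ j
same-index {c} {d} {b} {v} {c'} {d'} {b'} {v'} {t} {w} {w'} L L' bf = <-rec _ go
  where
  module L = Ladder L
  module L' = Ladder L'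
  go : ∀ i → (∀ {k} → k < i → ∀ j → Linked t w w' (v k) (v' j) → k ≡ j) → ∀ j → Linked t w w' (v i) (v' j) → i ≡ j
  go i ih j l with <-cmp i j
  ... | tri≈ _ e _ = e
  ... | tri< lt _ _ = let p , pr , l' = proj₂ (bf (v i) (v' j) (L.top i) (L'.top j) l) (v' i) (L'.precedes (≡R-refl {v' j}) lt)
                          k , k<i , e = L.predecessor (≡R-refl {v i}) pr in
      ⊥-elim (<-irrefl (ih k<i i (linked-resp {t} {w} {w'} {p} {v' i} {v k} {v' i} (proj₂ e) (≤R-refl {v' i}) l')) k<i)
  ... | tri> _ _ gt = let p , pr , l' = proj₁ (bf (v i) (v' j) (L.top i) (L'.top j) l) (v j) (L.precedes (≡R-refl {v i}) gt)
                          k , k<j , e = L'.predecessor (≡R-refl {v' j}) pr in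
      ⊥-elim (<-irrefl (sym (ih gt k (linked-resp {t} {w} {w'} {v j} {p} {v j} {v' k} (≤R-refl {v j}) (proj₂ e) l'))) k<j)

-- Existence of a finite system up to n

module Linking (em : ExcludedMiddle 0ℓ) (K≰∅ : ¬ (K ≤ₘ ∅)) (s : Code 1) (incS : Incomplete s) (nzS : NonZero s) (n : ℕ) where
  open Degrees em K≰∅

  module T = Independent (independent incS nzS)

  t : ℕ → Code 1
  t = Row T.ω

  t̂ : Code 1
  t̂ = finJoin t n

  inc : Incomplete (s ∨ t̂)
  inc h = T.incomplete (suc n) (≤ₘ-trans h (∨-lub (T.base (suc n)) (finJoin-≤ {t} n (λ c le → T.earlier (s≤s le)))))

  t-prime : ∀ j → Prime (t j)
  t-prime j = prime (T.prime j)

  top-t : ∀ {j} → j ≤ n → MaxPrime t̂ t̂ (t j)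
  top-t {j} le = t-prime j , finJoin-≥ {t} n le , finJoin-≥ {t} n le , λ z pz z≤ _ t≤z → let l , _ , z≤t = prime-finJoin {t} n pz z≤ in
    subst (λ j → z ≤R t j) (sym (T.incomparable (≤ₘ-trans t≤z z≤t))) z≤t

  top-is-t : ∀ {τ} → MaxPrime t̂ t̂ τ → ∃ λ j → j ≤ n × (t j ≤R τ)
  top-is-t {τ} (p , τ≤ , _ , max) = let j , le , h = prime-finJoin {t} n p τ≤ in
    j , le , max (t j) (t-prime j) (finJoin-≥ {t} n le) (finJoin-≥ {t} n le) h

  module Family {c d b v} (L : Ladder c d b v) (c≤s : c ≤R s) where
    module L = Ladder L

    v≤s : ∀ k → v k ≤R s
    v≤s k = ≤R-trans {v k} {c} {s} (L.v≤c k) c≤s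

    -- The base `s ∨ t̂` bounds both ladder and names, so that below it the hull contains nothing
    -- beyond `v j ∨ t j`.
    module H j = Hull₁ (hull₁Of {s ∨ t̂} (v j ∨ t j) inc)

    w : Code 1
    w = finJoin H.hull n

    joined : ∀ {j} → j ≤ n → Joined w (v j) (t j)
    joined {j} le = H.hull j , prime (H.prime j) , finJoin-≥ {H.hull} n le , ≤ₘ-trans ∨-upperˡ (H.above j) , ≤ₘ-trans ∨-upperʳ (H.above j)

    -- A prime below w is below a single hull, say the l-th. So `v k` and `t j` are below
    -- `v l ∨ t l`, and as they are prime, independence of the t from s leaves only k = l and j = l.
    joined-index : ∀ {j k} → j ≤ n → Joined w (v k) (t j) → k ≡ j
    joined-index {j} {k} le (z , pz , z≤w , v≤z , t≤z) = trans k≡l (sym j≡l)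
      where
      found : ∃ λ l → l ≤ n × (z ≤R H.hull l)
      found = prime-finJoin {H.hull} n pz z≤w
      l : ℕ
      l = proj₁ found
      z≤ : z ≤R H.hull l
      z≤ = proj₂ (proj₂ found)
      j≡l : j ≡ l
      j≡l = [ (λ h → ⊥-elim (T.new j (≤ₘ-trans (≤R-trans {t j} {v l} {s} h (v≤s l)) (T.base j)))) , T.incomparable ]′
        (prime-∨ {t j} {v l} {t l} (t-prime j) (H.meet l (W (t j)) (≤ₘ-trans t≤z z≤)
          (≤R-trans {t j} {t̂} {s ∨ t̂} (finJoin-≥ {t} n le) ∨-upperʳ)))
      k≡l : k ≡ l
      k≡l = [ L.antichain , (λ h → ⊥-elim (L.nonzero k (T.meet l (W (v k)) h (≤ₘ-trans (v≤s k) (T.base l))))) ]′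
        (prime-∨ {v k} {v l} {t l} (L.primes k) (H.meet l (W (v k)) (≤ₘ-trans v≤z z≤) (≤R-trans {v k} {s} {s ∨ t̂} (v≤s k) ∨-upperˡ)))

  module _ {c d b v c' d' b' v'} (L : Ladder c d b v) (L' : Ladder c' d' b' v') (c≤s : c ≤R s) (c'≤s : c' ≤R s) where
    private
      module L = Ladder L
      module L' = Ladder L'
      module F = Family L c≤s
      module F' = Family L' c'≤s

      linked : ∀ {j} → j ≤ n → Linked t̂ F.w F'.w (v j) (v' j)
      linked {j} le = t j , top-t le , F.joined le , F'.joined le

      linked-index : ∀ {k l} → Linked t̂ F.w F'.w (v k) (v' l) → k ≡ l × k ≤ n
      linked-index {k} {l} (τ , top , j₁ , j₂) = trans k≡j (sym l≡j) , subst (_≤ n) (sym k≡j) le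
        where
        found = top-is-t top
        j = proj₁ found
        le = proj₁ (proj₂ found)
        k≡j : k ≡ j
        k≡j = F.joined-index le (joined-resp {F.w} {v k} {τ} {v k} {t j} (≤R-refl {v k}) (proj₂ (proj₂ found)) j₁)
        l≡j : l ≡ j
        l≡j = F'.joined-index le (joined-resp {F'.w} {v' l} {τ} {v' l} {t j} (≤R-refl {v' l}) (proj₂ (proj₂ found)) j₂)

      back-and-forth : BackAndForth c d b c' d' b' t̂ F.w F'.w
      back-and-forth a a' ta ta' l = (λ p pr → forth' p (L.predecessor (proj₂ A) pr)) , (λ p' pr → back' p' (L'.predecessor (proj₂ A') pr))
        where
        A = L.only ta
        A' = L'.only ta'
        k = proj₁ A
        k' = proj₁ A'
        same : k ≡ k' × k ≤ n
        same = linked-index (linked-resp {t̂} {F.w} {F'.w} {a} {a'} {v k} {v' k'} (proj₂ (proj₂ A)) (proj₂ (proj₂ A')) l)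
        forth' : ∀ p → (∃ λ m → m < k × (p ≡R v m)) → ∃ λ p' → Precedes c' d' b' p' a' × Linked t̂ F.w F'.w p p'
        forth' p (m , lt , e) = v' m , L'.precedes (proj₂ A') (subst (m <_) (proj₁ same) lt) ,
          linked-resp {t̂} {F.w} {F'.w} {v m} {v' m} {p} {v' m} (proj₁ e) (≤R-refl {v' m}) (linked (≤-trans (<⇒≤ lt) (proj₂ same)))
        back' : ∀ p' → (∃ λ m → m < k' × (p' ≡R v' m)) → ∃ λ p → Precedes c d b p a × Linked t̂ F.w F'.w p p'
        back' p' (m , lt' , e) = v m , L.precedes (proj₂ A) lt ,
          linked-resp {t̂} {F.w} {F'.w} {v m} {v' m} {v m} {p'} (≤R-refl {v m}) (proj₁ e) (linked (≤-trans (<⇒≤ lt) (proj₂ same)))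
          where
          lt : m < k
          lt = subst (m <_) (sym (proj₁ same)) lt'

    samePlace : SamePlace c d b c' d' b' (v n) (v' n)
    samePlace = t̂ , F.w , F'.w , linked ≤-refl , back-and-forth

-- The graph of Φ below e

module Main (em : ExcludedMiddle 0ℓ) (e : Code 1) (incE : Incomplete e) (nzE : NonZero e) (Φ : Aut) where

  K≰∅ : ¬ (K ≤ₘ ∅)
  K≰∅ h = nzE (≤ₘ-trans (K-top e) h)

  open Degrees em K≰∅
  open Structure em K≰∅ e incE nzE

  ladder : Ladder γ δ β u
  ladder = record { top = top-u ; only = top-is-u ; up = before ; down = before⁻ ; antichain = u-antichain ; nonzero = u-nonzero }

  incΦ : ∀ {a} → Incomplete a → Incomplete (app Φ a)
  incΦ {a} inc h = inc (app-≤⁻ Φ {universal} {a} (≤ₘ-trans (K-top (app Φ universal)) h))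

  -- A common bound of both ladders, so that the names chosen over it are independent of both.
  s : Code 1
  s = γ ∨ app Φ γ

  s-nonzero : NonZero s
  s-nonzero h = u-nonzero 0 (≤ₘ-trans (u≤γ 0) (≤ₘ-trans {W γ} {W s} ∨-upperˡ h))

  meets : ∀ {a x} → Meet e a x ⟺ Meet (app Φ e) (app Φ a) (app Φ x)
  meets {a} {x} = Sat-invariant Φ {3} (meetF #0 #1 #2) {e ∷ a ∷ x ∷ []} {app Φ e ∷ app Φ a ∷ app Φ x ∷ []}
    (matches₃ Φ (≡R-app Φ {e}) (≡R-app Φ {a}) (≡R-app Φ {x}))

  meet-resp : ∀ {e a x a' x'} → a ≡R a' → x ≡R x' → Meet e a x → Meet e a' x'
  meet-resp {e} {a} {x} {a'} {x'} (p , p') (q , q') (h , h' , g) = ≤R-trans {x'} {x} {e} q' h , ≤R-trans {x'} {a} {a'} (≤R-trans {x'} {x} {a} q' h') p ,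
    λ r r≤e r≤a → ≤R-trans {r} {x} {x'} (g r r≤e (≤R-trans {r} {a'} {a} r≤a p')) q

  meet-unique : ∀ {e a x x'} → Meet e a x → Meet e a x' → x ≡R x'
  meet-unique {e} {a} {x} {x'} (p , q , m) (p' , q' , m') = m' x p q , m x' p' q'

  -- The system forces both maximal primes to have one index i; then y is the meet of the images of
  -- e and `u i`, which is the image of their meet x. Conversely each x below e is the meet of e
  -- with some `u i`.
  correct : ∀ x y → Corresponds e γ δ β (app Φ e) (app Φ γ) (app Φ δ) (app Φ β) x y ⟺ ((x ≤R e) × (y ≡R app Φ x))
  correct a y = to , from
    where
    ladder' = image Φ ladder
    to : Corresponds e γ δ β (app Φ e) (app Φ γ) (app Φ δ) (app Φ β) a y → (a ≤R e) × (y ≡R app Φ a)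
    to (a₁ , a₂ , top₁ , top₂ , m₁ , m₂ , t , w , w' , l , bf) = proj₁ m₁ , y≡
      where
      I = Ladder.only ladder top₁
      I' = Ladder.only ladder' top₂
      i = proj₁ I
      j = proj₁ I'
      i≡j : i ≡ j
      i≡j = same-index ladder ladder' bf i j (linked-resp {t} {w} {w'} {a₁} {a₂} {u i} {app Φ (u j)} (proj₂ (proj₂ I)) (proj₂ (proj₂ I')) l)
      m₃ : Meet (app Φ e) (app Φ (u i)) (app Φ a)
      m₃ = proj₁ (meets {u i} {a}) (meet-resp {e} {a₁} {a} {u i} {a} (proj₂ I) (≡R-refl {a}) m₁)
      y≡ : y ≡R app Φ a
      y≡ = meet-unique {app Φ e} {app Φ (u i)} {y} {app Φ a} (subst (λ k → Meet (app Φ e) (app Φ (u k)) y) (sym i≡j)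
             (meet-resp {app Φ e} {a₂} {y} {app Φ (u j)} {y} (proj₂ I') (≡R-refl {y}) m₂)) m₃
    from : (a ≤R e) × (y ≡R app Φ a) → Corresponds e γ δ β (app Φ e) (app Φ γ) (app Φ δ) (app Φ β) a y
    from (a≤e , y≡) = u i , app Φ (u i) , Ladder.top ladder i , Ladder.top ladder' i , m ,
        meet-resp {app Φ e} {app Φ (u i)} {app Φ a} {app Φ (u i)} {y} (≡R-refl {app Φ (u i)}) (≡R-sym {y} {app Φ a} y≡) (proj₁ (meets {u i} {a}) m) ,
        Linking.samePlace em K≰∅ s (∨-incomplete incγ (incΦ incγ)) s-nonzero i ladder ladder' ∨-upperˡ ∨-upperʳ
      where
      found : ∃ λ i → a ≡R x i
      found = ξ-onto a≤e
      i : ℕ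
      i = proj₁ found
      m : Meet e (u i) a
      m = meet-resp {e} {u i} {x i} {u i} {a} (≡R-refl {u i}) (≡R-sym {a} {x i} (proj₂ found)) (u-meet-e i)

least-case : ∀ {e} (Φ : Aut) → Least e → ∀ x y → ((x ≤R e) × (y ≤R e)) ⟺ ((x ≤R e) × (y ≡R app Φ x))
least-case {e} Φ le x y = (λ { (p , q) → p , ≤R-trans {y} {e} {app Φ x} q (le (app Φ x)) , bottom p y }) ,
                          (λ { (p , (q , _)) → p , ≤R-trans {y} {app Φ x} {e} q (bottom p e) })
  where
  bottom : x ≤R e → ∀ d → app Φ x ≤R d
  bottom p d = let a , h = onto Φ d in ≤R-trans {app Φ x} {app Φ a} {d} (app-≤ Φ {x} {a} (≤R-trans {x} {e} {a} p (le a))) (proj₁ h)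

theorem3p6 : ExcludedMiddle 0ℓ →
    Σ ℕ λ k → Σ (Formula (suc (suc k))) λ ψ →
    ∀ (e : Code 1) → e <𝟏 → ∀ (Φ : Aut) →
    Σ (Vec (Code 1) k) λ p →
    ∀ (x y : Code 1) →
    Sat ψ (x ∷ y ∷ p) ⇔ ((x ≤R e) × (y ≡R Aut.map Φ x))
theorem3p6 em = 8 , ψ , λ e e<𝟏 Φ → define e e<𝟏 Φ em
  where
  define : ∀ e → e <𝟏 → (Φ : Aut) → Dec (Least e) → Σ (Vec (Code 1) 8) λ p →
           ∀ (x y : Code 1) → Sat ψ (x ∷ y ∷ p) ⇔ ((x ≤R e) × (y ≡R Aut.map Φ x))
  define e e<𝟏 Φ (yes le) = (e ∷ e ∷ e ∷ e ∷ e ∷ e ∷ e ∷ e ∷ []) , λ x y → mk⇔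
    (λ { (inj₁ (_ , h)) → proj₁ (least-case {e} Φ le x y) h ; (inj₂ (n , _)) → ⊥-elim (n le) })
    (λ h → inj₁ (le , proj₂ (least-case {e} Φ le x y) h))
  define e e<𝟏 Φ (no n) = (e ∷ M.γ ∷ M.δ ∷ M.β ∷ app Φ e ∷ app Φ M.γ ∷ app Φ M.δ ∷ app Φ M.β ∷ []) , λ x y → mk⇔
    (λ { (inj₁ (le , _)) → ⊥-elim (n le) ; (inj₂ (_ , h)) → proj₁ (Q.correct x y) h })
    (λ h → inj₂ (n , proj₂ (Q.correct x y) h))
    where
    incE : Incomplete e
    incE = proj₂ (e<𝟏 universal K-top)
    nzE : NonZero e
    nzE h = n (λ d → ≤ₘ-trans h ∅-least)
    module Q = Main em e incE nzE Φ
    module M = Structure em Q.K≰∅ e incE nzE
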